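{- There are exactly 26 Wilf-equivalence classes of quasi-consecutive patterns of length $5$ (patterns $\sigma_1\sigma_2\sigma_3\sigma_4\text{ - }\sigma_5$ with $\sigma\in S_5$). They are given by the following list, where each class consists of the listed patterns together with their complements: A: 1254-3, 1354-2. B: 1453-2, 1543-2. C: 2135-4, 2145-3. D: 1534-2. E: 2315-4. F: 1243-5, 1253-4, 2134-5, 2354-1, 3145-2, 3245-1. G: 3125-4, 3215-4. H: 1523-4. I: 3251-4. J: 2154-3. K: 1435-2. L: 3124-5, 3214-5, 2543-1, 2453-1, 2341-5, 2431-5, 1342-5, 1432-5, 1352-4, 1452-3, 1532-4, 1542-3, 2531-4, 2541-3, 2351-4, 2451-3. M: 2153-4, 3154-2. N: 2513-4. O: 1524-3. P: 2415-3. Q: 1325-4. R: 1423-5, 2314-5, 2534-1, 3241-5. S: 2143-5, 3254-1. T: 3152-4. U: 1425-3. V: 1324-5, 2435-1. W: 2514-3. X: 2413-5, 3142-5. Y: 1235-4, 1245-3, 1345-2. Z: 1234-5, 2345-1. That is, two quasi-consecutive patterns of length $5$ are Wilf-equivalent if and only if they lie in the same one of these 26 classes.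
   Context: $S_n$ is the set of permutations of $\{1,\dots,n\}$, written in one-line notation. Two sequences $(a_1,\dots,a_k)$, $(b_1,\dots,b_k)$ of positive integers are order-isomorphic, written $a_1\cdots a_k\sim b_1\cdots b_k$, if for all $1\le i,j\le k$ one has $a_i<a_j$ iff $b_i<b_j$. A quasi-consecutive pattern of length $5$ is written $\sigma_1\sigma_2\sigma_3\sigma_4\text{ - }\sigma_5$ with $\sigma=\sigma_1\cdots\sigma_5\in S_5$. A permutation $\pi\in S_n$ contains it if there are indices $1\le i_1<i_2<i_3<i_4<i_5\le n$ with $i_{j+1}=i_j+1$ for $j=1,2,3$ and $\pi_{i_1}\cdots\pi_{i_5}\sim\sigma_1\cdots\sigma_5$ (the first four positions are adjacent, the last one is arbitrary to their right); otherwise $\pi$ avoids it. $S_n(\sigma)$ denotes the set of permutations in $S_n$ avoiding the pattern. Two patterns $\sigma,\tau$ are Wilf-equivalent, $\sigma\equiv\tau$, if $|S_n(\sigma)|=|S_n(\tau)|$ for every positive integer $n$. The complement of $\sigma_1\sigma_2\sigma_3\sigma_4\text{ - }\sigma_5$ is $(6-\sigma_1)(6-\sigma_2)(6-\sigma_3)(6-\sigma_4)\text{ - }(6-\sigma_5)$. In the list only the lexicographically smaller of each pattern and its complement is recorded, so the list has 60 entries representing all 120 patterns. -}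

module Defs where

open import Data.Nat using (ℕ; zero; suc; _∸_; NonZero)
import Data.Nat.Properties as ℕ
open import Data.Fin using (Fin; toℕ; _<_)
open import Data.Fin.Properties using (_≟_; _<?_; any?; all?)
open import Data.Vec using (Vec; []; _∷_; lookup; map)
open import Data.Vec.Relation.Unary.AllPairs using (allPairs?)
open import Data.Vec.Relation.Unary.Unique.Propositional using (Unique)
open import Data.List as List using (List; []; _∷_)
open import Data.List.Membership.Propositional using (_∈_)
open import Data.Product using (Σ; ∃; _×_; <_,_>; uncurry; proj₁)
open import Data.Sum using (_⊎_)
open import Function using (_∘_)
open import Function.Bundles using (_⇔_; mk⇔; Equivalence)
open import Relation.Nullary using (¬_; Dec)
open import Relation.Nullary.Decidable using (map′; ¬?; _×-dec_; _→-dec_)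
open import Relation.Binary.PropositionalEquality using (_≡_)

-- One-line notation: the word (π₁ , … , πₙ).  Positions and values are counted
-- from 0, so `zero : Fin n` plays the role of the number 1.
Word : ℕ → Set
Word n = Vec (Fin n) n

-- n letters in Fin n, pairwise distinct, hence every letter exactly once.
Permutation : ℕ → Set
Permutation n = Σ (Word n) Unique

-- The permutation σ₁…σ₅ stands for the quasi-consecutive pattern σ₁σ₂σ₃σ₄-σ₅.
Pattern : Set
Pattern = Permutation 5

OrderIsomorphic : ∀ {k m n} → Vec (Fin m) k → Vec (Fin n) k → Set
OrderIsomorphic a b = ∀ i j → lookup a i < lookup a j ⇔ lookup b i < lookup b j

IsOccurrence : ∀ {n} → Pattern → Word n → (i₁ i₂ i₃ i₄ i₅ : Fin n) → Set
IsOccurrence σ π i₁ i₂ i₃ i₄ i₅ =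
  toℕ i₂ ≡ suc (toℕ i₁) ×
  toℕ i₃ ≡ suc (toℕ i₂) ×
  toℕ i₄ ≡ suc (toℕ i₃) ×
  i₄ < i₅ ×
  OrderIsomorphic (map (lookup π) (i₁ ∷ i₂ ∷ i₃ ∷ i₄ ∷ i₅ ∷ [])) (proj₁ σ)

Contains : ∀ {n} → Pattern → Word n → Set
Contains σ π =
  ∃ λ i₁ → ∃ λ i₂ → ∃ λ i₃ → ∃ λ i₄ → ∃ λ i₅ → IsOccurrence σ π i₁ i₂ i₃ i₄ i₅

Avoids : ∀ {n} → Pattern → Word n → Set
Avoids σ π = ¬ Contains σ π

orderIsomorphic? : ∀ {k m n} (a : Vec (Fin m) k) (b : Vec (Fin n) k) →
                   Dec (OrderIsomorphic a b)
orderIsomorphic? a b = all? λ i → all? λ j →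
  map′ (uncurry mk⇔) < Equivalence.to , Equivalence.from >
    (((lookup a i <? lookup a j) →-dec (lookup b i <? lookup b j)) ×-dec
     ((lookup b i <? lookup b j) →-dec (lookup a i <? lookup a j)))

contains? : ∀ {n} (σ : Pattern) (π : Word n) → Dec (Contains σ π)
contains? σ π =
  any? λ i₁ → any? λ i₂ → any? λ i₃ → any? λ i₄ → any? λ i₅ →
    (toℕ i₂ ℕ.≟ suc (toℕ i₁)) ×-dec
    (toℕ i₃ ℕ.≟ suc (toℕ i₂)) ×-dec
    (toℕ i₄ ℕ.≟ suc (toℕ i₃)) ×-dec
    (i₄ <? i₅) ×-dec
    orderIsomorphic? (map (lookup π) (i₁ ∷ i₂ ∷ i₃ ∷ i₄ ∷ i₅ ∷ [])) (proj₁ σ)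

avoids? : ∀ {n} (σ : Pattern) (π : Word n) → Dec (Avoids σ π)
avoids? σ π = ¬? (contains? σ π)

unique? : ∀ {m k} (w : Vec (Fin m) k) → Dec (Unique w)
unique? = allPairs? λ x y → ¬? (x ≟ y)

-- All words of length k over Fin m, each listed once.
words : ∀ m k → List (Vec (Fin m) k)
words m zero    = List.[ [] ]
words m (suc k) = List.cartesianProductWith _∷_ (List.allFin m) (words m k)

-- The one-line notations of the elements of Sₙ, and of Sₙ(σ); being
-- repetition-free lists, their lengths are the cardinalities.
S : ∀ n → List (Word n)
S n = List.filter unique? (words n n)

S[_] : Pattern → ∀ n → List (Word n)
S[ σ ] n = List.filter (avoids? σ) (S n)

infix 4 _≡ᵂ_

_≡ᵂ_ : Pattern → Pattern → Set
σ ≡ᵂ τ = ∀ n → .{{NonZero n}} → List.length (S[ σ ] n) ≡ List.length (S[ τ ] n)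

-- Back to the values 1, …, 5.
oneLine : Pattern → Vec ℕ 5
oneLine σ = map (suc ∘ toℕ) (proj₁ σ)

complement : Vec ℕ 5 → Vec ℕ 5
complement = map (6 ∸_)

pat : ℕ → ℕ → ℕ → ℕ → ℕ → Vec ℕ 5
pat a b c d e = a ∷ b ∷ c ∷ d ∷ e ∷ []

-- The classes A, B, …, Z in this order; pat a b c d e is the pattern abcd-e.
-- Of each pattern and its complement only the lexicographically smaller is
-- listed; _∈class_ adds the complements.
classes : Vec (List (Vec ℕ 5)) 26
classes =
  (pat 1 2 5 4 3 ∷ pat 1 3 5 4 2 ∷ []) ∷
  (pat 1 4 5 3 2 ∷ pat 1 5 4 3 2 ∷ []) ∷
  (pat 2 1 3 5 4 ∷ pat 2 1 4 5 3 ∷ []) ∷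
  (pat 1 5 3 4 2 ∷ []) ∷
  (pat 2 3 1 5 4 ∷ []) ∷
  (pat 1 2 4 3 5 ∷ pat 1 2 5 3 4 ∷ pat 2 1 3 4 5 ∷ pat 2 3 5 4 1 ∷
   pat 3 1 4 5 2 ∷ pat 3 2 4 5 1 ∷ []) ∷
  (pat 3 1 2 5 4 ∷ pat 3 2 1 5 4 ∷ []) ∷
  (pat 1 5 2 3 4 ∷ []) ∷
  (pat 3 2 5 1 4 ∷ []) ∷
  (pat 2 1 5 4 3 ∷ []) ∷
  (pat 1 4 3 5 2 ∷ []) ∷
  (pat 3 1 2 4 5 ∷ pat 3 2 1 4 5 ∷ pat 2 5 4 3 1 ∷ pat 2 4 5 3 1 ∷
   pat 2 3 4 1 5 ∷ pat 2 4 3 1 5 ∷ pat 1 3 4 2 5 ∷ pat 1 4 3 2 5 ∷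
   pat 1 3 5 2 4 ∷ pat 1 4 5 2 3 ∷ pat 1 5 3 2 4 ∷ pat 1 5 4 2 3 ∷
   pat 2 5 3 1 4 ∷ pat 2 5 4 1 3 ∷ pat 2 3 5 1 4 ∷ pat 2 4 5 1 3 ∷ []) ∷
  (pat 2 1 5 3 4 ∷ pat 3 1 5 4 2 ∷ []) ∷
  (pat 2 5 1 3 4 ∷ []) ∷
  (pat 1 5 2 4 3 ∷ []) ∷
  (pat 2 4 1 5 3 ∷ []) ∷
  (pat 1 3 2 5 4 ∷ []) ∷
  (pat 1 4 2 3 5 ∷ pat 2 3 1 4 5 ∷ pat 2 5 3 4 1 ∷ pat 3 2 4 1 5 ∷ []) ∷
  (pat 2 1 4 3 5 ∷ pat 3 2 5 4 1 ∷ []) ∷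
  (pat 3 1 5 2 4 ∷ []) ∷
  (pat 1 4 2 5 3 ∷ []) ∷
  (pat 1 3 2 4 5 ∷ pat 2 4 3 5 1 ∷ []) ∷
  (pat 2 5 1 4 3 ∷ []) ∷
  (pat 2 4 1 3 5 ∷ pat 3 1 4 2 5 ∷ []) ∷
  (pat 1 2 3 5 4 ∷ pat 1 2 4 5 3 ∷ pat 1 3 4 5 2 ∷ []) ∷
  (pat 1 2 3 4 5 ∷ pat 2 3 4 5 1 ∷ []) ∷
  []

infix 4 _∈class_

_∈class_ : Pattern → Fin 26 → Set
σ ∈class c =
  oneLine σ ∈ lookup classes c ⊎ complement (oneLine σ) ∈ lookup classes c

{-# OPTIONS --safe #-}

-- A permutation is encoded by its Lehmer code.  Whether its first four letters start
-- an occurrence of σ depends on the first four entries of the code and the length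
-- only: a fifth letter can be found to the right iff some value at all completes the
-- window.  Avoidance thus becomes a condition on windows of four consecutive entries
-- of a code, and inclusion–exclusion over marked inadmissible windows (the cluster
-- method) reduces a Wilf-equivalence to a comparison of clusters.
--   If the windows of a cluster share one letter at most, only their end letters
-- matter; exchanging the two inner letters of σ, or σ₅ with an inner letter of
-- adjacent value, then changes no cluster count.  For 1235-4, 1245-3, 1345-2 a cluster
-- is a chain of weak and strict inequalities, and only their numbers matter.  For
-- 2153-4 and 3154-2 the clusters correspond by raising some of their letters by one.
--   If σ₅ = 5, splitting a permutation at its maximum expresses the count through
-- words that avoid σ₁σ₂σ₃σ₄ consecutively, and these can be reversed and complemented.
--   Conversely, the numbers of avoiding permutations of length 10 tell the classes
-- apart.
module Submission where

open import Defs
open import Algebra.Properties.CommutativeSemigroup using (interchange)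
open import Data.Bool using (Bool; true; false; _∧_; _∨_; not; T; if_then_else_)
open import Data.Bool.ListAction using (any)
open import Data.Bool.Properties using (∧-assoc; ∧-comm; ∧-identityʳ)
open import Data.Empty using (⊥; ⊥-elim)
open import Data.Fin as Fin using (Fin; toℕ)
open import Data.Fin.Patterns using (0F; 1F; 2F; 3F; 4F)
open import Data.Fin.Properties as Fin using (toℕ<n; toℕ-injective; all?; any?)
open import Data.List using (List; []; _∷_; map; length; drop; _++_; reverse; _∷ʳ_; filter; cartesianProductWith; allFin; tabulate)
open import Data.List.Membership.Propositional using (_∈_)
open import Data.List.Membership.Propositional.Properties using (∈-map⁺)
open import Data.List.Properties using (unfold-reverse; reverse-++; ++-assoc; reverse-involutive; map-++; map-∘)
open import Data.List.Relation.Unary.All as All using (All; []; _∷_)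
open import Data.List.Relation.Unary.Any using (here; there)
open import Data.Nat
open import Data.Nat.DivMod using (_mod_)
open import Data.Nat.Induction using (<-rec)
open import Data.Nat.ListAction using (sum)
open import Data.Nat.ListAction.Properties using (sum-++)
open import Data.Nat.Properties
open import Data.Product using (∃; ∃!; ∃₂; _×_; _,_; proj₁; proj₂)
open import Data.Sum using (_⊎_; inj₁; inj₂)
open import Data.Unit using (tt)
open import Data.Vec as Vec using (Vec; []; _∷_; lookup; toList)
open import Data.Vec.Properties using (≡-dec; lookup-map)
open import Data.Vec.Relation.Unary.All as VecAll using ([]; _∷_)
open import Data.Vec.Relation.Unary.All.Properties using (lookup⁺)
open import Data.Vec.Relation.Unary.AllPairs using ([]; _∷_)
open import Data.Vec.Relation.Unary.Unique.Propositional using (Unique)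
open import Function using (_∘_; id; const)
open import Function.Bundles using (_⇔_; mk⇔; Equivalence)
open import Relation.Binary using (tri<; tri≈; tri>)
open import Relation.Binary.PropositionalEquality
open import Relation.Nullary using (¬_; yes; no; Dec; does)
open import Relation.Nullary.Decidable using (T?; toWitness; _×-dec_; _⊎-dec_; _→-dec_)
open import Relation.Unary using (Decidable)

open import Data.List.Membership.DecPropositional (≡-dec {n = 5} _≟_) using (_∈?_)

-- Whether a window is inadmissible depends on the relative order of the letters from it onwards,
-- and the tail of a code is the code of that suffix. Hence one predicate, given the number of
-- remaining letters, serves at every position. The entries of a code also range independently of
-- one another, so that a finished cluster contributes a factor that does not interfere with the
-- rest. All counts stay in ℕ. Instead of an alternating sum, `weight-step` adds the codes with a
-- marked window to those with an admissible one and obtains those with no condition on that window;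
-- the signs turn into cancellation of equal summands. What changes from case to case is only the
-- invariant describing a cluster in progress. `Transfer` asks that it survive a next window
-- starting one, two or three entries later, and that it yield a constant once the cluster ends.

𝟙 : Bool → ℕ
𝟙 true  = 1
𝟙 false = 0

𝟙-∧ : ∀ x y → 𝟙 (x ∧ y) ≡ 𝟙 x * 𝟙 y
𝟙-∧ true  y = sym (+-identityʳ (𝟙 y))
𝟙-∧ false y = refl

T-≡ : ∀ {x y} → (T x → T y) → (T y → T x) → x ≡ y
T-≡ {true}  {true}  _ _ = refl
T-≡ {true}  {false} f _ = ⊥-elim (f tt)
T-≡ {false} {true}  _ g = ⊥-elim (g tt)
T-≡ {false} {false} _ _ = refl

¬T⇒false : ∀ {x} → ¬ T x → x ≡ false
¬T⇒false {true}  h = ⊥-elim (h tt)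
¬T⇒false {false} _ = refl

T⇒true : ∀ {x} → T x → x ≡ true
T⇒true {true} _ = refl

-- Finite sums

infixr 5 ∑
syntax ∑ n (λ i → x) = ∑[ i < n ] x

opaque
  ∑ : ℕ → (ℕ → ℕ) → ℕ
  ∑ zero    f = 0
  ∑ (suc n) f = f 0 + ∑ n (f ∘ suc)

  ∑-nil : ∀ f → ∑ 0 f ≡ 0
  ∑-nil f = refl

  ∑-suc : ∀ n f → ∑ (suc n) f ≡ f 0 + ∑ n (f ∘ suc)
  ∑-suc n f = refl

  ∑-cong : ∀ n {f g : ℕ → ℕ} → (∀ i → i < n → f i ≡ g i) → ∑ n f ≡ ∑ n g
  ∑-cong zero    eq = refl
  ∑-cong (suc n) eq = cong₂ _+_ (eq 0 z<s) (∑-cong n λ i i<n → eq (suc i) (s<s i<n))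

  ∑-zero : ∀ n {f : ℕ → ℕ} → (∀ i → i < n → f i ≡ 0) → ∑ n f ≡ 0
  ∑-zero zero    eq = refl
  ∑-zero (suc n) eq = cong₂ _+_ (eq 0 z<s) (∑-zero n λ i i<n → eq (suc i) (s<s i<n))

  ∑-const0 : ∀ n → ∑ n (const 0) ≡ 0
  ∑-const0 n = ∑-zero n λ _ _ → refl

  ∑-one : ∀ n → ∑ n (const 1) ≡ n
  ∑-one zero    = refl
  ∑-one (suc n) = cong suc (∑-one n)

  ∑-+ : ∀ n (f g : ℕ → ℕ) → ∑ n (λ i → f i + g i) ≡ ∑ n f + ∑ n g
  ∑-+ zero    f g = refl
  ∑-+ (suc n) f g = begin
    (f 0 + g 0) + ∑ n (λ i → f (suc i) + g (suc i))      ≡⟨ cong (f 0 + g 0 +_) (∑-+ n (f ∘ suc) (g ∘ suc)) ⟩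
    (f 0 + g 0) + (∑ n (f ∘ suc) + ∑ n (g ∘ suc))        ≡⟨ interchange +-commutativeSemigroup (f 0) (g 0) _ _ ⟩
    (f 0 + ∑ n (f ∘ suc)) + (g 0 + ∑ n (g ∘ suc))        ∎
    where open ≡-Reasoning

  ∑-*ˡ : ∀ n c (f : ℕ → ℕ) → ∑ n (λ i → c * f i) ≡ c * ∑ n f
  ∑-*ˡ zero    c f = sym (*-zeroʳ c)
  ∑-*ˡ (suc n) c f = trans (cong (c * f 0 +_) (∑-*ˡ n c (f ∘ suc))) (sym (*-distribˡ-+ c (f 0) _))

  ∑-*ʳ : ∀ n c (f : ℕ → ℕ) → ∑ n (λ i → f i * c) ≡ ∑ n f * c
  ∑-*ʳ n c f = begin
    ∑ n (λ i → f i * c)  ≡⟨ ∑-cong n (λ i _ → *-comm (f i) c) ⟩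
    ∑ n (λ i → c * f i)  ≡⟨ ∑-*ˡ n c f ⟩
    c * ∑ n f            ≡⟨ *-comm c _ ⟩
    ∑ n f * c            ∎
    where open ≡-Reasoning

  ∑-swap : ∀ n m (f : ℕ → ℕ → ℕ) → ∑ n (λ i → ∑ m (f i)) ≡ ∑ m (λ j → ∑ n (λ i → f i j))
  ∑-swap zero    m f = sym (∑-const0 m)
  ∑-swap (suc n) m f = begin
    ∑ m (f 0) + ∑ n (λ i → ∑ m (f (suc i)))          ≡⟨ cong (∑ m (f 0) +_) (∑-swap n m (f ∘ suc)) ⟩
    ∑ m (f 0) + ∑ m (λ j → ∑ n (λ i → f (suc i) j))  ≡⟨ sym (∑-+ m _ _) ⟩
    ∑ m (λ j → ∑ (suc n) (λ i → f i j))              ∎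
    where open ≡-Reasoning

  ∑-last : ∀ n (f : ℕ → ℕ) → ∑ (suc n) f ≡ ∑ n f + f n
  ∑-last zero    f = +-identityʳ (f 0)
  ∑-last (suc n) f = trans (cong (f 0 +_) (∑-last n (f ∘ suc))) (sym (+-assoc (f 0) _ _))

  ∑-reverse : ∀ n (f : ℕ → ℕ) → ∑ n (λ i → f (n ∸ suc i)) ≡ ∑ n f
  ∑-reverse zero    f = refl
  ∑-reverse (suc n) f = begin
    f n + ∑ n (λ i → f (n ∸ suc i))  ≡⟨ cong (f n +_) (∑-reverse n f) ⟩
    f n + ∑ n f                      ≡⟨ +-comm (f n) _ ⟩
    ∑ n f + f n                      ≡⟨ sym (∑-last n f) ⟩
    ∑ (suc n) f                      ∎
    where open ≡-Reasoning

  ∑-restrict : ∀ {k n} (f : ℕ → ℕ) → k ≤ n → ∑ n (λ i → 𝟙 (i <ᵇ k) * f i) ≡ ∑ k f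
  ∑-restrict {zero}  {n}     f _        = ∑-const0 n
  ∑-restrict {suc k} {suc n} f (s≤s le) = cong₂ _+_ (+-identityʳ (f 0)) (∑-restrict (f ∘ suc) le)

-- Bounded existence

anyBelow : ℕ → (ℕ → Bool) → Bool
anyBelow zero    p = false
anyBelow (suc n) p = p 0 ∨ anyBelow n (p ∘ suc)

T-∨ˡ : ∀ {x y} → T x → T (x ∨ y)
T-∨ˡ {true} _ = tt

T-∨ʳ : ∀ {x y} → T y → T (x ∨ y)
T-∨ʳ {true}  _ = tt
T-∨ʳ {false} t = t

T-∨⁻ : ∀ {x y} → T (x ∨ y) → T x ⊎ T y
T-∨⁻ {true}  t = inj₁ t
T-∨⁻ {false} t = inj₂ t

T-∧⁺ : ∀ {x y} → T x → T y → T (x ∧ y)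
T-∧⁺ {true} _ t = t

T-∧ˡ : ∀ {x y} → T (x ∧ y) → T x
T-∧ˡ {true} _ = tt

T-∧ʳ : ∀ {x y} → T (x ∧ y) → T y
T-∧ʳ {true} t = t

anyBelow⁺ : ∀ {n} (p : ℕ → Bool) {v} → v < n → T (p v) → T (anyBelow n p)
anyBelow⁺ p {zero}  (s≤s _)  t = T-∨ˡ t
anyBelow⁺ p {suc v} (s≤s lt) t = T-∨ʳ {p 0} (anyBelow⁺ (p ∘ suc) lt t)

anyBelow⁻ : ∀ n (p : ℕ → Bool) → T (anyBelow n p) → ∃ λ v → v < n × T (p v)
anyBelow⁻ (suc n) p t with T-∨⁻ {p 0} t
... | inj₁ t₀ = 0 , z<s , t₀
... | inj₂ t₁ with v , lt , tv ← anyBelow⁻ n (p ∘ suc) t₁ = suc v , s<s lt , tv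

-- The increasing enumeration of ℕ ∖ {a}, that is, punchIn on ℕ.
pin : ℕ → ℕ → ℕ
pin zero    x       = suc x
pin (suc a) zero    = zero
pin (suc a) (suc x) = suc (pin a x)

pin-<ᵇ : ∀ a x y → (pin a x <ᵇ pin a y) ≡ (x <ᵇ y)
pin-<ᵇ zero    x       y       = refl
pin-<ᵇ (suc a) zero    zero    = refl
pin-<ᵇ (suc a) zero    (suc y) = refl
pin-<ᵇ (suc a) (suc x) zero    = refl
pin-<ᵇ (suc a) (suc x) (suc y) = pin-<ᵇ a x y

<ᵇ-pin : ∀ a x → (a <ᵇ pin a x) ≡ (a <ᵇ suc x)
<ᵇ-pin zero    x       = refl
<ᵇ-pin (suc a) zero    = refl
<ᵇ-pin (suc a) (suc x) = <ᵇ-pin a x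

pin-<ᵇ-self : ∀ a x → (pin a x <ᵇ a) ≡ (x <ᵇ a)
pin-<ᵇ-self zero    x       = refl
pin-<ᵇ-self (suc a) zero    = refl
pin-<ᵇ-self (suc a) (suc x) = pin-<ᵇ-self a x

pin≢ : ∀ a x → pin a x ≢ a
pin≢ (suc a) (suc x) eq = pin≢ a x (suc-injective eq)

pin-injective : ∀ a {x y} → pin a x ≡ pin a y → x ≡ y
pin-injective zero    eq = suc-injective eq
pin-injective (suc a) {zero}  {zero}  eq = refl
pin-injective (suc a) {suc x} {suc y} eq = cong suc (pin-injective a (suc-injective eq))

pin< : ∀ {n} a {x} → x < n → pin a x < suc n
pin< zero    lt       = s<s lt
pin< (suc a) {zero}  lt       = z<s
pin< (suc a) {suc x} (s≤s lt) = s<s (pin< a lt)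

pin-≥ : ∀ {a x} → a ≤ x → pin a x ≡ suc x
pin-≥ {zero}  {x}     _        = refl
pin-≥ {suc a} {suc x} (s≤s le) = cong suc (pin-≥ le)

pin-< : ∀ {a x} → x < a → pin a x ≡ x
pin-< {suc a} {zero}  _        = refl
pin-< {suc a} {suc x} (s≤s lt) = cong suc (pin-< lt)

pin-surjective : ∀ {n} a {v} → v < suc n → a < suc n → v ≢ a → ∃ λ x → x < n × pin a x ≡ v
pin-surjective zero {zero}  _ _ ne = ⊥-elim (ne refl)
pin-surjective zero {suc v} (s≤s lt) _ _ = v , lt , refl
pin-surjective {suc n} (suc a) {zero}  _ _ _ = 0 , z<s , refl
pin-surjective {suc n} (suc a) {suc v} (s≤s lt) (s≤s la) ne
  with x , lx , eq ← pin-surjective a lt la (ne ∘ cong suc) = suc x , s<s lx , cong suc eq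
pin-surjective {zero} (suc a) _ (s≤s ()) _

opaque
  unfolding ∑

  -- `pin a` runs through all values up to n except a, and the missing term is zero.
  ∑-pin : ∀ n a (f : ℕ → ℕ) → a ≤ n → f a ≡ 0 → ∑ n (f ∘ pin a) ≡ ∑ (suc n) f
  ∑-pin n       zero    f _        eq = sym (cong (_+ ∑ n (f ∘ suc)) eq)
  ∑-pin (suc n) (suc a) f (s≤s le) eq = cong (f 0 +_) (∑-pin n a (f ∘ suc) le eq)

-- Lehmer codes

-- A code over M lists choices e₁ < M, e₂ < M ∸ 1, …; the letter chosen by eᵢ is
-- the eᵢ-th smallest of those still unused.
decode : List ℕ → List ℕ
decode []       = []
decode (e ∷ es) = e ∷ map (pin e) (decode es)

data Code : ℕ → ℕ → List ℕ → Set where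
  []  : ∀ {M} → Code M 0 []
  _∷_ : ∀ {M L e es} → e < suc M → Code M L es → Code (suc M) (suc L) (e ∷ es)

opaque
  ∑ᶜ : ℕ → ℕ → (List ℕ → ℕ) → ℕ
  ∑ᶜ M       zero    F = F []
  ∑ᶜ zero    (suc L) F = 0
  ∑ᶜ (suc M) (suc L) F = ∑[ e < suc M ] ∑ᶜ M L (F ∘ (e ∷_))

  ∑ᶜ-nil : ∀ M F → ∑ᶜ M 0 F ≡ F []
  ∑ᶜ-nil M F = refl

  ∑ᶜ-suc : ∀ M L F → ∑ᶜ (suc M) (suc L) F ≡ ∑[ e < suc M ] ∑ᶜ M L (F ∘ (e ∷_))
  ∑ᶜ-suc M L F = refl

  ∑ᶜ-cong : ∀ M L {F G} → (∀ es → Code M L es → F es ≡ G es) → ∑ᶜ M L F ≡ ∑ᶜ M L G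
  ∑ᶜ-cong M       zero    eq = eq [] []
  ∑ᶜ-cong zero    (suc L) eq = refl
  ∑ᶜ-cong (suc M) (suc L) eq = ∑-cong (suc M) λ e lt → ∑ᶜ-cong M L λ es c → eq (e ∷ es) (lt ∷ c)

  ∑ᶜ-zero : ∀ M L {F} → (∀ es → Code M L es → F es ≡ 0) → ∑ᶜ M L F ≡ 0
  ∑ᶜ-zero M       zero    eq = eq [] []
  ∑ᶜ-zero zero    (suc L) eq = refl
  ∑ᶜ-zero (suc M) (suc L) eq = ∑-zero (suc M) λ e lt → ∑ᶜ-zero M L λ es c → eq (e ∷ es) (lt ∷ c)

  ∑ᶜ-+ : ∀ M L F G → ∑ᶜ M L (λ es → F es + G es) ≡ ∑ᶜ M L F + ∑ᶜ M L G
  ∑ᶜ-+ M       zero    F G = refl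
  ∑ᶜ-+ zero    (suc L) F G = refl
  ∑ᶜ-+ (suc M) (suc L) F G = trans (∑-cong (suc M) λ e _ → ∑ᶜ-+ M L (F ∘ (e ∷_)) (G ∘ (e ∷_))) (∑-+ (suc M) (λ e → ∑ᶜ M L (F ∘ (e ∷_))) (λ e → ∑ᶜ M L (G ∘ (e ∷_))))

  ∑ᶜ-*ˡ : ∀ M L c F → ∑ᶜ M L (λ es → c * F es) ≡ c * ∑ᶜ M L F
  ∑ᶜ-*ˡ M       zero    c F = refl
  ∑ᶜ-*ˡ zero    (suc L) c F = sym (*-zeroʳ c)
  ∑ᶜ-*ˡ (suc M) (suc L) c F = trans (∑-cong (suc M) λ e _ → ∑ᶜ-*ˡ M L c (F ∘ (e ∷_))) (∑-*ˡ (suc M) c (λ e → ∑ᶜ M L (F ∘ (e ∷_))))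

  ∑ᶜ-∑ : ∀ M L n (F : ℕ → List ℕ → ℕ) → ∑[ i < n ] ∑ᶜ M L (F i) ≡ ∑ᶜ M L (λ es → ∑[ i < n ] F i es)
  ∑ᶜ-∑ M       zero    n F = refl
  ∑ᶜ-∑ zero    (suc L) n F = ∑-const0 n
  ∑ᶜ-∑ (suc M) (suc L) n F = begin
    (∑[ i < n ] ∑[ e < suc M ] ∑ᶜ M L (F i ∘ (e ∷_)))      ≡⟨ ∑-swap n (suc M) (λ i e → ∑ᶜ M L (F i ∘ (e ∷_))) ⟩
    (∑[ e < suc M ] ∑[ i < n ] ∑ᶜ M L (F i ∘ (e ∷_)))      ≡⟨ ∑-cong (suc M) (λ e _ → ∑ᶜ-∑ M L n (λ i → F i ∘ (e ∷_))) ⟩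
    (∑[ e < suc M ] ∑ᶜ M L (λ es → ∑[ i < n ] F i (e ∷ es))) ∎
    where open ≡-Reasoning

-- Clusters

push : ℕ → (List ℕ → ℕ) → List ℕ → ℕ
push m ψ es = ∑[ e < m ] ψ (e ∷ es)

-- Since G does not see the first entry, that entry can be summed out inside ψ.
∑ᶜ-push : ∀ M L ψ (G : List ℕ → ℕ) →
          ∑ᶜ (suc M) (suc L) (λ es → ψ es * G (drop 1 es)) ≡
          ∑ᶜ M L (λ es → push (suc M) ψ es * G es)
∑ᶜ-push M L ψ G = begin
  ∑ᶜ (suc M) (suc L) (λ es → ψ es * G (drop 1 es))    ≡⟨ ∑ᶜ-suc M L _ ⟩
  (∑[ e < suc M ] ∑ᶜ M L (λ es → ψ (e ∷ es) * G es))  ≡⟨ ∑ᶜ-∑ M L (suc M) (λ e es → ψ (e ∷ es) * G es) ⟩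
  ∑ᶜ M L (λ es → ∑[ e < suc M ] ψ (e ∷ es) * G es)    ≡⟨ ∑ᶜ-cong M L (λ es _ → ∑-*ʳ (suc M) (G es) (λ e → ψ (e ∷ es))) ⟩
  ∑ᶜ M L (λ es → push (suc M) ψ es * G es)            ∎
  where open ≡-Reasoning

-- Words whose admissibility is decided by a predicate b on the windows of four
-- consecutive entries of the code, the first argument of b being the number of
-- letters from the window to the end.
module Windows (b : ℕ → ℕ → ℕ → ℕ → ℕ → Bool) where

  marked : ℕ → List ℕ → Bool
  marked m (e₁ ∷ e₂ ∷ e₃ ∷ e₄ ∷ _) = b m e₁ e₂ e₃ e₄
  marked m _                       = false

  weight : ℕ → List ℕ → ℕ
  weight m []       = 1
  weight m (e ∷ es) = 𝟙 (not (marked m (e ∷ es))) * weight (pred m) es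

  count : ℕ → ℕ
  count n = ∑ᶜ n n (weight n)

  cut : ℕ → (List ℕ → ℕ) → List ℕ → ℕ
  cut m φ es = φ es * 𝟙 (marked m es)

  -- Codes with a mark on an inadmissible first window and no inadmissible window
  -- after it; φ collects the contributions of marked windows further left.
  clusters : ℕ → (List ℕ → ℕ) → ℕ
  clusters m φ = ∑ᶜ m m (λ es → cut m φ es * weight (pred m) (drop 1 es))

  clusters-< : ∀ {m} φ → m < 4 → clusters m φ ≡ 0
  clusters-< {m} φ lt = ∑ᶜ-zero m m λ es c →
    cong (_* weight (pred m) (drop 1 es)) (trans (cong (λ x → φ es * 𝟙 x) (short lt c)) (*-zeroʳ (φ es)))
    where
    short : ∀ {m M es} → m < 4 → Code M m es → marked m es ≡ false
    short _ []                  = refl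
    short _ (_ ∷ [])            = refl
    short _ (_ ∷ _ ∷ [])        = refl
    short _ (_ ∷ _ ∷ _ ∷ [])    = refl
    short (s≤s (s≤s (s≤s (s≤s ())))) (_ ∷ _ ∷ _ ∷ _ ∷ _)

  -- Inclusion-exclusion without signs: either the first window is admissible or it is marked, and
  -- together the two cases put no condition on it.
  weight-step : ∀ m e es → weight m (e ∷ es) + 𝟙 (marked m (e ∷ es)) * weight (pred m) es ≡ weight (pred m) es
  weight-step m e es with marked m (e ∷ es)
  ... | true  = +-identityʳ _
  ... | false = trans (+-identityʳ _) (+-identityʳ _)

  -- The left side puts no condition on the first window, so the first entry is free and takes
  -- `suc n` values in front of any admissible code.
  count-step : ∀ n → count (suc n) + clusters (suc n) (const 1) ≡ suc n * count n
  count-step n = begin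
    count (suc n) + clusters (suc n) (const 1)
      ≡⟨ sym (∑ᶜ-+ (suc n) (suc n) (weight (suc n)) _) ⟩
    ∑ᶜ (suc n) (suc n) (λ es → weight (suc n) es + cut (suc n) (const 1) es * weight n (drop 1 es))
      ≡⟨ ∑ᶜ-cong (suc n) (suc n) (λ { (e ∷ es) (_ ∷ _) →
           trans (cong (λ x → weight (suc n) (e ∷ es) + x * weight n es) (+-identityʳ (𝟙 (marked (suc n) (e ∷ es)))))
             (trans (weight-step (suc n) e es) (sym (+-identityʳ _))) }) ⟩
    ∑ᶜ (suc n) (suc n) (λ es → 1 * weight n (drop 1 es))
      ≡⟨ ∑ᶜ-push n n (const 1) (weight n) ⟩
    ∑ᶜ n n (λ es → (∑[ e < suc n ] 1) * weight n es)
      ≡⟨ ∑ᶜ-*ˡ n n (∑[ e < suc n ] 1) (weight n) ⟩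
    (∑[ e < suc n ] 1) * count n
      ≡⟨ cong (_* count n) (∑-one (suc n)) ⟩
    suc n * count n ∎
    where open ≡-Reasoning

  module _ (k : ℕ) (φ : List ℕ → ℕ) where

    φ₁ φ₂ φ₃ φ₄ : List ℕ → ℕ
    φ₁ = push (4 + k) (cut (4 + k) φ)
    φ₂ = push (3 + k) φ₁
    φ₃ = push (2 + k) φ₂
    φ₄ = push (1 + k) φ₃

    private
      C : List ℕ → ℕ
      C = cut (4 + k) φ

      W : ℕ → List ℕ → ℕ
      W = weight

      M : ℕ → List ℕ → ℕ
      M m es = 𝟙 (marked m es)

    -- The next marked window of a cluster starts one, two or three entries later.
    clusters-step : clusters (4 + k) φ +
                    (clusters (3 + k) φ₁ + (clusters (2 + k) φ₂ + clusters (1 + k) φ₃)) ≡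
                    ∑ᶜ k k (λ es → φ₄ es * weight k es)
    clusters-step = begin
      ∑ᶜ m m F₀ + (clusters (3 + k) φ₁ + (clusters (2 + k) φ₂ + clusters (1 + k) φ₃))
        ≡⟨ cong (∑ᶜ m m F₀ +_) (cong₂ _+_ at₁ (cong₂ _+_ at₂ at₃)) ⟩
      ∑ᶜ m m F₀ + (∑ᶜ m m F₁ + (∑ᶜ m m F₂ + ∑ᶜ m m F₃))
        ≡⟨ cong (λ x → ∑ᶜ m m F₀ + (∑ᶜ m m F₁ + x)) (sym (∑ᶜ-+ m m F₂ F₃)) ⟩
      ∑ᶜ m m F₀ + (∑ᶜ m m F₁ + ∑ᶜ m m (λ es → F₂ es + F₃ es))
        ≡⟨ cong (∑ᶜ m m F₀ +_) (sym (∑ᶜ-+ m m F₁ _)) ⟩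
      ∑ᶜ m m F₀ + ∑ᶜ m m (λ es → F₁ es + (F₂ es + F₃ es))
        ≡⟨ sym (∑ᶜ-+ m m F₀ _) ⟩
      ∑ᶜ m m (λ es → F₀ es + (F₁ es + (F₂ es + F₃ es)))
        ≡⟨ ∑ᶜ-cong m m pointwise ⟩
      ∑ᶜ m m (λ es → C es * W k (tl (tl (tl (tl es)))))
        ≡⟨ to₁ (W k ∘ tl ∘ tl ∘ tl) ⟩
      ∑ᶜ (3 + k) (3 + k) (λ es → φ₁ es * W k (tl (tl (tl es))))
        ≡⟨ to₂ (W k ∘ tl ∘ tl) ⟩
      ∑ᶜ (2 + k) (2 + k) (λ es → φ₂ es * W k (tl (tl es)))
        ≡⟨ to₃ (W k ∘ tl) ⟩
      ∑ᶜ (1 + k) (1 + k) (λ es → φ₃ es * W k (tl es))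
        ≡⟨ ∑ᶜ-push k k φ₃ (W k) ⟩
      ∑ᶜ k k (λ es → φ₄ es * W k es) ∎
      where
      open ≡-Reasoning
      m = 4 + k
      tl = drop {A = ℕ} 1

      G₁ G₂ G₃ F₀ F₁ F₂ F₃ : List ℕ → ℕ
      G₁ es = M (3 + k) es * W (2 + k) (tl es)
      G₂ es = M (2 + k) es * W (1 + k) (tl es)
      G₃ es = M (1 + k) es * W k (tl es)
      F₀ es = C es * W (3 + k) (tl es)
      F₁ es = C es * G₁ (tl es)
      F₂ es = C es * G₂ (tl (tl es))
      F₃ es = C es * G₃ (tl (tl (tl es)))

      to₁ : (G : List ℕ → ℕ) → ∑ᶜ m m (λ es → C es * G (tl es)) ≡ ∑ᶜ (3 + k) (3 + k) (λ es → φ₁ es * G es)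
      to₁ = ∑ᶜ-push (3 + k) (3 + k) C
      to₂ : (G : List ℕ → ℕ) →
            ∑ᶜ (3 + k) (3 + k) (λ es → φ₁ es * G (tl es)) ≡ ∑ᶜ (2 + k) (2 + k) (λ es → φ₂ es * G es)
      to₂ = ∑ᶜ-push (2 + k) (2 + k) φ₁
      to₃ : (G : List ℕ → ℕ) →
            ∑ᶜ (2 + k) (2 + k) (λ es → φ₂ es * G (tl es)) ≡ ∑ᶜ (1 + k) (1 + k) (λ es → φ₃ es * G es)
      to₃ = ∑ᶜ-push (1 + k) (1 + k) φ₂

      reassoc : ∀ M′ (ψ : List ℕ → ℕ) (g h : List ℕ → ℕ) →
                ∑ᶜ M′ M′ (λ es → ψ es * g es * h es) ≡ ∑ᶜ M′ M′ (λ es → ψ es * (g es * h es))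
      reassoc M′ ψ g h = ∑ᶜ-cong M′ M′ λ es _ → *-assoc (ψ es) (g es) (h es)

      at₁ : clusters (3 + k) φ₁ ≡ ∑ᶜ m m F₁
      at₁ = trans (reassoc (3 + k) φ₁ (M (3 + k)) _) (sym (to₁ G₁))
      at₂ : clusters (2 + k) φ₂ ≡ ∑ᶜ m m F₂
      at₂ = trans (reassoc (2 + k) φ₂ (M (2 + k)) _) (sym (trans (to₁ (G₂ ∘ tl)) (to₂ G₂)))
      at₃ : clusters (1 + k) φ₃ ≡ ∑ᶜ m m F₃
      at₃ = trans (reassoc (1 + k) φ₃ (M (1 + k)) _)
                  (sym (trans (to₁ (G₃ ∘ tl ∘ tl)) (trans (to₂ (G₃ ∘ tl)) (to₃ G₃))))

      absorb : ∀ c {x y z r} → x + y ≡ z → c * z + r ≡ c * x + (c * y + r)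
      absorb c {x} {y} {r = r} refl = trans (cong (_+ r) (*-distribˡ-+ c x y)) (+-assoc (c * x) (c * y) r)

      -- The sum telescopes: each use of `weight-step` frees one more of the three windows that meet
      -- the marked one, until only the code after its four entries is restricted.
      pointwise : ∀ es → Code m m es →
                  F₀ es + (F₁ es + (F₂ es + F₃ es)) ≡ C es * W k (tl (tl (tl (tl es))))
      pointwise es@(e₁ ∷ e₂ ∷ e₃ ∷ e₄ ∷ es′) (_ ∷ _ ∷ _ ∷ _ ∷ _) = begin
        F₀ es + (F₁ es + (F₂ es + F₃ es))
          ≡⟨ sym (absorb c (weight-step (3 + k) e₂ (e₃ ∷ e₄ ∷ es′))) ⟩
        c * W (2 + k) (e₃ ∷ e₄ ∷ es′) + (F₂ es + F₃ es)
          ≡⟨ sym (absorb c (weight-step (2 + k) e₃ (e₄ ∷ es′))) ⟩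
        c * W (1 + k) (e₄ ∷ es′) + F₃ es
          ≡⟨ sym (*-distribˡ-+ c _ _) ⟩
        c * (W (1 + k) (e₄ ∷ es′) + G₃ (e₄ ∷ es′))
          ≡⟨ cong (c *_) (weight-step (1 + k) e₄ es′) ⟩
        c * W k es′ ∎
        where c = C es

module _ (b b′ : ℕ → ℕ → ℕ → ℕ → ℕ → Bool) where

  private
    module X = Windows b
    module Y = Windows b′

  -- The cluster method of Goulden and Jackson.
  module Transfer
    (R : ℕ → (List ℕ → ℕ) → (List ℕ → ℕ) → Set)
    (R₁ : ∀ k φ ψ → R (4 + k) φ ψ → R (3 + k) (X.φ₁ k φ) (Y.φ₁ k ψ))
    (R₂ : ∀ k φ ψ → R (4 + k) φ ψ → R (2 + k) (X.φ₂ k φ) (Y.φ₂ k ψ))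
    (R₃ : ∀ k φ ψ → R (4 + k) φ ψ → R (1 + k) (X.φ₃ k φ) (Y.φ₃ k ψ))
    -- After all four entries of a window are summed, the result must not depend on the entries that
    -- follow; then the right side of `clusters-step` is a multiple of `count k`.
    (R₄ : ∀ k φ ψ → R (4 + k) φ ψ →
          ∃ λ c → (∀ es → X.φ₄ k φ es ≡ c) × (∀ es → Y.φ₄ k ψ es ≡ c))
    (start : ∀ m → R m (const 1) (const 1))
    where

    private
      Clusters Counts : ℕ → Set
      Clusters m = ∀ φ ψ → R m φ ψ → X.clusters m φ ≡ Y.clusters m ψ
      Counts   n = X.count n ≡ Y.count n

    -- By `clusters-step` a cluster sum and three shorter ones add up to c times `count k`, with the
    -- same c on both sides; the shorter ones agree by induction and cancel.
    clusters-cong : ∀ k → Clusters (3 + k) → Clusters (2 + k) → Clusters (1 + k) → Counts k → Clusters (4 + k)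
    clusters-cong k c₁ c₂ c₃ n φ ψ r with c , eqˣ , eqʸ ← R₄ k φ ψ r =
      +-cancelʳ-≡ _ _ _ (begin
        X.clusters (4 + k) φ + rest
          ≡⟨ X.clusters-step k φ ⟩
        ∑ᶜ k k (λ es → X.φ₄ k φ es * X.weight k es)
          ≡⟨ ∑ᶜ-cong k k (λ es _ → cong (_* X.weight k es) (eqˣ es)) ⟩
        ∑ᶜ k k (λ es → c * X.weight k es)
          ≡⟨ ∑ᶜ-*ˡ k k c (X.weight k) ⟩
        c * X.count k
          ≡⟨ cong (c *_) n ⟩
        c * Y.count k
          ≡⟨ sym (∑ᶜ-*ˡ k k c (Y.weight k)) ⟩
        ∑ᶜ k k (λ es → c * Y.weight k es)
          ≡⟨ ∑ᶜ-cong k k (λ es _ → cong (_* Y.weight k es) (sym (eqʸ es))) ⟩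
        ∑ᶜ k k (λ es → Y.φ₄ k ψ es * Y.weight k es)
          ≡⟨ sym (Y.clusters-step k ψ) ⟩
        Y.clusters (4 + k) ψ + _
          ≡⟨ cong (Y.clusters (4 + k) ψ +_) (sym (cong₂ _+_ (c₁ _ _ (R₁ k φ ψ r))
               (cong₂ _+_ (c₂ _ _ (R₂ k φ ψ r)) (c₃ _ _ (R₃ k φ ψ r))))) ⟩
        Y.clusters (4 + k) ψ + rest ∎)
      where
      open ≡-Reasoning
      rest = X.clusters (3 + k) (X.φ₁ k φ) + (X.clusters (2 + k) (X.φ₂ k φ) + X.clusters (1 + k) (X.φ₃ k φ))

    counts-cong : ∀ n → Clusters (suc n) → Counts n → Counts (suc n)
    counts-cong n c eq = +-cancelʳ-≡ _ _ _ (begin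
      X.count (suc n) + X.clusters (suc n) (const 1)  ≡⟨ X.count-step n ⟩
      suc n * X.count n                               ≡⟨ cong (suc n *_) eq ⟩
      suc n * Y.count n                               ≡⟨ sym (Y.count-step n) ⟩
      Y.count (suc n) + Y.clusters (suc n) (const 1)  ≡⟨ cong (Y.count (suc n) +_) (sym (c _ _ (start (suc n)))) ⟩
      Y.count (suc n) + X.clusters (suc n) (const 1)  ∎)
      where open ≡-Reasoning

    -- The induction is joint: cluster sums need shorter cluster sums and counts, while a count
    -- needs the cluster sum of its own length, which is therefore settled first.
    clusters×counts : ∀ n → Clusters n × Counts n
    clusters×counts = <-rec _ λ n rec →
      let cl = clusters-at n (proj₁ ∘ rec) (proj₂ ∘ rec) in cl , counts-at n cl (proj₂ ∘ rec)
      where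
      small : ∀ m → m < 4 → Clusters m
      small m lt φ ψ _ = trans (X.clusters-< φ lt) (sym (Y.clusters-< ψ lt))

      clusters-at : ∀ n → (∀ {m} → m < n → Clusters m) → (∀ {m} → m < n → Counts m) → Clusters n
      clusters-at 0 _ _ = small 0 z<s
      clusters-at 1 _ _ = small 1 (s<s z<s)
      clusters-at 2 _ _ = small 2 (s<s (s<s z<s))
      clusters-at 3 _ _ = small 3 (s<s (s<s (s<s z<s)))
      clusters-at (suc (suc (suc (suc k)))) cl co = clusters-cong k
        (cl (m<n+m (3 + k) {1} z<s)) (cl (m<n+m (2 + k) {2} z<s)) (cl (m<n+m (1 + k) {3} z<s)) (co (m<n+m k {4} z<s))

      counts-at : ∀ n → Clusters n → (∀ {m} → m < n → Counts m) → Counts n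
      counts-at zero    _ _  = trans (∑ᶜ-nil 0 _) (sym (∑ᶜ-nil 0 _))
      counts-at (suc n) c co = counts-cong n c (co ≤-refl)

    counts : ∀ n → X.count n ≡ Y.count n
    counts n = proj₂ (clusters×counts n)

-- Windows of the shape 1234

-- `true` stands for a strict step x < y, `false` for a weak step x ≤ y. Writing both as x below a
-- bound lets one summation rule treat them alike.
bound : Bool → ℕ → ℕ
bound true  y = y
bound false y = suc y

step : Bool → ℕ → ℕ → Bool
step s x y = x <ᵇ bound s y

bound≤ : ∀ s {y m} → y < m → bound s y ≤ m
bound≤ true  lt = <⇒≤ lt
bound≤ false lt = lt

-- Overlapping windows may impose two steps on the same pair of entries; the strict one prevails.
step-∨ : ∀ s t x y → step s x y ∧ step t x y ≡ step (s ∨ t) x y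
step-∨ s t zero    zero    with s | t
... | true  | _     = refl
... | false | true  = refl
... | false | false = refl
step-∨ s t zero    (suc y) with s | t
... | true  | true  = refl
... | true  | false = refl
... | false | true  = refl
... | false | false = refl
step-∨ true  true  (suc x) zero = refl
step-∨ true  false (suc x) zero = refl
step-∨ false true  (suc x) zero = refl
step-∨ false false (suc x) zero = refl
step-∨ true  true  (suc x) (suc y) = step-∨ true  true  x y
step-∨ true  false (suc x) (suc y) = step-∨ true  false x y
step-∨ false true  (suc x) (suc y) = step-∨ false true  x y
step-∨ false false (suc x) (suc y) = step-∨ false false x y

Steps : Set
Steps = ℕ × ℕ

bump : Bool → Steps → Steps
bump true  (a , b) = suc a , b
bump false (a , b) = a , suc b

-- chains (a , b) y is the number of chains ending in y with a strict and b weak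
-- steps, in any fixed order.
chains : Steps → ℕ → ℕ
chains (zero  , zero)  y = 1
chains (zero  , suc b) y = ∑ (suc y) (chains (zero , b))
chains (suc a , b)     y = ∑ y (chains (a , b))

-- A weak step commutes past a strict one: lowering x by one turns t < x ≤ y into t ≤ x < y. This is
-- why only the numbers of steps matter.
chains-bump : ∀ s u y → ∑ (bound s y) (chains u) ≡ chains (bump s u) y
chains-bump true  (a     , b) y = refl
chains-bump false (zero  , b) y = refl
chains-bump false (suc a , b) y = begin
  ∑ (suc y) (chains (suc a , b))                  ≡⟨ ∑-suc y _ ⟩
  ∑ 0 (chains (a , b)) + (∑[ x < y ] ∑ (suc x) (chains (a , b)))
    ≡⟨ cong₂ _+_ (∑-nil (chains (a , b))) (∑-cong y λ x _ → chains-bump false (a , b) x) ⟩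
  ∑ y (chains (a , suc b))                        ∎
  where open ≡-Reasoning

-- The gap between neighbouring window letters in which the fifth value has to fit. Room for it
-- makes the corresponding step between code entries strict; the other two are weak.
data Place : Set where
  front middle back : Place

s₁ s₂ s₃ : Place → Bool
s₁ front  = true
s₁ _      = false
s₂ middle = true
s₂ _      = false
s₃ back   = true
s₃ _      = false

rising : Place → ℕ → ℕ → ℕ → ℕ → ℕ → Bool
rising p _ x y z w = step (s₁ p) x y ∧ step (s₂ p) y z ∧ step (s₃ p) z w

-- The strictness of the three steps of the newest window, including what earlier windows impose.
-- Those have their strict steps further left, so every step beyond the window's own strict one is
-- weak.
data Reachable : Place → Bool → Bool → Bool → Set where
  front  : Reachable front true false false
  middle : ∀ α → Reachable middle α true false
  back   : ∀ α β → Reachable back α β true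

total : Steps → Bool → Bool → Bool → Steps
total u α β γ = bump γ (bump β (bump α u))

-- Three new steps, one of them strict: this describes the first window of a cluster and also a
-- window that shares just one letter with its predecessor.
initial : ∀ p → Reachable p (s₁ p) (s₂ p) (s₃ p) × (∀ u → total u (s₁ p) (s₂ p) (s₃ p) ≡ bump true (bump false (bump false u)))
initial front  = front , λ _ → refl
initial middle = middle false , λ _ → refl
initial back   = back false false , λ _ → refl

-- The strict step of a window sits at a fixed distance from its start, so different windows have
-- different strict steps. Each new window therefore adds exactly one strict step, wherever the
-- place is and however long the overlap.
shift₁ : ∀ {p α β γ} → Reachable p α β γ →
         Reachable p (β ∨ s₁ p) (γ ∨ s₂ p) (s₃ p) ×
         (∀ u → total (bump α u) (β ∨ s₁ p) (γ ∨ s₂ p) (s₃ p) ≡ bump true (total u α β γ))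
shift₁ front              = front , λ _ → refl
shift₁ (middle true)      = middle true , λ _ → refl
shift₁ (middle false)     = middle true , λ _ → refl
shift₁ (back true true)   = back true true , λ _ → refl
shift₁ (back true false)  = back false true , λ _ → refl
shift₁ (back false true)  = back true true , λ _ → refl
shift₁ (back false false) = back false true , λ _ → refl

shift₂ : ∀ {p α β γ} → Reachable p α β γ →
         Reachable p (γ ∨ s₁ p) (s₂ p) (s₃ p) ×
         (∀ u → total (bump β (bump α u)) (γ ∨ s₁ p) (s₂ p) (s₃ p) ≡ bump true (bump false (total u α β γ)))
shift₂ front              = front , λ _ → refl
shift₂ (middle true)      = middle false , λ _ → refl
shift₂ (middle false)     = middle false , λ _ → refl
shift₂ (back true true)   = back true false , λ _ → refl
shift₂ (back true false)  = back true false , λ _ → refl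
shift₂ (back false true)  = back true false , λ _ → refl
shift₂ (back false false) = back true false , λ _ → refl

module Rising {p : Place} where

  private
    module X = Windows (rising p)

  ∧-shuffle : ∀ a b c d e → (a ∧ b) ∧ (c ∧ d ∧ e) ≡ (a ∧ c) ∧ (b ∧ d) ∧ e
  ∧-shuffle false b     c     d e = refl
  ∧-shuffle true  false false d e = refl
  ∧-shuffle true  false true  d e = refl
  ∧-shuffle true  true  c     d e = refl

  -- A cluster in progress: its letters up to the first of the last marked window
  -- have been summed over, and the strict steps required so far are recorded.
  record Open (m : ℕ) (φ : List ℕ → ℕ) (u : Steps) (α β γ : Bool) : Set where
    constructor mkOpen
    field
      cut-chains : ∀ x y z w es → x < m →
        X.cut m φ (x ∷ y ∷ z ∷ w ∷ es) ≡ chains u x * 𝟙 (step α x y ∧ step β y z ∧ step γ z w)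

  -- The first step cuts the range of x down to `bound α y`, and what remains is a chain that is one
  -- step longer.
  sum-first : ∀ {m} α u y c → y < m →
              ∑[ x < m ] chains u x * 𝟙 (step α x y ∧ c) ≡ chains (bump α u) y * 𝟙 c
  sum-first {m} α u y c lt = begin
    ∑[ x < m ] chains u x * 𝟙 (step α x y ∧ c)
      ≡⟨ ∑-cong m (λ x _ → trans (cong (chains u x *_) (𝟙-∧ (step α x y) c))
           (trans (sym (*-assoc (chains u x) _ _)) (cong (_* 𝟙 c) (*-comm (chains u x) (𝟙 (step α x y)))))) ⟩
    ∑[ x < m ] 𝟙 (step α x y) * chains u x * 𝟙 c
      ≡⟨ ∑-*ʳ m (𝟙 c) _ ⟩
    (∑[ x < m ] 𝟙 (x <ᵇ bound α y) * chains u x) * 𝟙 c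
      ≡⟨ cong (_* 𝟙 c) (∑-restrict (chains u) (bound≤ α lt)) ⟩
    ∑ (bound α y) (chains u) * 𝟙 c
      ≡⟨ cong (_* 𝟙 c) (chains-bump α u y) ⟩
    chains (bump α u) y * 𝟙 c ∎
    where open ≡-Reasoning

  open-start : ∀ m → Open m (const 1) (0 , 0) (s₁ p) (s₂ p) (s₃ p)
  open-start m = mkOpen λ x y z w es _ → refl

  module _ {k φ u α β γ} (o : Open (4 + k) φ u α β γ) where

    φ₁-open : ∀ y z w es → y < 3 + k → X.φ₁ k φ (y ∷ z ∷ w ∷ es) ≡ chains (bump α u) y * 𝟙 (step β y z ∧ step γ z w)
    φ₁-open y z w es lt =
      trans (∑-cong (4 + k) λ x lx → Open.cut-chains o x y z w es lx) (sum-first α u y _ (m≤n⇒m≤1+n lt))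

    φ₂-open : ∀ z w es → z < 2 + k → X.φ₂ k φ (z ∷ w ∷ es) ≡ chains (bump β (bump α u)) z * 𝟙 (step γ z w)
    φ₂-open z w es lt =
      trans (∑-cong (3 + k) λ y ly → φ₁-open y z w es ly) (sum-first β (bump α u) z _ (m≤n⇒m≤1+n lt))

    φ₃-open : ∀ w es → w < 1 + k → X.φ₃ k φ (w ∷ es) ≡ chains (total u α β γ) w
    φ₃-open w es lt =
      trans (∑-cong (2 + k) λ z lz →
               trans (φ₂-open z w es lz)
                     (cong (λ c → chains (bump β (bump α u)) z * 𝟙 c) (sym (∧-identityʳ (step γ z w)))))
            (trans (sum-first γ (bump β (bump α u)) w true (m≤n⇒m≤1+n lt)) (*-identityʳ _))

    φ₄-open : ∀ es → X.φ₄ k φ es ≡ ∑ (1 + k) (chains (total u α β γ))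
    φ₄-open es = ∑-cong (1 + k) λ w lw → φ₃-open w es lw

    -- The new window shares three letters with the old one: its first two steps are the last two of
    -- the old window, and their strictness is joined by `step-∨`.
    open₁ : Open (3 + k) (X.φ₁ k φ) (bump α u) (β ∨ s₁ p) (γ ∨ s₂ p) (s₃ p)
    open₁ = mkOpen combined
      where
      open ≡-Reasoning
      combined : ∀ x y z w es → x < 3 + k → X.cut (3 + k) (X.φ₁ k φ) (x ∷ y ∷ z ∷ w ∷ es) ≡
                 chains (bump α u) x * 𝟙 (step (β ∨ s₁ p) x y ∧ step (γ ∨ s₂ p) y z ∧ step (s₃ p) z w)
      combined x y z w es lt = begin
        X.φ₁ k φ (x ∷ y ∷ z ∷ w ∷ es) * 𝟙 (rising p (3 + k) x y z w)
          ≡⟨ cong (_* 𝟙 (rising p (3 + k) x y z w)) (φ₁-open x y z (w ∷ es) lt) ⟩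
        chains (bump α u) x * 𝟙 (step β x y ∧ step γ y z) * 𝟙 (rising p (3 + k) x y z w)
          ≡⟨ *-assoc (chains (bump α u) x) _ _ ⟩
        chains (bump α u) x * (𝟙 (step β x y ∧ step γ y z) * 𝟙 (rising p (3 + k) x y z w))
          ≡⟨ cong (chains (bump α u) x *_) (trans (sym (𝟙-∧ (step β x y ∧ step γ y z) (rising p (3 + k) x y z w))) (cong 𝟙 (trans
               (∧-shuffle (step β x y) (step γ y z) (step (s₁ p) x y) (step (s₂ p) y z) (step (s₃ p) z w))
               (cong₂ (λ a b → a ∧ b ∧ step (s₃ p) z w) (step-∨ β (s₁ p) x y) (step-∨ γ (s₂ p) y z))))) ⟩
        chains (bump α u) x * 𝟙 (step (β ∨ s₁ p) x y ∧ step (γ ∨ s₂ p) y z ∧ step (s₃ p) z w) ∎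

    open₂ : Open (2 + k) (X.φ₂ k φ) (bump β (bump α u)) (γ ∨ s₁ p) (s₂ p) (s₃ p)
    open₂ = mkOpen combined
      where
      open ≡-Reasoning
      combined : ∀ x y z w es → x < 2 + k → X.cut (2 + k) (X.φ₂ k φ) (x ∷ y ∷ z ∷ w ∷ es) ≡
                 chains (bump β (bump α u)) x * 𝟙 (step (γ ∨ s₁ p) x y ∧ step (s₂ p) y z ∧ step (s₃ p) z w)
      combined x y z w es lt = begin
        X.φ₂ k φ (x ∷ y ∷ z ∷ w ∷ es) * 𝟙 (rising p (2 + k) x y z w)
          ≡⟨ cong (_* 𝟙 (rising p (2 + k) x y z w)) (φ₂-open x y (z ∷ w ∷ es) lt) ⟩
        h * 𝟙 (step γ x y) * 𝟙 (rising p (2 + k) x y z w)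
          ≡⟨ *-assoc h _ _ ⟩
        h * (𝟙 (step γ x y) * 𝟙 (rising p (2 + k) x y z w))
          ≡⟨ cong (h *_) (trans (sym (𝟙-∧ (step γ x y) (rising p (2 + k) x y z w))) (cong 𝟙 (trans
               (sym (∧-assoc (step γ x y) (step (s₁ p) x y) _))
               (cong (_∧ step (s₂ p) y z ∧ step (s₃ p) z w) (step-∨ γ (s₁ p) x y))))) ⟩
        h * 𝟙 (step (γ ∨ s₁ p) x y ∧ step (s₂ p) y z ∧ step (s₃ p) z w) ∎
        where h = chains (bump β (bump α u)) x

    open₃ : Open (1 + k) (X.φ₃ k φ) (total u α β γ) (s₁ p) (s₂ p) (s₃ p)
    open₃ = mkOpen λ x y z w es lt → cong (_* 𝟙 (rising p (1 + k) x y z w)) (φ₃-open x (y ∷ z ∷ w ∷ es) lt)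

-- Moving the strict step inside the windows changes neither the number of strict
-- steps of a cluster nor its length.
module _ (p q : Place) where

  open Rising

  record Matched (m : ℕ) (φ ψ : List ℕ → ℕ) : Set where
    constructor matched
    field
      {u v}               : Steps
      {α β γ α′ β′ γ′}    : Bool
      openˡ               : Open {p} m φ u α β γ
      openʳ               : Open {q} m ψ v α′ β′ γ′
      reachˡ              : Reachable p α β γ
      reachʳ              : Reachable q α′ β′ γ′
      same                : total u α β γ ≡ total v α′ β′ γ′

  rising-count : ∀ n → Windows.count (rising p) n ≡ Windows.count (rising q) n
  rising-count = Transfer.counts (rising p) (rising q) Matched
    (λ { k φ ψ (matched o o′ r r′ eq) → matched (open₁ o) (open₁ o′) (proj₁ (shift₁ r)) (proj₁ (shift₁ r′))
           (trans (proj₂ (shift₁ r) _) (trans (cong (bump true) eq) (sym (proj₂ (shift₁ r′) _)))) })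
    (λ { k φ ψ (matched o o′ r r′ eq) → matched (open₂ o) (open₂ o′) (proj₁ (shift₂ r)) (proj₁ (shift₂ r′))
           (trans (proj₂ (shift₂ r) _) (trans (cong (bump true ∘ bump false) eq) (sym (proj₂ (shift₂ r′) _)))) })
    (λ { k φ ψ (matched o o′ r r′ eq) → matched (open₃ o) (open₃ o′) (proj₁ (initial p)) (proj₁ (initial q))
           (trans (proj₂ (initial p) _) (trans (cong (bump true ∘ bump false ∘ bump false) eq) (sym (proj₂ (initial q) _)))) })
    (λ { k φ ψ (matched o o′ r r′ eq) → _ , φ₄-open o ,
           λ es → trans (φ₄-open o′ es) (cong (λ t → ∑ (1 + k) (chains t)) (sym eq)) })
    (λ m → matched (open-start m) (open-start m) (proj₁ (initial p)) (proj₁ (initial q))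
             (trans (proj₂ (initial p) _) (sym (proj₂ (initial q) _))))

-- Windows of the shape 2143

-- The parameters say where the fifth value needs room: through c between the last two letters
-- (`Upper`, for 2153-4), or through r between the first two (`Lower`, for 3154-2).
module Pairs (r : ℕ → ℕ) (r≤ : ∀ x → r x ≤ x)
             (c : ℕ → ℕ → Bool) (c⇒< : ∀ {w z} → T (c w z) → w < z) where

  pairs : ℕ → ℕ → ℕ → ℕ → ℕ → Bool
  pairs _ x y z w = (y <ᵇ r x) ∧ (x <ᵇ 2 + w) ∧ c w z

  private
    module X = Windows pairs

  -- Given the last entry w, the conditions on the first two entries do not involve the third, so
  -- those two can be summed on their own.
  below : (ℕ → ℕ → ℕ) → ℕ → ℕ
  below f w = ∑[ x < 2 + w ] ∑[ y < r x ] f x y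

  record Open (m : ℕ) (φ : List ℕ → ℕ) (f : ℕ → ℕ → ℕ) : Set where
    constructor mkOpen
    field
      cut-pairs : ∀ x y z w es → x < m → y < pred m →
        X.cut m φ (x ∷ y ∷ z ∷ w ∷ es) ≡ f x y * 𝟙 (pairs m x y z w)

  -- A window begins with a descent and rises from its second to its third entry; a window starting
  -- one entry later would need a descent there.
  pairs-overlap : ∀ m m′ x y z w v → 𝟙 (pairs m x y z w) * 𝟙 (pairs m′ y z w v) ≡ 0
  pairs-overlap m m′ x y z w v =
    trans (sym (𝟙-∧ (pairs m x y z w) (pairs m′ y z w v))) (cong 𝟙 (¬T⇒false λ t →
      let t₁ = T-∧ˡ {pairs m x y z w} t
          t₂ = T-∧ʳ {pairs m x y z w} t
          t₃ = T-∧ʳ {y <ᵇ r x} t₁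
          y<x = <-≤-trans (<ᵇ⇒< y (r x) (T-∧ˡ t₁)) (r≤ x)
          x≤1+w = ≤-pred (<ᵇ⇒< x (2 + w) (T-∧ˡ t₃))
          w<z = c⇒< (T-∧ʳ {x <ᵇ 2 + w} t₃)
          z<y = <-≤-trans (<ᵇ⇒< z (r y) (T-∧ˡ t₂)) (r≤ y)
      in <-irrefl refl (<-≤-trans y<x (≤-trans x≤1+w (≤-trans w<z (<⇒≤ z<y))))))

  open-start : ∀ m → Open m (const 1) (λ _ _ → 1)
  open-start m = mkOpen λ _ _ _ _ _ _ _ → refl

  module _ {k φ f} (o : Open (4 + k) φ f) where

    φ₁-open : ∀ y z w es → y < 3 + k →
              X.φ₁ k φ (y ∷ z ∷ w ∷ es) ≡ (∑[ x < 4 + k ] f x y * 𝟙 (pairs (4 + k) x y z w))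
    φ₁-open y z w es ly = ∑-cong (4 + k) λ x lx → Open.cut-pairs o x y z w es lx ly

    φ₂-open : ∀ z w es → w < 1 + k → X.φ₂ k φ (z ∷ w ∷ es) ≡ below f w * 𝟙 (c w z)
    φ₂-open z w es lw = begin
      ∑[ y < 3 + k ] X.φ₁ k φ (y ∷ z ∷ w ∷ es)
        ≡⟨ ∑-cong (3 + k) (λ y → φ₁-open y z w es) ⟩
      ∑[ y < 3 + k ] ∑[ x < 4 + k ] f x y * 𝟙 (pairs (4 + k) x y z w)
        ≡⟨ ∑-swap (3 + k) (4 + k) _ ⟩
      ∑[ x < 4 + k ] ∑[ y < 3 + k ] f x y * 𝟙 (pairs (4 + k) x y z w)
        ≡⟨ ∑-cong (4 + k) (λ x _ → trans (∑-cong (3 + k) λ y _ → split x y) (trans (∑-*ˡ (3 + k) (𝟙 (x <ᵇ 2 + w)) _)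
             (cong (𝟙 (x <ᵇ 2 + w) *_) (∑-*ʳ (3 + k) (𝟙 (c w z)) _)))) ⟩
      ∑[ x < 4 + k ] 𝟙 (x <ᵇ 2 + w) * ((∑[ y < 3 + k ] 𝟙 (y <ᵇ r x) * f x y) * 𝟙 (c w z))
        ≡⟨ ∑-restrict _ (s≤s (s≤s (≤-trans (<⇒≤ lw) (m≤n+m (1 + k) 1)))) ⟩
      ∑[ x < 2 + w ] (∑[ y < 3 + k ] 𝟙 (y <ᵇ r x) * f x y) * 𝟙 (c w z)
        ≡⟨ ∑-*ʳ (2 + w) (𝟙 (c w z)) _ ⟩
      (∑[ x < 2 + w ] ∑[ y < 3 + k ] 𝟙 (y <ᵇ r x) * f x y) * 𝟙 (c w z)
        ≡⟨ cong (_* 𝟙 (c w z)) (∑-cong (2 + w) λ x lx →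
             ∑-restrict (f x) (≤-trans (r≤ x) (≤-trans (≤-pred lx) (≤-trans lw (m≤n+m (1 + k) 2))))) ⟩
      below f w * 𝟙 (c w z) ∎
      where
      open ≡-Reasoning
      split : ∀ x y → f x y * 𝟙 (pairs (4 + k) x y z w) ≡ 𝟙 (x <ᵇ 2 + w) * (𝟙 (y <ᵇ r x) * f x y * 𝟙 (c w z))
      split x y with y <ᵇ r x | x <ᵇ 2 + w | c w z
      ... | true  | true  | true  = trans (*-identityʳ (f x y)) (sym (trans (+-identityʳ _) (trans (*-identityʳ _) (+-identityʳ (f x y)))))
      ... | true  | true  | false = trans (*-zeroʳ (f x y)) (sym (trans (+-identityʳ _) (*-zeroʳ (f x y + 0))))
      ... | true  | false | _     = *-zeroʳ (f x y)
      ... | false | true  | _     = *-zeroʳ (f x y)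
      ... | false | false | _     = *-zeroʳ (f x y)

    last : ℕ → ℕ
    last w = below f w * (∑[ z < 2 + k ] 𝟙 (c w z))

    φ₃-open : ∀ w es → w < 1 + k → X.φ₃ k φ (w ∷ es) ≡ last w
    φ₃-open w es lw = trans (∑-cong (2 + k) λ z _ → φ₂-open z w es lw) (∑-*ˡ (2 + k) (below f w) _)

    φ₄-open : ∀ es → X.φ₄ k φ es ≡ ∑ (1 + k) last
    φ₄-open es = ∑-cong (1 + k) λ w → φ₃-open w es

    open₁ : Open (3 + k) (X.φ₁ k φ) (λ _ _ → 0)
    open₁ = mkOpen λ x y z w es lx _ →
      trans (cong (_* 𝟙 (pairs (3 + k) x y z w)) (φ₁-open x y z (w ∷ es) lx))
      (trans (sym (∑-*ʳ (4 + k) (𝟙 (pairs (3 + k) x y z w)) _))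
        (∑-zero (4 + k) λ v _ → trans (*-assoc (f v x) _ _)
          (trans (cong (f v x *_) (pairs-overlap (4 + k) (3 + k) v x y z w)) (*-zeroʳ (f v x)))))

    open₂ : Open (2 + k) (X.φ₂ k φ) (λ x y → below f y * 𝟙 (c y x))
    open₂ = mkOpen λ x y z w es _ ly → cong (_* 𝟙 (pairs (2 + k) x y z w)) (φ₂-open x y (z ∷ w ∷ es) ly)

    open₃ : Open (1 + k) (X.φ₃ k φ) (λ x _ → last x)
    open₃ = mkOpen λ x y z w es lx _ → cong (_* 𝟙 (pairs (1 + k) x y z w)) (φ₃-open x (y ∷ z ∷ w ∷ es) lx)

module Upper = Pairs id (λ _ → ≤-refl) (λ w z → suc w <ᵇ z) (λ {w} {z} t → <-trans (n<1+n w) (<ᵇ⇒< (suc w) z t))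
module Lower = Pairs pred (λ _ → pred[n]≤n) (λ w z → w <ᵇ z) (λ {w} {z} t → <ᵇ⇒< w z t)

-- Corresponding clusters have a window ending in c for `Upper` and in `suc c` for `Lower`.
Shifted : (ℕ → ℕ → ℕ) → (ℕ → ℕ → ℕ) → Set
Shifted f g = ∀ c → Lower.below g (suc c) ≡ Upper.below f c

Lower-below-0 : ∀ g → Lower.below g 0 ≡ 0
Lower-below-0 g = ∑-zero 2 λ { zero _ → ∑-nil _ ; (suc zero) _ → ∑-nil _ ; (suc (suc x)) (s≤s (s≤s ())) }

Lower-below-suc : ∀ g c → Lower.below g (suc c) ≡ (∑[ x < 2 + c ] ∑[ y < x ] g (suc x) y)
Lower-below-suc g c = trans (∑-suc (2 + c) _) (cong (_+ (∑[ x < 2 + c ] ∑[ y < x ] g (suc x) y)) (∑-nil (g 0)))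

-- Raising by one all letters of a cluster but the lowest and the highest of each
-- chain exchanges the two kinds of strictness.
shifted₂ : ∀ {f g} → Shifted f g →
           Shifted (λ x y → Upper.below f y * 𝟙 (suc y <ᵇ x)) (λ x y → Lower.below g y * 𝟙 (y <ᵇ x))
shifted₂ {f} {g} sh c = begin
  Lower.below (λ x y → Lower.below g y * 𝟙 (y <ᵇ x)) (suc c)
    ≡⟨ Lower-below-suc (λ x y → Lower.below g y * 𝟙 (y <ᵇ x)) c ⟩
  ∑[ x < 2 + c ] ∑[ y < x ] Lower.below g y * 𝟙 (y <ᵇ suc x)
    ≡⟨ ∑-suc (1 + c) _ ⟩
  (∑[ y < 0 ] Lower.below g y * 𝟙 (y <ᵇ 1)) + (∑[ x < 1 + c ] ∑[ y < suc x ] Lower.below g y * 𝟙 (y <ᵇ 2 + x))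
    ≡⟨ cong₂ _+_ (∑-nil (λ y → Lower.below g y * 𝟙 (y <ᵇ 1))) (∑-cong (1 + c) λ x _ → trans (left x) (sym (right x))) ⟩
  ∑[ x < 1 + c ] ∑[ y < suc x ] Upper.below f y * 𝟙 (suc y <ᵇ suc x)
    ≡⟨ cong (_+ (∑[ x < 1 + c ] ∑[ y < suc x ] Upper.below f y * 𝟙 (suc y <ᵇ suc x))) (sym (∑-nil (λ y → Upper.below f y * 𝟙 (suc y <ᵇ 0)))) ⟩
  (∑[ y < 0 ] Upper.below f y * 𝟙 (suc y <ᵇ 0)) + (∑[ x < 1 + c ] ∑[ y < suc x ] Upper.below f y * 𝟙 (suc y <ᵇ suc x))
    ≡⟨ sym (∑-suc (1 + c) _) ⟩
  Upper.below (λ x y → Upper.below f y * 𝟙 (suc y <ᵇ x)) c ∎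
  where
  open ≡-Reasoning
  left : ∀ x → (∑[ y < suc x ] Lower.below g y * 𝟙 (y <ᵇ 2 + x)) ≡ ∑ x (Upper.below f)
  left x = begin
    (∑[ y < suc x ] Lower.below g y * 𝟙 (y <ᵇ 2 + x))
      ≡⟨ ∑-cong (suc x) (λ y ly → trans (cong (λ t → Lower.below g y * 𝟙 t) (T⇒true (<⇒<ᵇ (m<n⇒m<1+n ly)))) (*-identityʳ _)) ⟩
    ∑ (suc x) (Lower.below g)
      ≡⟨ ∑-suc x _ ⟩
    Lower.below g 0 + ∑ x (Lower.below g ∘ suc)
      ≡⟨ cong₂ _+_ (Lower-below-0 g) (∑-cong x λ y _ → sh y) ⟩
    ∑ x (Upper.below f) ∎
  right : ∀ x → (∑[ y < suc x ] Upper.below f y * 𝟙 (suc y <ᵇ suc x)) ≡ ∑ x (Upper.below f)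
  right x = trans (∑-cong (suc x) λ y _ → *-comm (Upper.below f y) (𝟙 (y <ᵇ x))) (∑-restrict (Upper.below f) (n≤1+n x))

module _ {k φ ψ f g} (o : Upper.Open (4 + k) φ f) (o′ : Lower.Open (4 + k) ψ g) (sh : Shifted f g) where

  -- After the raise both kinds put the same condition `suc w` < z on the third entry.
  last-suc : ∀ w → Lower.last o′ (suc w) ≡ Upper.last o w
  last-suc w = cong (_* _) (sh w)

  shifted₃ : Shifted (λ x _ → Upper.last o x) (λ x _ → Lower.last o′ x)
  shifted₃ c = trans (Lower-below-suc (λ x _ → Lower.last o′ x) c)
                     (∑-cong (2 + c) λ x _ → ∑-cong x λ _ _ → last-suc x)

  -- The raise from w to `suc w` leaves out the value 0 for `Lower` and the value k for `Upper`.
  -- Both contribute nothing: no pair fits below 0, and no third entry lies above `suc k`.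
  last-total : ∑ (1 + k) (Lower.last o′) ≡ ∑ (1 + k) (Upper.last o)
  last-total = begin
    ∑ (1 + k) (Lower.last o′)                     ≡⟨ ∑-suc k _ ⟩
    Lower.last o′ 0 + ∑ k (Lower.last o′ ∘ suc)   ≡⟨ cong₂ _+_ (cong (_* _) (Lower-below-0 g)) (∑-cong k λ w _ → last-suc w) ⟩
    ∑ k (Upper.last o)                            ≡⟨ sym (+-identityʳ _) ⟩
    ∑ k (Upper.last o) + 0                        ≡⟨ cong (∑ k (Upper.last o) +_) (sym last-k) ⟩
    ∑ k (Upper.last o) + Upper.last o k           ≡⟨ sym (∑-last k _) ⟩
    ∑ (1 + k) (Upper.last o)                      ∎
    where
    open ≡-Reasoning
    last-k : Upper.last o k ≡ 0
    last-k = trans (cong (Upper.below f k *_) (∑-zero (2 + k) λ z lz →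
               cong 𝟙 (¬T⇒false λ t → <⇒≱ (<ᵇ⇒< (suc k) z t) (≤-pred lz)))) (*-zeroʳ (Upper.below f k))

pairs-count : ∀ n → Windows.count Upper.pairs n ≡ Windows.count Lower.pairs n
pairs-count = Transfer.counts Upper.pairs Lower.pairs
  (λ m φ ψ → ∃₂ λ f g → Upper.Open m φ f × Lower.Open m ψ g × Shifted f g)
  (λ { k φ ψ (f , g , o , o′ , sh) → _ , _ , Upper.open₁ o , Lower.open₁ o′ , λ c → zero-below c })
  (λ { k φ ψ (f , g , o , o′ , sh) → _ , _ , Upper.open₂ o , Lower.open₂ o′ , shifted₂ sh })
  (λ { k φ ψ (f , g , o , o′ , sh) → _ , _ , Upper.open₃ o , Lower.open₃ o′ , shifted₃ o o′ sh })
  (λ { k φ ψ (f , g , o , o′ , sh) → _ , Upper.φ₄-open o ,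
         λ es → trans (Lower.φ₄-open o′ es) (last-total o o′ sh) })
  (λ m → _ , _ , Upper.open-start m , Lower.open-start m , Lower-below-suc (λ _ _ → 1))
  where
  zero-below : Shifted (λ _ _ → 0) (λ _ _ → 0)
  zero-below = Lower-below-suc (λ _ _ → 0)

-- Patterns and words

_⇔ᵇ_ : Bool → Bool → Bool
true  ⇔ᵇ y = y
false ⇔ᵇ y = not y

⇔ᵇ⇒≡ : ∀ {x y} → T (x ⇔ᵇ y) → x ≡ y
⇔ᵇ⇒≡ {true}  {true}  _ = refl
⇔ᵇ⇒≡ {false} {false} _ = refl

≡⇒⇔ᵇ : ∀ {x y} → x ≡ y → T (x ⇔ᵇ y)
≡⇒⇔ᵇ {true}  refl = tt
≡⇒⇔ᵇ {false} refl = tt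

agree : ℕ → ℕ → ℕ → ℕ → Bool
agree x y a b = ((x <ᵇ y) ⇔ᵇ (a <ᵇ b)) ∧ ((y <ᵇ x) ⇔ᵇ (b <ᵇ a))

-- Both directions are compared, so that equal letters agree with equal letters only and
-- distinctness passes from the pattern to the window.
record Agree (x y a b : ℕ) : Set where
  constructor agreeing
  field
    <-agree : (x <ᵇ y) ≡ (a <ᵇ b)
    >-agree : (y <ᵇ x) ≡ (b <ᵇ a)
open Agree public

agree⁻ : ∀ x y a b → T (agree x y a b) → Agree x y a b
agree⁻ x y a b t = agreeing (⇔ᵇ⇒≡ (T-∧ˡ t)) (⇔ᵇ⇒≡ (T-∧ʳ {(x <ᵇ y) ⇔ᵇ (a <ᵇ b)} t))

agree⁺ : ∀ {x y a b} → Agree x y a b → T (agree x y a b)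
agree⁺ {x} {y} (agreeing e e′) = T-∧⁺ (≡⇒⇔ᵇ {x <ᵇ y} e) (≡⇒⇔ᵇ {y <ᵇ x} e′)

Agree-flip : ∀ {x y a b} → Agree x y a b → Agree y x b a
Agree-flip (agreeing e e′) = agreeing e′ e

Agree-sym : ∀ {x y a b} → Agree x y a b → Agree a b x y
Agree-sym (agreeing e e′) = agreeing (sym e) (sym e′)

Agree-trans : ∀ {x y a b c d} → Agree x y a b → Agree a b c d → Agree x y c d
Agree-trans (agreeing e e′) (agreeing f f′) = agreeing (trans e f) (trans e′ f′)

Agree-pin : ∀ e x y → Agree (pin e x) (pin e y) x y
Agree-pin e x y = agreeing (pin-<ᵇ e x y) (pin-<ᵇ e y x)

incomparable⇒≡ : ∀ {a b} → (a <ᵇ b) ≡ false → (b <ᵇ a) ≡ false → a ≡ b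
incomparable⇒≡ {zero}  {zero}  _ _ = refl
incomparable⇒≡ {suc a} {suc b} e e′ = cong suc (incomparable⇒≡ e e′)

n<ᵇn : ∀ n → (n <ᵇ n) ≡ false
n<ᵇn zero    = refl
n<ᵇn (suc n) = n<ᵇn n

Agree-≡ : ∀ {x y a b} → Agree x y a b → x ≡ y → a ≡ b
Agree-≡ {x} (agreeing e e′) refl = incomparable⇒≡ (trans (sym e) (n<ᵇn x)) (trans (sym e′) (n<ᵇn x))

fits₄ : Vec ℕ 5 → ℕ → ℕ → ℕ → ℕ → Bool
fits₄ (a ∷ b ∷ c ∷ d ∷ _ ∷ []) x y z w =
  agree x y a b ∧ agree x z a c ∧ agree x w a d ∧ agree y z b c ∧ agree y w b d ∧ agree z w c d

fits₅ : Vec ℕ 5 → ℕ → ℕ → ℕ → ℕ → ℕ → Bool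
fits₅ (a ∷ b ∷ c ∷ d ∷ e ∷ []) x y z w v =
  agree x v a e ∧ agree y v b e ∧ agree z v c e ∧ agree w v d e

Fits₄ : Vec ℕ 5 → ℕ → ℕ → ℕ → ℕ → Set
Fits₄ (a ∷ b ∷ c ∷ d ∷ _ ∷ []) x y z w =
  Agree x y a b × Agree x z a c × Agree x w a d × Agree y z b c × Agree y w b d × Agree z w c d

Fits₅ : Vec ℕ 5 → ℕ → ℕ → ℕ → ℕ → ℕ → Set
Fits₅ (a ∷ b ∷ c ∷ d ∷ e ∷ []) x y z w v =
  Agree x v a e × Agree y v b e × Agree z v c e × Agree w v d e

fits₄⁻ : ∀ p x y z w → T (fits₄ p x y z w) → Fits₄ p x y z w
fits₄⁻ (a ∷ b ∷ c ∷ d ∷ _ ∷ []) x y z w t =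
  let t₂ = T-∧ʳ {agree x y a b} t ; t₃ = T-∧ʳ {agree x z a c} t₂ ; t₄ = T-∧ʳ {agree x w a d} t₃
      t₅ = T-∧ʳ {agree y z b c} t₄ ; t₆ = T-∧ʳ {agree y w b d} t₅
  in agree⁻ x y a b (T-∧ˡ t) , agree⁻ x z a c (T-∧ˡ t₂) , agree⁻ x w a d (T-∧ˡ t₃) ,
     agree⁻ y z b c (T-∧ˡ t₄) , agree⁻ y w b d (T-∧ˡ t₅) , agree⁻ z w c d t₆

fits₄⁺ : ∀ p x y z w → Fits₄ p x y z w → T (fits₄ p x y z w)
fits₄⁺ (a ∷ b ∷ c ∷ d ∷ _ ∷ []) x y z w (f₁ , f₂ , f₃ , f₄ , f₅ , f₆) =
  T-∧⁺ (agree⁺ f₁) (T-∧⁺ (agree⁺ f₂) (T-∧⁺ (agree⁺ f₃) (T-∧⁺ (agree⁺ f₄) (T-∧⁺ (agree⁺ f₅) (agree⁺ f₆)))))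

fits₅⁻ : ∀ p x y z w v → T (fits₅ p x y z w v) → Fits₅ p x y z w v
fits₅⁻ (a ∷ b ∷ c ∷ d ∷ e ∷ []) x y z w v t =
  let t₂ = T-∧ʳ {agree x v a e} t ; t₃ = T-∧ʳ {agree y v b e} t₂ ; t₄ = T-∧ʳ {agree z v c e} t₃
  in agree⁻ x v a e (T-∧ˡ t) , agree⁻ y v b e (T-∧ˡ t₂) , agree⁻ z v c e (T-∧ˡ t₃) , agree⁻ w v d e t₄

fits₅⁺ : ∀ p x y z w v → Fits₅ p x y z w v → T (fits₅ p x y z w v)
fits₅⁺ (a ∷ b ∷ c ∷ d ∷ e ∷ []) x y z w v (f₁ , f₂ , f₃ , f₄) =
  T-∧⁺ (agree⁺ f₁) (T-∧⁺ (agree⁺ f₂) (T-∧⁺ (agree⁺ f₃) (agree⁺ f₄)))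

bad : Vec ℕ 5 → ℕ → ℕ → ℕ → ℕ → ℕ → Bool
bad p m x y z w = fits₄ p x y z w ∧ anyBelow m (fits₅ p x y z w)

-- The four letters are those with which `decode (e₁ ∷ e₂ ∷ e₃ ∷ e₄ ∷ es)` begins.
badᶜ : Vec ℕ 5 → ℕ → ℕ → ℕ → ℕ → ℕ → Bool
badᶜ p m e₁ e₂ e₃ e₄ = bad p m e₁ (pin e₁ e₂) (pin e₁ (pin e₂ e₃)) (pin e₁ (pin e₂ (pin e₃ e₄)))

bad⁻ : ∀ p m x y z w → T (bad p m x y z w) → Fits₄ p x y z w × ∃ λ v → v < m × Fits₅ p x y z w v
bad⁻ p m x y z w t with v , lt , f ← anyBelow⁻ m _ (T-∧ʳ {fits₄ p x y z w} t) =
  fits₄⁻ p x y z w (T-∧ˡ t) , v , lt , fits₅⁻ p x y z w v f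

bad⁺ : ∀ p m x y z w v → Fits₄ p x y z w → v < m → Fits₅ p x y z w v → T (bad p m x y z w)
bad⁺ p m x y z w v f lt g =
  T-∧⁺ (fits₄⁺ p x y z w f) (anyBelow⁺ (fits₅ p x y z w) lt (fits₅⁺ p x y z w v g))

module Pat (p : Vec ℕ 5) = Windows (badᶜ p)

count : Vec ℕ 5 → ℕ → ℕ
count p = Pat.count p

-- Sums over words and over codes

opaque
  ∑ʷ : ℕ → ℕ → (List ℕ → ℕ) → ℕ
  ∑ʷ M zero    F = F []
  ∑ʷ M (suc L) F = ∑[ x < M ] ∑ʷ M L (F ∘ (x ∷_))

  ∑ʷ-nil : ∀ M F → ∑ʷ M 0 F ≡ F []
  ∑ʷ-nil M F = refl

  ∑ʷ-suc : ∀ M L F → ∑ʷ M (suc L) F ≡ (∑[ x < M ] ∑ʷ M L (F ∘ (x ∷_)))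
  ∑ʷ-suc M L F = refl

  ∑ʷ-zero : ∀ M L {F} → (∀ ws → F ws ≡ 0) → ∑ʷ M L F ≡ 0
  ∑ʷ-zero M zero    eq = eq []
  ∑ʷ-zero M (suc L) eq = ∑-zero M λ x _ → ∑ʷ-zero M L λ ws → eq (x ∷ ws)

fresh : ℕ → List ℕ → Bool
fresh x []       = true
fresh x (y ∷ ys) = not (x ≡ᵇ y) ∧ fresh x ys

uniq : List ℕ → Bool
uniq []       = true
uniq (x ∷ xs) = fresh x xs ∧ uniq xs

n≡ᵇn : ∀ n → (n ≡ᵇ n) ≡ true
n≡ᵇn zero    = refl
n≡ᵇn (suc n) = n≡ᵇn n

pin-≡ᵇ : ∀ a x y → (pin a x ≡ᵇ pin a y) ≡ (x ≡ᵇ y)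
pin-≡ᵇ a x y = T-≡ (λ t → ≡⇒≡ᵇ x y (pin-injective a (≡ᵇ⇒≡ (pin a x) (pin a y) t)))
                   (λ t → ≡⇒≡ᵇ (pin a x) (pin a y) (cong (pin a) (≡ᵇ⇒≡ x y t)))

fresh-pin : ∀ a x xs → fresh (pin a x) (map (pin a) xs) ≡ fresh x xs
fresh-pin a x []       = refl
fresh-pin a x (y ∷ ys) = cong₂ (λ b c → not b ∧ c) (pin-≡ᵇ a x y) (fresh-pin a x ys)

uniq-pin : ∀ a xs → uniq (map (pin a) xs) ≡ uniq xs
uniq-pin a []       = refl
uniq-pin a (x ∷ xs) = cong₂ _∧_ (fresh-pin a x xs) (uniq-pin a xs)

∧-falseʳ : ∀ x {y} → y ≡ false → x ∧ y ≡ false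
∧-falseʳ true  eq = eq
∧-falseʳ false _  = refl

opaque
  unfolding ∑ʷ

  -- Words without the letter a are the images of words under `pin a`; all others contribute
  -- nothing.
  ∑ʷ-pin : ∀ M L a {F} → a ≤ M → (∀ ws → fresh a ws ≡ false → F ws ≡ 0) →
           ∑ʷ M L (F ∘ map (pin a)) ≡ ∑ʷ (suc M) L F
  ∑ʷ-pin M zero    a le vanish = refl
  ∑ʷ-pin M (suc L) a {F} le vanish = begin
    ∑[ x < M ] ∑ʷ M L (F ∘ (pin a x ∷_) ∘ map (pin a))
      ≡⟨ ∑-cong M (λ x _ → ∑ʷ-pin M L a le λ ws fr → vanish _ (∧-falseʳ (not (a ≡ᵇ pin a x)) fr)) ⟩
    ∑[ x < M ] ∑ʷ (suc M) L (F ∘ (pin a x ∷_))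
      ≡⟨ ∑-pin M a (λ x → ∑ʷ (suc M) L (F ∘ (x ∷_))) le
           (∑ʷ-zero (suc M) L λ ws → vanish _ (cong (λ b → not b ∧ fresh a ws) (n≡ᵇn a))) ⟩
    ∑[ x < suc M ] ∑ʷ (suc M) L (F ∘ (x ∷_)) ∎
    where open ≡-Reasoning

opaque
  unfolding ∑ʷ ∑ᶜ

  -- `decode` reaches every repetition-free word exactly once: behind a first letter e stands an
  -- arbitrary repetition-free word in the other letters, which `pin e` enumerates.
  ∑ᶜ-decode : ∀ M L {F} → (∀ ws → uniq ws ≡ false → F ws ≡ 0) → ∑ᶜ M L (F ∘ decode) ≡ ∑ʷ M L F
  ∑ᶜ-decode M       zero    vanish = refl
  ∑ᶜ-decode zero    (suc L) vanish = sym (∑-nil _)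
  ∑ᶜ-decode (suc M) (suc L) {F} vanish = ∑-cong (suc M) λ e le → begin
    ∑ᶜ M L (F ∘ (e ∷_) ∘ map (pin e) ∘ decode)
      ≡⟨ ∑ᶜ-decode M L (λ ws un → vanish _ (∧-falseʳ (fresh e (map (pin e) ws)) (trans (uniq-pin e ws) un))) ⟩
    ∑ʷ M L (F ∘ (e ∷_) ∘ map (pin e))
      ≡⟨ ∑ʷ-pin M L e (≤-pred le) (λ ws fr → vanish _ (cong (_∧ uniq ws) fr)) ⟩
    ∑ʷ (suc M) L (F ∘ (e ∷_)) ∎
    where open ≡-Reasoning

-- Non-overlapping patterns

pin-excess : ∀ a x → pin a x ≡ 𝟙 (a <ᵇ pin a x) + x
pin-excess zero    x       = refl
pin-excess (suc a) zero    = refl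
pin-excess (suc a) (suc x) = trans (cong suc (pin-excess a x)) (sym (+-suc _ x))

rank₄ : Vec ℕ 5 → ℕ
rank₄ (a ∷ b ∷ c ∷ d ∷ _ ∷ []) = 𝟙 (a <ᵇ d) + (𝟙 (b <ᵇ d) + 𝟙 (c <ᵇ d))

-- Each `pin` raises the last entry by one exactly if the earlier letter lies below the last one,
-- and the pattern tells how often that happens. Thus the last letter of a window determines the
-- entry with which the next window begins.
Fits₄-last : ∀ p e₁ e₂ e₃ e₄ → let w = pin e₁ (pin e₂ (pin e₃ e₄)) in
             Fits₄ p e₁ (pin e₁ e₂) (pin e₁ (pin e₂ e₃)) w → w ≡ rank₄ p + e₄
Fits₄-last (a ∷ b ∷ c ∷ d ∷ _ ∷ []) e₁ e₂ e₃ e₄ (_ , _ , f₁₄ , _ , f₂₄ , f₃₄) = begin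
  pin e₁ u                                                      ≡⟨ pin-excess e₁ u ⟩
  𝟙 (e₁ <ᵇ pin e₁ u) + u                                        ≡⟨ cong₂ (λ t x → 𝟙 t + x) (<-agree f₁₄) (pin-excess e₂ t) ⟩
  𝟙 (a <ᵇ d) + (𝟙 (e₂ <ᵇ pin e₂ t) + t)                         ≡⟨ cong₂ (λ s x → 𝟙 (a <ᵇ d) + (𝟙 s + x))
                                                                     (trans (sym (pin-<ᵇ e₁ e₂ (pin e₂ t))) (<-agree f₂₄)) (pin-excess e₃ e₄) ⟩
  𝟙 (a <ᵇ d) + (𝟙 (b <ᵇ d) + (𝟙 (e₃ <ᵇ pin e₃ e₄) + e₄))        ≡⟨ cong (λ s → 𝟙 (a <ᵇ d) + (𝟙 (b <ᵇ d) + (𝟙 s + e₄)))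
                                                                     (trans (sym (trans (pin-<ᵇ e₁ _ _) (pin-<ᵇ e₂ e₃ (pin e₃ e₄)))) (<-agree f₃₄)) ⟩
  𝟙 (a <ᵇ d) + (𝟙 (b <ᵇ d) + (𝟙 (c <ᵇ d) + e₄))                 ≡⟨ cong (𝟙 (a <ᵇ d) +_) (sym (+-assoc (𝟙 (b <ᵇ d)) _ e₄)) ⟩
  𝟙 (a <ᵇ d) + ((𝟙 (b <ᵇ d) + 𝟙 (c <ᵇ d)) + e₄)                 ≡⟨ sym (+-assoc (𝟙 (a <ᵇ d)) _ e₄) ⟩
  rank₄ (a ∷ b ∷ c ∷ d ∷ 0 ∷ []) + e₄                           ∎
  where
  open ≡-Reasoning
  t = pin e₃ e₄
  u = pin e₂ t

≢⇒fresh : ∀ {x y b} → x ≢ y → T b → T (not (x ≡ᵇ y) ∧ b)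
≢⇒fresh {x} {y} ne t with x ≡ᵇ y in eq
... | true  = ⊥-elim (ne (≡ᵇ⇒≡ x y (subst T (sym eq) tt)))
... | false = t

fresh⇒≢ : ∀ {x y} → T (not (x ≡ᵇ y)) → x ≢ y
fresh⇒≢ {x} t refl with x ≡ᵇ x | n≡ᵇn x
fresh⇒≢ {x} () refl | true | _

Distinct₄ : Vec ℕ 5 → Set
Distinct₄ (a ∷ b ∷ c ∷ d ∷ _ ∷ []) = a ≢ b × a ≢ c × a ≢ d × b ≢ c × b ≢ d × c ≢ d

Fits₄-uniq : ∀ p x y z w → Distinct₄ p → Fits₄ p x y z w → T (uniq (x ∷ y ∷ z ∷ w ∷ []))
Fits₄-uniq (a ∷ b ∷ c ∷ d ∷ _ ∷ []) x y z w (n₁ , n₂ , n₃ , n₄ , n₅ , n₆) (f₁ , f₂ , f₃ , f₄ , f₅ , f₆) =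
  T-∧⁺ (≢⇒fresh (n₁ ∘ Agree-≡ f₁) (≢⇒fresh (n₂ ∘ Agree-≡ f₂) (≢⇒fresh (n₃ ∘ Agree-≡ f₃) tt)))
    (T-∧⁺ (≢⇒fresh (n₄ ∘ Agree-≡ f₄) (≢⇒fresh (n₅ ∘ Agree-≡ f₅) tt))
      (T-∧⁺ (≢⇒fresh (n₆ ∘ Agree-≡ f₆) tt) tt))

-- σ₂σ₃σ₄ is not order-isomorphic to σ₁σ₂σ₃, nor σ₃σ₄ to σ₁σ₂.
NonOverlapping : Vec ℕ 5 → Set
NonOverlapping (a ∷ b ∷ c ∷ d ∷ _ ∷ []) =
  T (not (agree b c a b ∧ agree b d a c ∧ agree c d b c)) × T (not (agree c d a b))

not-T : ∀ {b} → T (not b) → T b → ⊥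
not-T {true} () _

𝟙-disjoint : ∀ x y → (T x → T y → ⊥) → 𝟙 x * 𝟙 y ≡ 0
𝟙-disjoint true  true  h = ⊥-elim (h tt tt)
𝟙-disjoint true  false h = refl
𝟙-disjoint false y     h = refl

module _ (p : Vec ℕ 5) (no : NonOverlapping p) where

  -- The three shared letters would be ordered both like σ₂σ₃σ₄ and like σ₁σ₂σ₃; the additional
  -- `pin e₁` seen from the first window changes no comparison.
  overlap₁ : ∀ m m′ e₁ e₂ e₃ e₄ e₅ → 𝟙 (badᶜ p m e₁ e₂ e₃ e₄) * 𝟙 (badᶜ p m′ e₂ e₃ e₄ e₅) ≡ 0
  overlap₁ m m′ e₁ e₂ e₃ e₄ e₅ = 𝟙-disjoint (badᶜ p m e₁ e₂ e₃ e₄) _ λ t t′ →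
    go p no (proj₁ (bad⁻ p m _ _ _ _ t)) (proj₁ (bad⁻ p m′ _ _ _ _ t′))
    where
    go : ∀ p → NonOverlapping p →
         Fits₄ p e₁ (pin e₁ e₂) (pin e₁ (pin e₂ e₃)) (pin e₁ (pin e₂ (pin e₃ e₄))) →
         Fits₄ p e₂ (pin e₂ e₃) (pin e₂ (pin e₃ e₄)) (pin e₂ (pin e₃ (pin e₄ e₅))) → ⊥
    go (a ∷ b ∷ c ∷ d ∷ _ ∷ []) (n , _) (_ , _ , _ , g₁ , g₂ , g₃) (f₁ , f₂ , _ , f₃ , _ , _) =
      not-T n (T-∧⁺ (agree⁺ (via g₁ f₁)) (T-∧⁺ (agree⁺ (via g₂ f₂)) (agree⁺ (via g₃ f₃))))
      where
      via : ∀ {x y a b c d} → Agree (pin e₁ x) (pin e₁ y) a b → Agree x y c d → Agree a b c d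
      via g f = Agree-trans (Agree-sym g) (Agree-trans (Agree-pin e₁ _ _) f)

  overlap₂ : ∀ m m′ e₁ e₂ e₃ e₄ e₅ e₆ → 𝟙 (badᶜ p m e₁ e₂ e₃ e₄) * 𝟙 (badᶜ p m′ e₃ e₄ e₅ e₆) ≡ 0
  overlap₂ m m′ e₁ e₂ e₃ e₄ e₅ e₆ = 𝟙-disjoint (badᶜ p m e₁ e₂ e₃ e₄) _ λ t t′ →
    go p no (proj₁ (bad⁻ p m _ _ _ _ t)) (proj₁ (bad⁻ p m′ _ _ _ _ t′))
    where
    go : ∀ p → NonOverlapping p →
         Fits₄ p e₁ (pin e₁ e₂) (pin e₁ (pin e₂ e₃)) (pin e₁ (pin e₂ (pin e₃ e₄))) →
         Fits₄ p e₃ (pin e₃ e₄) (pin e₃ (pin e₄ e₅)) (pin e₃ (pin e₄ (pin e₅ e₆))) → ⊥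
    go (a ∷ b ∷ c ∷ d ∷ _ ∷ []) (_ , n) (_ , _ , _ , _ , _ , g) (f , _ , _ , _ , _ , _) =
      not-T n (agree⁺ (Agree-trans (Agree-sym g)
        (Agree-trans (Agree-pin e₁ _ _) (Agree-trans (Agree-pin e₂ _ _) f))))

-- Only the number of completions for given end letters enters the count of clusters
-- whose windows share one letter at most.
_≈ᵏ_ : Vec ℕ 5 → Vec ℕ 5 → Set
p ≈ᵏ q = ∀ m x w →
  (∑[ y < m ] ∑[ z < m ] 𝟙 (bad p m x y z w)) ≡ (∑[ y < m ] ∑[ z < m ] 𝟙 (bad q m x y z w))

≈ᵏ-trans : ∀ {p q r} → p ≈ᵏ q → q ≈ᵏ r → p ≈ᵏ r
≈ᵏ-trans e f m x w = trans (e m x w) (f m x w)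

-- The two inner letters run over the same range, so their summations can be exchanged.
≈ᵏ-swap : ∀ a b c d e → (a ∷ b ∷ c ∷ d ∷ e ∷ []) ≈ᵏ (a ∷ c ∷ b ∷ d ∷ e ∷ [])
≈ᵏ-swap a b c d e m x w =
  trans (∑-cong m λ y _ → ∑-cong m λ z _ → cong 𝟙 (T-≡ (flip a b c d e x y z w) (flip a c b d e x z y w)))
        (∑-swap m m _)
  where
  flip : ∀ a b c d e x y z w → T (bad (a ∷ b ∷ c ∷ d ∷ e ∷ []) m x y z w) → T (bad (a ∷ c ∷ b ∷ d ∷ e ∷ []) m x z y w)
  flip a b c d e x y z w t with (f₁ , f₂ , f₃ , f₄ , f₅ , f₆) , v , lt , (g₁ , g₂ , g₃ , g₄) ← bad⁻ (a ∷ b ∷ c ∷ d ∷ e ∷ []) m x y z w t =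
    bad⁺ (a ∷ c ∷ b ∷ d ∷ e ∷ []) m x z y w v (f₂ , f₁ , f₃ , Agree-flip f₄ , f₆ , f₅) lt (g₁ , g₃ , g₂ , g₄)

hasAbove hasBelow : ℕ → (ℕ → Bool) → ℕ → Bool
hasAbove m Q b = Q b ∧ anyBelow m (λ v → Q v ∧ (b <ᵇ v))
hasBelow m Q b = Q b ∧ anyBelow m (λ v → Q v ∧ (v <ᵇ b))

size : ℕ → (ℕ → Bool) → ℕ
size m Q = ∑[ b < m ] 𝟙 (Q b)

anyBelow-cong : ∀ m {p q : ℕ → Bool} → (∀ v → p v ≡ q v) → anyBelow m p ≡ anyBelow m q
anyBelow-cong zero    eq = refl
anyBelow-cong (suc m) eq = cong₂ _∨_ (eq 0) (anyBelow-cong m (eq ∘ suc))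

any-size : ∀ m Q → 𝟙 (anyBelow m Q) + (size m Q ∸ 1) ≡ size m Q
any-size zero    Q rewrite ∑-nil (𝟙 ∘ Q) = refl
any-size (suc m) Q rewrite ∑-suc m (𝟙 ∘ Q) with Q 0
... | true  = refl
... | false = any-size m (Q ∘ suc)

-- Exactly the greatest element of Q has none above it; truncated subtraction covers the empty Q.
size-above : ∀ m Q → (∑[ b < m ] 𝟙 (hasAbove m Q b)) ≡ size m Q ∸ 1
size-above zero    Q = trans (∑-nil _) (cong (_∸ 1) (sym (∑-nil _)))
size-above (suc m) Q = begin
  ∑ (suc m) (𝟙 ∘ hasAbove (suc m) Q)
    ≡⟨ ∑-suc m _ ⟩
  𝟙 (hasAbove (suc m) Q 0) + (∑[ b < m ] 𝟙 (hasAbove (suc m) Q (suc b)))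
    ≡⟨ cong₂ (λ x y → 𝟙 x + y) (cong (λ x → Q 0 ∧ (x ∨ anyBelow m (λ v → Q (suc v) ∧ true))) (∧-falseʳ (Q 0) refl))
         (∑-cong m λ b _ → cong (λ x → 𝟙 (Q (suc b) ∧ (x ∨ anyBelow m (λ v → Q (suc v) ∧ (b <ᵇ v))))) (∧-falseʳ (Q 0) refl)) ⟩
  𝟙 (Q 0 ∧ anyBelow m (λ v → Q (suc v) ∧ true)) + (∑[ b < m ] 𝟙 (hasAbove m (Q ∘ suc) b))
    ≡⟨ cong₂ (λ x y → 𝟙 (Q 0 ∧ x) + y) (anyBelow-cong m λ v → ∧-identityʳ (Q (suc v))) (size-above m (Q ∘ suc)) ⟩
  𝟙 (Q 0 ∧ anyBelow m (Q ∘ suc)) + (size m (Q ∘ suc) ∸ 1)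
    ≡⟨ finish (Q 0) ⟩
  𝟙 (Q 0) + size m (Q ∘ suc) ∸ 1
    ≡⟨ cong (_∸ 1) (sym (∑-suc m _)) ⟩
  size (suc m) Q ∸ 1 ∎
  where
  open ≡-Reasoning
  finish : ∀ q → 𝟙 (q ∧ anyBelow m (Q ∘ suc)) + (size m (Q ∘ suc) ∸ 1) ≡ 𝟙 q + size m (Q ∘ suc) ∸ 1
  finish true  = any-size m (Q ∘ suc)
  finish false = refl

size-below : ∀ m Q → (∑[ b < m ] 𝟙 (hasBelow m Q b)) ≡ size m Q ∸ 1
size-below zero    Q = trans (∑-nil _) (cong (_∸ 1) (sym (∑-nil _)))
size-below (suc m) Q = begin
  ∑ (suc m) (𝟙 ∘ hasBelow (suc m) Q)
    ≡⟨ ∑-suc m _ ⟩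
  𝟙 (hasBelow (suc m) Q 0) + (∑[ b < m ] 𝟙 (hasBelow (suc m) Q (suc b)))
    ≡⟨ cong₂ _+_ (cong 𝟙 (trans (cong (Q 0 ∧_) (none (suc m) λ v → ∧-falseʳ (Q v) refl)) (∧-falseʳ (Q 0) refl)))
         (∑-cong m λ b _ → cong (λ x → 𝟙 (Q (suc b) ∧ (x ∨ anyBelow m (λ v → Q (suc v) ∧ (v <ᵇ b))))) (∧-identityʳ (Q 0))) ⟩
  ∑[ b < m ] 𝟙 (Q (suc b) ∧ (Q 0 ∨ anyBelow m (λ v → Q (suc v) ∧ (v <ᵇ b))))
    ≡⟨ finish (Q 0) ⟩
  𝟙 (Q 0) + size m (Q ∘ suc) ∸ 1
    ≡⟨ cong (_∸ 1) (sym (∑-suc m _)) ⟩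
  size (suc m) Q ∸ 1 ∎
  where
  open ≡-Reasoning
  none : ∀ m {p : ℕ → Bool} → (∀ v → p v ≡ false) → anyBelow m p ≡ false
  none zero    eq = refl
  none (suc m) eq = cong₂ _∨_ (eq 0) (none m (eq ∘ suc))
  finish : ∀ q → (∑[ b < m ] 𝟙 (Q (suc b) ∧ (q ∨ anyBelow m (λ v → Q (suc v) ∧ (v <ᵇ b))))) ≡
                 𝟙 q + size m (Q ∘ suc) ∸ 1
  finish true  = ∑-cong m λ b _ → cong 𝟙 (∧-identityʳ (Q (suc b)))
  finish false = size-below m (Q ∘ suc)

<ᵇ-agree : ∀ {x y a b} → (a <ᵇ b) ≡ true → T (x <ᵇ y) → Agree x y a b
<ᵇ-agree {x} {y} {a} {b} a<b x<y = agreeing (trans (T⇒true x<y) (sym a<b))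
  (trans (¬T⇒false (λ t → <-asym (<ᵇ⇒< x y x<y) (<ᵇ⇒< y x t)))
         (sym (¬T⇒false λ t → <-asym (<ᵇ⇒< a b (subst T (sym a<b) tt)) (<ᵇ⇒< b a t))))

-- Exchanging the consecutive values c < e of the third letter and of the fifth: the
-- admissible third letters form an interval, and either its greatest or its least
-- element must be left to the fifth letter.
≈ᵏ-slide : ∀ a b c d e → (c <ᵇ e) ≡ true → Agree a c a e → Agree b c b e → Agree c d e d →
           (a ∷ b ∷ c ∷ d ∷ e ∷ []) ≈ᵏ (a ∷ b ∷ e ∷ d ∷ c ∷ [])
≈ᵏ-slide a b c d e c<e ac bc cd m x w = ∑-cong m λ y _ → begin
  ∑[ z < m ] 𝟙 (bad p m x y z w)         ≡⟨ ∑-cong m (λ z _ → cong 𝟙 (T-≡ (p⇒ y z) (p⇐ y z))) ⟩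
  ∑[ z < m ] 𝟙 (hasAbove m (Q y) z)      ≡⟨ trans (size-above m (Q y)) (sym (size-below m (Q y))) ⟩
  ∑[ z < m ] 𝟙 (hasBelow m (Q y) z)      ≡⟨ ∑-cong m (λ z _ → cong 𝟙 (T-≡ (q⇐ y z) (q⇒ y z))) ⟩
  ∑[ z < m ] 𝟙 (bad q m x y z w)         ∎
  where
  open ≡-Reasoning
  p = a ∷ b ∷ c ∷ d ∷ e ∷ []
  q = a ∷ b ∷ e ∷ d ∷ c ∷ []
  Q : ℕ → ℕ → Bool
  Q y z = fits₄ p x y z w
  dc : Agree d c d e
  dc = Agree-flip cd

  -- As c and e compare alike with a, b and d, the fifth letter v could itself stand in third place.
  p⇒ : ∀ y z → T (bad p m x y z w) → T (hasAbove m (Q y) z)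
  p⇒ y z t with (f₁ , f₂ , f₃ , f₄ , f₅ , f₆) , v , lt , (g₁ , g₂ , g₃ , g₄) ← bad⁻ p m x y z w t =
    T-∧⁺ (fits₄⁺ p x y z w (f₁ , f₂ , f₃ , f₄ , f₅ , f₆)) (anyBelow⁺ _ lt (T-∧⁺
      (fits₄⁺ p x y v w (f₁ , Agree-trans g₁ (Agree-sym ac) , f₃ , Agree-trans g₂ (Agree-sym bc) , f₅ ,
                         Agree-flip (Agree-trans g₄ (Agree-sym dc))))
      (subst T (sym (trans (<-agree g₃) c<e)) tt)))

  p⇐ : ∀ y z → T (hasAbove m (Q y) z) → T (bad p m x y z w)
  p⇐ y z t with v , lt , t₂ ← anyBelow⁻ m _ (T-∧ʳ {Q y z} t)
    with (_ , g₂ , _ , g₄ , _ , g₆) ← fits₄⁻ p x y v w (T-∧ˡ t₂) =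
    bad⁺ p m x y z w v (fits₄⁻ p x y z w (T-∧ˡ t)) lt
      (Agree-trans g₂ ac , Agree-trans g₄ bc , <ᵇ-agree c<e (T-∧ʳ {Q y v} t₂) , Agree-trans (Agree-flip g₆) dc)

  q⇐ : ∀ y z → T (hasBelow m (Q y) z) → T (bad q m x y z w)
  q⇐ y z t with v , lt , t₂ ← anyBelow⁻ m _ (T-∧ʳ {Q y z} t)
    with (f₁ , f₂ , f₃ , f₄ , f₅ , f₆) ← fits₄⁻ p x y z w (T-∧ˡ t)
       | (_ , g₂ , _ , g₄ , _ , g₆) ← fits₄⁻ p x y v w (T-∧ˡ t₂) =
    bad⁺ q m x y z w v (f₁ , Agree-trans f₂ ac , f₃ , Agree-trans f₄ bc , f₅ , Agree-trans f₆ cd) lt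
      (g₂ , g₄ , Agree-flip (<ᵇ-agree c<e (T-∧ʳ {Q y v} t₂)) , Agree-flip g₆)

  q⇒ : ∀ y z → T (bad q m x y z w) → T (hasBelow m (Q y) z)
  q⇒ y z t with (f₁ , f₂ , f₃ , f₄ , f₅ , f₆) , v , lt , (g₁ , g₂ , g₃ , g₄) ← bad⁻ q m x y z w t =
    T-∧⁺ (fits₄⁺ p x y z w (f₁ , Agree-trans f₂ (Agree-sym ac) , f₃ , Agree-trans f₄ (Agree-sym bc) , f₅ ,
                            Agree-trans f₆ (Agree-sym cd)))
      (anyBelow⁺ _ lt (T-∧⁺ (fits₄⁺ p x y v w (f₁ , g₁ , f₃ , g₂ , f₅ , Agree-flip g₄))
        (subst T (sym (trans (>-agree g₃) c<e)) tt)))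

∑-δ : ∀ n c (X : ℕ → ℕ) → c < n → (∑[ w < n ] X w * 𝟙 (w ≡ᵇ c)) ≡ X c
∑-δ (suc n) zero    X _ = trans (∑-suc n _)
  (trans (cong₂ _+_ (*-identityʳ (X 0)) (∑-zero n λ w _ → *-zeroʳ (X (suc w)))) (+-identityʳ (X 0)))
∑-δ (suc n) (suc c) X (s≤s lt) = trans (∑-suc n _) (cong₂ _+_ (*-zeroʳ (X 0)) (∑-δ n c (X ∘ suc) lt))

opaque
  unfolding ∑ᶜ ∑ʷ

  ∑ᶜ₄ : ∀ k F → ∑ᶜ (4 + k) 4 F ≡
    (∑[ x < 4 + k ] ∑[ y < 3 + k ] ∑[ z < 2 + k ] ∑[ w < 1 + k ] F (x ∷ y ∷ z ∷ w ∷ []))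
  ∑ᶜ₄ k F = refl

  ∑ʷ₄ : ∀ M F → ∑ʷ M 4 F ≡ (∑[ x < M ] ∑[ y < M ] ∑[ z < M ] ∑[ w < M ] F (x ∷ y ∷ z ∷ w ∷ []))
  ∑ʷ₄ M F = refl

∑-rotate : ∀ n₁ n₂ n₃ n₄ (f : ℕ → ℕ → ℕ → ℕ → ℕ) →
           (∑[ x < n₁ ] ∑[ y < n₂ ] ∑[ z < n₃ ] ∑[ w < n₄ ] f x y z w) ≡
           (∑[ x < n₁ ] ∑[ w < n₄ ] ∑[ y < n₂ ] ∑[ z < n₃ ] f x y z w)
∑-rotate n₁ n₂ n₃ n₄ f = ∑-cong n₁ λ x _ →
  trans (∑-cong n₂ λ y _ → ∑-swap n₃ n₄ (f x y)) (∑-swap n₂ n₄ (λ y w → ∑ n₃ (λ z → f x y z w)))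

module _ (p : Vec ℕ 5) (dist : Distinct₄ p) (k : ℕ) (f : ℕ → ℕ) (G : ℕ → ℕ) where

  private
    M = 4 + k

    F : List ℕ → ℕ
    F (x ∷ y ∷ z ∷ w ∷ []) = f x * (𝟙 (bad p M x y z w) * G (w ∸ rank₄ p))
    F _                    = 0

    vanish : ∀ ws → uniq ws ≡ false → F ws ≡ 0
    vanish (x ∷ y ∷ z ∷ w ∷ []) un =
      trans (cong (λ t → f x * (𝟙 t * G (w ∸ rank₄ p))) (¬T⇒false {bad p M x y z w} λ t →
              subst T un (Fits₄-uniq p x y z w dist (proj₁ (bad⁻ p M x y z w t)))))
            (*-zeroʳ (f x))
    vanish []                        _ = refl
    vanish (_ ∷ [])                  _ = refl
    vanish (_ ∷ _ ∷ [])              _ = refl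
    vanish (_ ∷ _ ∷ _ ∷ [])          _ = refl
    vanish (_ ∷ _ ∷ _ ∷ _ ∷ _ ∷ _)   _ = refl

    last-code : ∀ x y z w → 𝟙 (badᶜ p M x y z w) * G (pin x (pin y (pin z w)) ∸ rank₄ p) ≡ 𝟙 (badᶜ p M x y z w) * G w
    last-code x y z w with badᶜ p M x y z w in eq
    ... | false = refl
    ... | true  = cong (λ v → G v + 0) (trans
      (cong (_∸ rank₄ p) (Fits₄-last p x y z w (proj₁ (bad⁻ p M _ _ _ _ (subst T (sym eq) tt)))))
      (m+n∸m≡n (rank₄ p) w))

  -- On the left the ranges shrink and the entries interact through `pin`; on the right all letters
  -- have the same range, so that for given end letters the inner two are merely counted. G is
  -- transported along `Fits₄-last`.
  window-sum : (∑[ x < 4 + k ] ∑[ y < 3 + k ] ∑[ z < 2 + k ] ∑[ w < 1 + k ] f x * (𝟙 (badᶜ p M x y z w) * G w)) ≡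
               (∑[ x < M ] ∑[ w < M ] f x * ((∑[ y < M ] ∑[ z < M ] 𝟙 (bad p M x y z w)) * G (w ∸ rank₄ p)))
  window-sum = begin
    (∑[ x < 4 + k ] ∑[ y < 3 + k ] ∑[ z < 2 + k ] ∑[ w < 1 + k ] f x * (𝟙 (badᶜ p M x y z w) * G w))
      ≡⟨ (∑-cong (4 + k) λ x _ → ∑-cong (3 + k) λ y _ → ∑-cong (2 + k) λ z _ → ∑-cong (1 + k) λ w _ →
            cong (f x *_) (sym (last-code x y z w))) ⟩
    (∑[ x < 4 + k ] ∑[ y < 3 + k ] ∑[ z < 2 + k ] ∑[ w < 1 + k ] F (decode (x ∷ y ∷ z ∷ w ∷ [])))
      ≡⟨ sym (∑ᶜ₄ k (F ∘ decode)) ⟩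
    ∑ᶜ M 4 (F ∘ decode)
      ≡⟨ ∑ᶜ-decode M 4 vanish ⟩
    ∑ʷ M 4 F
      ≡⟨ ∑ʷ₄ M F ⟩
    (∑[ x < M ] ∑[ y < M ] ∑[ z < M ] ∑[ w < M ] F (x ∷ y ∷ z ∷ w ∷ []))
      ≡⟨ ∑-rotate M M M M (λ x y z w → F (x ∷ y ∷ z ∷ w ∷ [])) ⟩
    (∑[ x < M ] ∑[ w < M ] ∑[ y < M ] ∑[ z < M ] f x * (𝟙 (bad p M x y z w) * G (w ∸ rank₄ p)))
      ≡⟨ (∑-cong M λ x _ → ∑-cong M λ w _ → trans
            (∑-cong M λ y _ → trans (∑-*ˡ M (f x) _) (cong (f x *_) (∑-*ʳ M (G (w ∸ rank₄ p)) _)))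
            (trans (∑-*ˡ M (f x) _) (cong (f x *_) (∑-*ʳ M (G (w ∸ rank₄ p)) _)))) ⟩
    (∑[ x < M ] ∑[ w < M ] f x * ((∑[ y < M ] ∑[ z < M ] 𝟙 (bad p M x y z w)) * G (w ∸ rank₄ p))) ∎
    where open ≡-Reasoning

window-sum-at : ∀ (b : ℕ → ℕ → ℕ → ℕ → ℕ → Bool) k (f : ℕ → ℕ) c → c < 1 + k →
  (∑[ x < 4 + k ] ∑[ y < 3 + k ] ∑[ z < 2 + k ] ∑[ w < 1 + k ] f x * (𝟙 (b (4 + k) x y z w) * 𝟙 (w ≡ᵇ c))) ≡
  (∑[ z < 2 + k ] ∑[ y < 3 + k ] ∑[ x < 4 + k ] f x * 𝟙 (b (4 + k) x y z c))
window-sum-at b k f c lt = begin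
  (∑[ x < 4 + k ] ∑[ y < 3 + k ] ∑[ z < 2 + k ] ∑[ w < 1 + k ] f x * (𝟙 (b (4 + k) x y z w) * 𝟙 (w ≡ᵇ c)))
    ≡⟨ (∑-cong (4 + k) λ x _ → ∑-cong (3 + k) λ y _ → ∑-cong (2 + k) λ z _ → trans
          (∑-cong (1 + k) λ w _ → sym (*-assoc (f x) (𝟙 (b (4 + k) x y z w)) (𝟙 (w ≡ᵇ c))))
          (∑-δ (1 + k) c (λ w → f x * 𝟙 (b (4 + k) x y z w)) lt)) ⟩
  (∑[ x < 4 + k ] ∑[ y < 3 + k ] ∑[ z < 2 + k ] f x * 𝟙 (b (4 + k) x y z c))
    ≡⟨ ∑-swap (4 + k) (3 + k) _ ⟩
  (∑[ y < 3 + k ] ∑[ x < 4 + k ] ∑[ z < 2 + k ] f x * 𝟙 (b (4 + k) x y z c))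
    ≡⟨ (∑-cong (3 + k) λ y _ → ∑-swap (4 + k) (2 + k) _) ⟩
  (∑[ y < 3 + k ] ∑[ z < 2 + k ] ∑[ x < 4 + k ] f x * 𝟙 (b (4 + k) x y z c))
    ≡⟨ ∑-swap (3 + k) (2 + k) _ ⟩
  (∑[ z < 2 + k ] ∑[ y < 3 + k ] ∑[ x < 4 + k ] f x * 𝟙 (b (4 + k) x y z c)) ∎
  where open ≡-Reasoning

-- In clusters of a non-overlapping pattern consecutive windows share one letter, so
-- that only the first and the last letter of a window matter.
module _ (p q : Vec ℕ 5) (dp : Distinct₄ p) (dq : Distinct₄ q)
         (nop : NonOverlapping p) (noq : NonOverlapping q)
         (same-rank : rank₄ p ≡ rank₄ q) (eq : p ≈ᵏ q) where

  private
    module X = Pat p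
    module Y = Pat q

    -- Testing `window-sum` with the indicator of c isolates the windows with last entry c; their
    -- end letters then give equal numbers by `≈ᵏ`.
    transfer-sum : ∀ k f c → c < 1 + k →
      (∑[ z < 2 + k ] ∑[ y < 3 + k ] ∑[ x < 4 + k ] f x * 𝟙 (badᶜ p (4 + k) x y z c)) ≡
      (∑[ z < 2 + k ] ∑[ y < 3 + k ] ∑[ x < 4 + k ] f x * 𝟙 (badᶜ q (4 + k) x y z c))
    transfer-sum k f c lt = begin
      _ ≡⟨ sym (window-sum-at (badᶜ p) k f c lt) ⟩
      _ ≡⟨ window-sum p dp k f (λ w → 𝟙 (w ≡ᵇ c)) ⟩
      _ ≡⟨ (∑-cong (4 + k) λ x _ → ∑-cong (4 + k) λ w _ → cong (f x *_)
              (cong₂ (λ s r → s * 𝟙 ((w ∸ r) ≡ᵇ c)) (eq (4 + k) x w) same-rank)) ⟩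
      _ ≡⟨ sym (window-sum q dq k f (λ w → 𝟙 (w ≡ᵇ c))) ⟩
      _ ≡⟨ window-sum-at (badᶜ q) k f c lt ⟩
      _ ∎
      where open ≡-Reasoning

    record Headed (m : ℕ) (f : ℕ → ℕ) (φ : List ℕ → ℕ) : Set where
      constructor headed
      field at-head : ∀ e es → e < m → φ (e ∷ es) ≡ f e
    open Headed

    module Side (p : Vec ℕ 5) (no : NonOverlapping p) where
      open Pat p

      Void : ℕ → (List ℕ → ℕ) → Set
      Void m φ = ∀ es → cut m φ es ≡ 0

      push-void : ∀ m ψ → (∀ es → ψ es ≡ 0) → ∀ es → push m ψ es ≡ 0
      push-void m ψ v es = ∑-zero m λ e _ → v (e ∷ es)

      cut-void : ∀ m {φ} → (∀ es → φ es ≡ 0) → Void m φ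
      cut-void m v es = cong (_* 𝟙 (marked m es)) (v es)

      void₁ : ∀ k φ → Void (4 + k) φ → ∀ es → φ₁ k φ es ≡ 0
      void₁ k φ v = push-void (4 + k) _ v
      void₂ : ∀ k φ → Void (4 + k) φ → ∀ es → φ₂ k φ es ≡ 0
      void₂ k φ v = push-void (3 + k) _ (void₁ k φ v)
      void₃ : ∀ k φ → Void (4 + k) φ → ∀ es → φ₃ k φ es ≡ 0
      void₃ k φ v = push-void (2 + k) _ (void₂ k φ v)
      void₄ : ∀ k φ → Void (4 + k) φ → ∀ es → φ₄ k φ es ≡ 0
      void₄ k φ v = push-void (1 + k) _ (void₃ k φ v)

      cut-short : ∀ m φ es → marked m es ≡ false → cut m φ es ≡ 0
      cut-short m φ es e = trans (cong (λ t → φ es * 𝟙 t) e) (*-zeroʳ (φ es))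

      module _ {k f φ} (h : Headed (4 + k) f φ) where

        φ₁-headed : ∀ y z w es → φ₁ k φ (y ∷ z ∷ w ∷ es) ≡ (∑[ x < 4 + k ] f x * 𝟙 (badᶜ p (4 + k) x y z w))
        φ₁-headed y z w es = ∑-cong (4 + k) λ x lx → cong (_* 𝟙 (badᶜ p (4 + k) x y z w)) (at-head h x (y ∷ z ∷ w ∷ es) lx)

        φ₂-headed : ∀ z w es → φ₂ k φ (z ∷ w ∷ es) ≡ (∑[ y < 3 + k ] ∑[ x < 4 + k ] f x * 𝟙 (badᶜ p (4 + k) x y z w))
        φ₂-headed z w es = ∑-cong (3 + k) λ y _ → φ₁-headed y z w es

        φ₃-headed : ∀ w es → φ₃ k φ (w ∷ es) ≡ (∑[ z < 2 + k ] ∑[ y < 3 + k ] ∑[ x < 4 + k ] f x * 𝟙 (badᶜ p (4 + k) x y z w))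
        φ₃-headed w es = ∑-cong (2 + k) λ z _ → φ₂-headed z w es

        kill₁ : ∀ y z w v → (∑[ x < 4 + k ] f x * 𝟙 (badᶜ p (4 + k) x y z w)) * 𝟙 (badᶜ p (3 + k) y z w v) ≡ 0
        kill₁ y z w v = trans (sym (∑-*ʳ (4 + k) (𝟙 (badᶜ p (3 + k) y z w v)) _)) (∑-zero (4 + k) λ x _ →
          trans (*-assoc (f x) _ _) (trans (cong (f x *_) (overlap₁ p no (4 + k) (3 + k) x y z w v)) (*-zeroʳ (f x))))

        kill₂ : ∀ y z w v u → (∑[ x < 4 + k ] f x * 𝟙 (badᶜ p (4 + k) x y z w)) * 𝟙 (badᶜ p (2 + k) z w v u) ≡ 0
        kill₂ y z w v u = trans (sym (∑-*ʳ (4 + k) (𝟙 (badᶜ p (2 + k) z w v u)) _)) (∑-zero (4 + k) λ x _ →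
          trans (*-assoc (f x) _ _) (trans (cong (f x *_) (overlap₂ p no (4 + k) (2 + k) x y z w v u)) (*-zeroʳ (f x))))

        headed₁ : Void (3 + k) (φ₁ k φ)
        headed₁ es@(y ∷ z ∷ w ∷ v ∷ es′) = trans (cong (_* 𝟙 (badᶜ p (3 + k) y z w v)) (φ₁-headed y z w (v ∷ es′))) (kill₁ y z w v)
        headed₁ []              = cut-short (3 + k) (φ₁ k φ) [] refl
        headed₁ (y ∷ [])        = cut-short (3 + k) (φ₁ k φ) (y ∷ []) refl
        headed₁ (y ∷ z ∷ [])    = cut-short (3 + k) (φ₁ k φ) (y ∷ z ∷ []) refl
        headed₁ (y ∷ z ∷ w ∷ []) = cut-short (3 + k) (φ₁ k φ) (y ∷ z ∷ w ∷ []) refl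

        headed₂ : Void (2 + k) (φ₂ k φ)
        headed₂ es@(z ∷ w ∷ v ∷ u ∷ es′) = trans (cong (_* 𝟙 (badᶜ p (2 + k) z w v u)) (φ₂-headed z w (v ∷ u ∷ es′)))
          (trans (sym (∑-*ʳ (3 + k) (𝟙 (badᶜ p (2 + k) z w v u)) _)) (∑-zero (3 + k) λ y _ → kill₂ y z w v u))
        headed₂ []              = cut-short (2 + k) (φ₂ k φ) [] refl
        headed₂ (y ∷ [])        = cut-short (2 + k) (φ₂ k φ) (y ∷ []) refl
        headed₂ (y ∷ z ∷ [])    = cut-short (2 + k) (φ₂ k φ) (y ∷ z ∷ []) refl
        headed₂ (y ∷ z ∷ w ∷ []) = cut-short (2 + k) (φ₂ k φ) (y ∷ z ∷ w ∷ []) refl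

    module P = Side p nop
    module Q = Side q noq

    -- After an overlap of two or three letters nothing is left on either side; after an overlap of
    -- one letter both contributions are the same function of that letter.
    Paired : ℕ → (List ℕ → ℕ) → (List ℕ → ℕ) → Set
    Paired m φ ψ = (P.Void m φ × Q.Void m ψ) ⊎ ∃ λ f → Headed m f φ × Headed m f ψ

    last : ℕ → (ℕ → ℕ) → ℕ → ℕ
    last k f w = ∑[ z < 2 + k ] ∑[ y < 3 + k ] ∑[ x < 4 + k ] f x * 𝟙 (badᶜ p (4 + k) x y z w)

    q₃-headed : ∀ {k f ψ} → Headed (4 + k) f ψ → Headed (1 + k) (last k f) (Y.φ₃ k ψ)
    q₃-headed {k} {f} h = headed λ w es lw → trans (Q.φ₃-headed h w es) (sym (transfer-sum k f w lw))

  nonOverlapping-count : ∀ n → count p n ≡ count q n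
  nonOverlapping-count = Transfer.counts (badᶜ p) (badᶜ q) Paired
    (λ { k φ ψ (inj₁ (v , v′)) → inj₁ (P.cut-void (3 + k) (P.void₁ k φ v) , Q.cut-void (3 + k) (Q.void₁ k ψ v′))
       ; k φ ψ (inj₂ (f , h , h′)) → inj₁ (P.headed₁ h , Q.headed₁ h′) })
    (λ { k φ ψ (inj₁ (v , v′)) → inj₁ (P.cut-void (2 + k) (P.void₂ k φ v) , Q.cut-void (2 + k) (Q.void₂ k ψ v′))
       ; k φ ψ (inj₂ (f , h , h′)) → inj₁ (P.headed₂ h , Q.headed₂ h′) })
    (λ { k φ ψ (inj₁ (v , v′)) → inj₁ (P.cut-void (1 + k) (P.void₃ k φ v) , Q.cut-void (1 + k) (Q.void₃ k ψ v′))
       ; k φ ψ (inj₂ (f , h , h′)) → inj₂ (last k f , headed (λ w es _ → P.φ₃-headed h w es) , q₃-headed h′) })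
    (λ { k φ ψ (inj₁ (v , v′)) → 0 , P.void₄ k φ v , Q.void₄ k ψ v′
       ; k φ ψ (inj₂ (f , h , h′)) → ∑ (1 + k) (last k f) ,
           (λ es → ∑-cong (1 + k) λ w _ → P.φ₃-headed h w es) ,
           (λ es → ∑-cong (1 + k) λ w → at-head (q₃-headed h′) w es) })
    (λ m → inj₂ (const 1 , headed (λ _ _ _ → refl) , headed λ _ _ _ → refl))

-- Counting by a transfer matrix

module _ {A : Set} where

  tabulateFrom : ℕ → ℕ → (ℕ → A) → List A
  tabulateFrom i zero    f = []
  tabulateFrom i (suc n) f = f i ∷ tabulateFrom (suc i) n f

  mapFrom : {B : Set} → ℕ → (ℕ → A → B) → List A → List B
  mapFrom i g []       = []
  mapFrom i g (x ∷ xs) = g i x ∷ mapFrom (suc i) g xs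

  sumFrom : ℕ → (ℕ → A → ℕ) → List A → ℕ
  sumFrom i g []       = 0
  sumFrom i g (x ∷ xs) = g i x + sumFrom (suc i) g xs

Table : Set
Table = List (List (List ℕ))

-- A table lists the numbers of admissible continuations by the three leading entries y, z, w. A new
-- first entry x forms a window with just these, and the result is indexed by x, y, z.
extend : (ℕ → ℕ → ℕ → ℕ → Bool) → ℕ → Table → Table
extend b m t = tabulateFrom 0 m λ x → mapFrom 0 (λ y → mapFrom 0 (λ z → sumFrom 0 (λ w v → if b x y z w then 0 else v))) t

table : (ℕ → ℕ → ℕ → ℕ → ℕ → Bool) → ℕ → Table
table b zero    = tabulateFrom 0 3 λ _ → tabulateFrom 0 2 λ _ → tabulateFrom 0 1 λ _ → 1
table b (suc k) = extend (b (4 + k)) (4 + k) (table b k)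

total₃ : Table → ℕ
total₃ = sumFrom 0 λ _ → sumFrom 0 λ _ → sumFrom 0 λ _ v → v

module _ {A : Set} where

  tabulateFrom-cong : ∀ i n {f g : ℕ → A} → (∀ j → f j ≡ g j) → tabulateFrom i n f ≡ tabulateFrom i n g
  tabulateFrom-cong i zero    eq = refl
  tabulateFrom-cong i (suc n) eq = cong₂ _∷_ (eq i) (tabulateFrom-cong (suc i) n eq)

  mapFrom-tabulate : {B : Set} → ∀ i n (g : ℕ → A → B) f →
                     mapFrom i g (tabulateFrom i n f) ≡ tabulateFrom i n (λ j → g j (f j))
  mapFrom-tabulate i zero    g f = refl
  mapFrom-tabulate i (suc n) g f = cong (g i (f i) ∷_) (mapFrom-tabulate (suc i) n g f)

  sumFrom-tabulate : ∀ i n (g : ℕ → A → ℕ) f →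
                     sumFrom i g (tabulateFrom i n f) ≡ (∑[ j < n ] g (i + j) (f (i + j)))
  sumFrom-tabulate i zero    g f = sym (∑-nil _)
  sumFrom-tabulate i (suc n) g f = trans
    (cong₂ _+_ (cong (λ j → g j (f j)) (sym (+-identityʳ i)))
      (trans (sumFrom-tabulate (suc i) n g f) (∑-cong n λ j _ → cong (λ l → g l (f l)) (sym (+-suc i j)))))
    (sym (∑-suc n _))

module _ (b : ℕ → ℕ → ℕ → ℕ → ℕ → Bool) where
  open Windows b using (weight) renaming (count to countʷ)

  entry : ℕ → ℕ → ℕ → ℕ → ℕ
  entry k x y z = ∑ᶜ k k (λ es → weight (3 + k) (x ∷ y ∷ z ∷ es))

  entry-suc : ∀ k x y z → entry (suc k) x y z ≡ (∑[ w < suc k ] (if b (4 + k) x y z w then 0 else entry k y z w))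
  entry-suc k x y z = trans (∑ᶜ-suc k k _) (∑-cong (suc k) λ w _ →
    trans (∑ᶜ-*ˡ k k (𝟙 (not (b (4 + k) x y z w))) _) (go (b (4 + k) x y z w) (entry k y z w)))
    where
    go : ∀ t n → 𝟙 (not t) * n ≡ (if t then 0 else n)
    go true  n = refl
    go false n = +-identityʳ n

  entries : ℕ → Table
  entries k = tabulateFrom 0 (3 + k) λ x → tabulateFrom 0 (2 + k) λ y → tabulateFrom 0 (1 + k) λ z → entry k x y z

  table-entries : ∀ k → table b k ≡ entries k
  table-entries zero    = tabulateFrom-cong 0 3 λ x → tabulateFrom-cong 0 2 λ y → tabulateFrom-cong 0 1 λ z →
    sym (∑ᶜ-nil 0 (λ es → weight 3 (x ∷ y ∷ z ∷ es)))
  table-entries (suc k) rewrite table-entries k = tabulateFrom-cong 0 (4 + k) λ x →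
    trans (mapFrom-tabulate 0 (3 + k) _ _) (tabulateFrom-cong 0 (3 + k) λ y →
      trans (mapFrom-tabulate 0 (2 + k) _ _) (tabulateFrom-cong 0 (2 + k) λ z →
        trans (sumFrom-tabulate 0 (1 + k) _ _) (sym (entry-suc k x y z))))

  total-entries : ∀ k → total₃ (entries k) ≡ countʷ (3 + k)
  total-entries k = begin
    sumFrom 0 (λ _ → rows) (tabulateFrom 0 (3 + k) plane)
      ≡⟨ sumFrom-tabulate 0 (3 + k) (λ _ → rows) plane ⟩
    (∑[ x < 3 + k ] rows (plane x))
      ≡⟨ (∑-cong (3 + k) λ x _ → sumFrom-tabulate 0 (2 + k) (λ _ → cells) (row x)) ⟩
    (∑[ x < 3 + k ] ∑[ y < 2 + k ] cells (row x y))
      ≡⟨ (∑-cong (3 + k) λ x _ → ∑-cong (2 + k) λ y _ → sumFrom-tabulate 0 (1 + k) (λ _ v → v) (entry k x y)) ⟩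
    (∑[ x < 3 + k ] ∑[ y < 2 + k ] ∑[ z < 1 + k ] entry k x y z)
      ≡⟨ (∑-cong (3 + k) λ x _ → ∑-cong (2 + k) λ y _ → sym (∑ᶜ-suc k k (λ es → weight (3 + k) (x ∷ y ∷ es)))) ⟩
    (∑[ x < 3 + k ] ∑[ y < 2 + k ] ∑ᶜ (1 + k) (1 + k) (λ es → weight (3 + k) (x ∷ y ∷ es)))
      ≡⟨ (∑-cong (3 + k) λ x _ → sym (∑ᶜ-suc (1 + k) (1 + k) (λ es → weight (3 + k) (x ∷ es)))) ⟩
    (∑[ x < 3 + k ] ∑ᶜ (2 + k) (2 + k) (λ es → weight (3 + k) (x ∷ es)))
      ≡⟨ sym (∑ᶜ-suc (2 + k) (2 + k) (weight (3 + k))) ⟩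
    countʷ (3 + k) ∎
    where
    open ≡-Reasoning
    cells : List ℕ → ℕ
    cells = sumFrom 0 λ _ v → v
    rows : List (List ℕ) → ℕ
    rows = sumFrom 0 λ _ → cells
    row : ℕ → ℕ → List ℕ
    row x y = tabulateFrom 0 (1 + k) (entry k x y)
    plane : ℕ → List (List ℕ)
    plane x = tabulateFrom 0 (2 + k) (row x)

  count-table : ∀ k → countʷ (3 + k) ≡ total₃ (table b k)
  count-table k = trans (sym (total-entries k)) (cong total₃ (sym (table-entries k)))

module _ {b b′ : ℕ → ℕ → ℕ → ℕ → ℕ → Bool}
         (eq : ∀ k {x y z w} → x < 4 + k → y < 3 + k → z < 2 + k → w < 1 + k → b (4 + k) x y z w ≡ b′ (4 + k) x y z w) where

  private
    module X = Windows b
    module Y = Windows b′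

  weight-cong : ∀ {m es} → Code m m es → X.weight m es ≡ Y.weight m es
  weight-cong []                = refl
  weight-cong c@(_ ∷ cs) = cong₂ (λ t n → 𝟙 (not t) * n) (marked-cong c) (weight-cong cs)
    where
    marked-cong : ∀ {m es} → Code m m es → X.marked m es ≡ Y.marked m es
    marked-cong []                       = refl
    marked-cong (_ ∷ [])                 = refl
    marked-cong (_ ∷ _ ∷ [])             = refl
    marked-cong (_ ∷ _ ∷ _ ∷ [])         = refl
    marked-cong (_∷_ {M = suc (suc (suc k))} l₁ (l₂ ∷ l₃ ∷ l₄ ∷ _)) = eq k l₁ l₂ l₃ l₄

  count-cong : ∀ n → X.count n ≡ Y.count n
  count-cong n = ∑ᶜ-cong n n λ es → weight-cong

-- Inadmissible codes for the shapes 1234 and 2143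

module Chain {u₀ u₁ u₂ u₃ u₄} (l₀ : u₀ < u₁) (l₁ : u₁ < u₂) (l₂ : u₂ < u₃) (l₃ : u₃ < u₄) where

  -- `U i` plays the pattern letter i + 1. The continuation past the fifth value only serves to make
  -- U strictly increasing on all of ℕ.
  U : ℕ → ℕ
  U 0 = u₀
  U 1 = u₁
  U 2 = u₂
  U 3 = u₃
  U (suc (suc (suc (suc n)))) = n + u₄

  U-step : ∀ n → U n < U (suc n)
  U-step 0 = l₀
  U-step 1 = l₁
  U-step 2 = l₂
  U-step 3 = l₃
  U-step (suc (suc (suc (suc n)))) = n<1+n (n + u₄)

  U-mono : ∀ {m n} → m < n → U m < U n
  U-mono {m} {suc n} (s≤s le) with m≤n⇒m<n∨m≡n le
  ... | inj₁ lt   = <-trans (U-mono lt) (U-step n)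
  ... | inj₂ refl = U-step n

  U-agree : ∀ a b → Agree (U a) (U b) (suc a) (suc b)
  U-agree a b with <-cmp a b
  ... | tri< lt _ _  = <ᵇ-agree (T⇒true (<⇒<ᵇ lt)) (<⇒<ᵇ (U-mono lt))
  ... | tri≈ _ refl _ = agreeing (trans (n<ᵇn (U a)) (sym (n<ᵇn a))) (trans (n<ᵇn (U a)) (sym (n<ᵇn a)))
  ... | tri> _ _ gt  = Agree-flip (<ᵇ-agree (T⇒true (<⇒<ᵇ gt)) (<⇒<ᵇ (U-mono gt)))

≡true⇒< : ∀ {m n} → (m <ᵇ n) ≡ true → m < n
≡true⇒< {m} {n} e = <ᵇ⇒< m n (subst T (sym e) tt)

<-pin⇒≤ : ∀ {a x} → (a <ᵇ pin a x) ≡ true → a ≤ x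
<-pin⇒≤ {a} {x} e = ≤-pred (≡true⇒< (trans (sym (<ᵇ-pin a x)) e))

pin-<⇒< : ∀ {a x} → (pin a x <ᵇ a) ≡ true → x < a
pin-<⇒< {a} {x} e = ≡true⇒< (trans (sym (pin-<ᵇ-self a x)) e)

unpin : ∀ {a x y} → (pin a x <ᵇ pin a y) ≡ true → (x <ᵇ y) ≡ true
unpin {a} {x} {y} e = trans (sym (pin-<ᵇ a x y)) e

module _ {x y z w : ℕ} where

  Windowᶜ : (ℕ → ℕ → ℕ → ℕ → Set) → Set
  Windowᶜ P = P x (pin x y) (pin x (pin y z)) (pin x (pin y (pin z w)))

  -- When the entries rise weakly, every `pin` acts as a successor, and the window letters are x, 1
  -- + y, 2 + z, 3 + w.
  pins-rising : x ≤ y → y ≤ z → z ≤ w → ∀ {ℓ} (P : ℕ → ℕ → ℕ → Set ℓ) →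
                P (pin x y) (pin x (pin y z)) (pin x (pin y (pin z w))) ≡ P (1 + y) (2 + z) (3 + w)
  pins-rising xy yz zw P
    rewrite pin-≥ zw | pin-≥ yz | pin-≥ (m≤n⇒m≤1+n (≤-trans yz zw)) | pin-≥ xy
          | pin-≥ (m≤n⇒m≤1+n (≤-trans xy yz)) | pin-≥ (m≤n⇒m≤1+n (m≤n⇒m≤1+n (≤-trans xy (≤-trans yz zw)))) = refl

  rising⇒≤ : ∀ {a b c d} → Windowᶜ (λ x′ y′ z′ w′ → Agree x′ y′ a b × Agree y′ z′ b c × Agree z′ w′ c d) →
             (a <ᵇ b) ≡ true → (b <ᵇ c) ≡ true → (c <ᵇ d) ≡ true → x ≤ y × y ≤ z × z ≤ w
  rising⇒≤ (f , g , h) e₁ e₂ e₃ =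
    <-pin⇒≤ (trans (<-agree f) e₁) ,
    <-pin⇒≤ (unpin {x} (trans (<-agree g) e₂)) ,
    <-pin⇒≤ (unpin {y} (unpin {x} (trans (<-agree h) e₃)))

  pins-pairs : y < x → x ≤ suc w → w < z → ∀ {ℓ} (P : ℕ → ℕ → ℕ → Set ℓ) →
               P (pin x y) (pin x (pin y z)) (pin x (pin y (pin z w))) ≡ P y (2 + z) (2 + w)
  pins-pairs yx xw wz P
    rewrite pin-< wz | pin-≥ {y} {z} (≤-trans (≤-pred (<-≤-trans yx xw)) (<⇒≤ wz)) | pin-≥ {y} {w} (≤-pred (<-≤-trans yx xw))
          | pin-< yx | pin-≥ {x} {suc z} (≤-trans xw (s≤s (<⇒≤ wz))) | pin-≥ xw = refl

  pairs⇒≤ : ∀ {a b c d} → Windowᶜ (λ x′ y′ z′ w′ → Agree x′ y′ a b × Agree x′ w′ a d × Agree z′ w′ c d) →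
            (b <ᵇ a) ≡ true → (a <ᵇ d) ≡ true → (d <ᵇ c) ≡ true → y < x × x ≤ suc w × w < z
  pairs⇒≤ (f , g , h) e₁ e₂ e₃ = yx , xw , wz
    where
    yx = pin-<⇒< (trans (>-agree f) e₁)
    wz = pin-<⇒< (unpin {y} (unpin {x} (trans (>-agree h) e₃)))
    le : x ≤ pin y w
    le = subst (λ t → x ≤ pin y t) (pin-< wz) (<-pin⇒≤ {x} (trans (<-agree g) e₂))
    xw : x ≤ suc w
    xw with y ≤? w
    ... | yes yw = subst (x ≤_) (pin-≥ yw) le
    ... | no yw  = ≤-trans (subst (x ≤_) (pin-< (≰⇒> yw)) le) (n≤1+n w)

<ᵇ-true : ∀ {m n} → T (m <ᵇ n) → m < n
<ᵇ-true {m} {n} = <ᵇ⇒< m n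

rising⁻ : ∀ p m {x y z w} → T (rising p m x y z w) → x < bound (s₁ p) y × y < bound (s₂ p) z × z < bound (s₃ p) w
rising⁻ p m {x} {y} {z} {w} t = <ᵇ-true (T-∧ˡ t) , <ᵇ-true (T-∧ˡ (T-∧ʳ {step (s₁ p) x y} t)) ,
  <ᵇ-true (T-∧ʳ {step (s₂ p) y z} (T-∧ʳ {step (s₁ p) x y} t))

rising⁺ : ∀ p m {x y z w} → x < bound (s₁ p) y → y < bound (s₂ p) z → z < bound (s₃ p) w → T (rising p m x y z w)
rising⁺ p m {x} {y} {z} {w} a b c = T-∧⁺ {step (s₁ p) x y} (<⇒<ᵇ a) (T-∧⁺ {step (s₂ p) y z} (<⇒<ᵇ b) (<⇒<ᵇ c))

placed : Place → Vec ℕ 5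
placed front  = 1 ∷ 3 ∷ 4 ∷ 5 ∷ 2 ∷ []
placed middle = 1 ∷ 2 ∷ 4 ∷ 5 ∷ 3 ∷ []
placed back   = 1 ∷ 2 ∷ 3 ∷ 5 ∷ 4 ∷ []

-- A value fits between two neighbouring letters of the window exactly if the code step there is
-- strict. The witness is the least candidate, one above the lower letter; the range of w keeps it
-- below the length.
bad-rising : ∀ p k {x y z w} → w < 1 + k → badᶜ (placed p) (4 + k) x y z w ≡ rising p (4 + k) x y z w
bad-rising p k {x} {y} {z} {w} lw = T-≡ (to p) (from p)
  where
  Goal : Place → Set
  Goal p = T (badᶜ (placed p) (4 + k) x y z w)

  restate : ∀ p → x ≤ y → y ≤ z → z ≤ w → Goal p ≡ T (bad (placed p) (4 + k) x (1 + y) (2 + z) (3 + w))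
  restate p xy yz zw = pins-rising xy yz zw (λ y z w → T (bad (placed p) (4 + k) x y z w))

  between : ∀ {a b v c} → Agree a v b c → (b <ᵇ c) ≡ true → a < v
  between f e = ≡true⇒< (trans (<-agree f) e)

  between′ : ∀ {a b v c} → Agree a v b c → (c <ᵇ b) ≡ true → v < a
  between′ f e = ≡true⇒< (trans (>-agree f) e)

  to : ∀ p → Goal p → T (rising p (4 + k) x y z w)
  to front t with f₁ , _ , _ , f₄ , _ , f₆ ← proj₁ (bad⁻ (placed front) (4 + k) x (pin x y) (pin x (pin y z)) (pin x (pin y (pin z w))) t)
    with xy , yz , zw ← rising⇒≤ {x} {y} {z} {w} (f₁ , f₄ , f₆) refl refl refl
    with _ , v , _ , (g₁ , g₂ , _ , _) ← bad⁻ (placed front) (4 + k) x (1 + y) (2 + z) (3 + w) (subst id (restate front xy yz zw) t) =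
    rising⁺ front (4 + k) (≤-trans (between g₁ refl) (≤-pred (between′ g₂ refl))) (s≤s yz) (s≤s zw)
  to middle t with f₁ , _ , _ , f₄ , _ , f₆ ← proj₁ (bad⁻ (placed middle) (4 + k) x (pin x y) (pin x (pin y z)) (pin x (pin y (pin z w))) t)
    with xy , yz , zw ← rising⇒≤ {x} {y} {z} {w} (f₁ , f₄ , f₆) refl refl refl
    with _ , v , _ , (_ , g₂ , g₃ , _) ← bad⁻ (placed middle) (4 + k) x (1 + y) (2 + z) (3 + w) (subst id (restate middle xy yz zw) t) =
    rising⁺ middle (4 + k) (s≤s xy) (≤-pred (≤-trans (between g₂ refl) (≤-pred (between′ g₃ refl)))) (s≤s zw)
  to back t with f₁ , _ , _ , f₄ , _ , f₆ ← proj₁ (bad⁻ (placed back) (4 + k) x (pin x y) (pin x (pin y z)) (pin x (pin y (pin z w))) t)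
    with xy , yz , zw ← rising⇒≤ {x} {y} {z} {w} (f₁ , f₄ , f₆) refl refl refl
    with _ , v , _ , (_ , _ , g₃ , g₄) ← bad⁻ (placed back) (4 + k) x (1 + y) (2 + z) (3 + w) (subst id (restate back xy yz zw) t) =
    rising⁺ back (4 + k) (s≤s xy) (s≤s yz) (≤-pred (≤-pred (≤-trans (between g₃ refl) (≤-pred (between′ g₄ refl)))))

  from : ∀ p → T (rising p (4 + k) x y z w) → Goal p
  from front t with a , b , c ← rising⁻ front (4 + k) {x} {y} {z} {w} t =
    subst id (sym (restate front (<⇒≤ a) (≤-pred b) (≤-pred c)))
      (bad⁺ (placed front) (4 + k) x (1 + y) (2 + z) (3 + w) (suc x)
        (A 0 2 , A 0 3 , A 0 4 , A 2 3 , A 2 4 , A 3 4)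
        (s≤s (≤-trans a (≤-trans (≤-pred b) (≤-trans (≤-pred c) (≤-trans (≤-pred lw) (m≤n+m k 3))))))
        (A 0 1 , A 2 1 , A 3 1 , A 4 1))
    where open Chain {x} {suc x} {1 + y} {2 + z} {3 + w} (n<1+n x) (s≤s a) (s≤s b) (s≤s (s≤s c)) renaming (U-agree to A)
  from middle t with a , b , c ← rising⁻ middle (4 + k) {x} {y} {z} {w} t =
    subst id (sym (restate middle (≤-pred a) (<⇒≤ b) (≤-pred c)))
      (bad⁺ (placed middle) (4 + k) x (1 + y) (2 + z) (3 + w) (2 + y)
        (A 0 1 , A 0 3 , A 0 4 , A 1 3 , A 1 4 , A 3 4)
        (s≤s (s≤s (≤-trans b (≤-trans (≤-pred c) (≤-trans (≤-pred lw) (m≤n+m k 2))))))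
        (A 0 2 , A 1 2 , A 3 2 , A 4 2))
    where open Chain {x} {1 + y} {2 + y} {2 + z} {3 + w} a (n<1+n (1 + y)) (s≤s (s≤s b)) (s≤s (s≤s c)) renaming (U-agree to A)
  from back t with a , b , c ← rising⁻ back (4 + k) {x} {y} {z} {w} t =
    subst id (sym (restate back (≤-pred a) (≤-pred b) (<⇒≤ c)))
      (bad⁺ (placed back) (4 + k) x (1 + y) (2 + z) (3 + w) (3 + z)
        (A 0 1 , A 0 2 , A 0 4 , A 1 2 , A 1 4 , A 2 4)
        (s≤s (s≤s (s≤s (≤-trans c (≤-trans (≤-pred lw) (m≤n+m k 1))))))
        (A 0 3 , A 1 3 , A 2 3 , A 4 3))
    where open Chain {x} {1 + y} {2 + z} {3 + z} {3 + w} a (s≤s b) (n<1+n (2 + z)) (s≤s (s≤s (s≤s c))) renaming (U-agree to A)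

placed-count : ∀ p q n → count (placed p) n ≡ count (placed q) n
placed-count p q n = trans (count-cong (λ k _ _ _ → bad-rising p k) n)
  (trans (rising-count p q n) (sym (count-cong (λ k _ _ _ → bad-rising q k) n)))

upper lower : Vec ℕ 5
upper = 2 ∷ 1 ∷ 5 ∷ 3 ∷ 4 ∷ []
lower = 3 ∷ 1 ∷ 5 ∷ 4 ∷ 2 ∷ []

module _ (k : ℕ) {x y z w : ℕ} (lx : x < 4 + k) (lz : z < 2 + k) (lw : w < 1 + k) where

  private
    Goal : Vec ℕ 5 → Set
    Goal p = T (badᶜ p (4 + k) x y z w)

    restate : ∀ p → y < x → x ≤ suc w → w < z → Goal p ≡ T (bad p (4 + k) x y (2 + z) (2 + w))
    restate p yx xw wz = pins-pairs yx xw wz (λ y z w → T (bad p (4 + k) x y z w))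

  -- The letters are x, y, 2 + z, 2 + w. A value between the last two exists iff `suc w` < z, the
  -- least being 3 + w; for `lower` the gap is that between y and x, and the least value is `suc y`.
  bad-upper : badᶜ upper (4 + k) x y z w ≡ Upper.pairs (4 + k) x y z w
  bad-upper = T-≡ to from
    where
    to : Goal upper → T (Upper.pairs (4 + k) x y z w)
    to t with f₁ , _ , f₃ , _ , _ , f₆ ← proj₁ (bad⁻ upper (4 + k) x (pin x y) (pin x (pin y z)) (pin x (pin y (pin z w))) t)
      with yx , xw , wz ← pairs⇒≤ {x} {y} {z} {w} (f₁ , f₃ , f₆) refl refl refl
      with _ , v , _ , (_ , _ , g₃ , g₄) ← bad⁻ upper (4 + k) x y (2 + z) (2 + w) (subst id (restate upper yx xw wz) t) =
      T-∧⁺ {y <ᵇ x} (<⇒<ᵇ yx) (T-∧⁺ {x <ᵇ 2 + w} (<⇒<ᵇ (s≤s xw))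
        (<⇒<ᵇ {suc w} {z} (≤-pred (≤-pred (≤-<-trans (≡true⇒< {2 + w} {v} (trans (<-agree g₄) refl)) (≡true⇒< {v} {2 + z} (trans (>-agree g₃) refl)))))))

    from : T (Upper.pairs (4 + k) x y z w) → Goal upper
    from t = subst id (sym (restate upper yx (≤-pred xw) (<-trans (n<1+n w) wz)))
        (bad⁺ upper (4 + k) x y (2 + z) (2 + w) (3 + w)
          (A 1 0 , A 1 4 , A 1 2 , A 0 4 , A 0 2 , A 4 2)
          (s≤s (s≤s (s≤s lw)))
          (A 1 3 , A 0 3 , A 4 3 , A 2 3))
      where
      yx = <ᵇ⇒< y x (T-∧ˡ t)
      xw = <ᵇ⇒< x (2 + w) (T-∧ˡ (T-∧ʳ {y <ᵇ x} t))
      wz = <ᵇ⇒< (suc w) z (T-∧ʳ {x <ᵇ 2 + w} (T-∧ʳ {y <ᵇ x} t))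
      open Chain {y} {x} {2 + w} {3 + w} {2 + z} yx xw (n<1+n (2 + w)) (s≤s (s≤s wz)) renaming (U-agree to A)

  bad-lower : badᶜ lower (4 + k) x y z w ≡ Lower.pairs (4 + k) x y z w
  bad-lower = T-≡ to from
    where
    to : Goal lower → T (Lower.pairs (4 + k) x y z w)
    to t with f₁ , _ , f₃ , _ , _ , f₆ ← proj₁ (bad⁻ lower (4 + k) x (pin x y) (pin x (pin y z)) (pin x (pin y (pin z w))) t)
      with yx , xw , wz ← pairs⇒≤ {x} {y} {z} {w} (f₁ , f₃ , f₆) refl refl refl
      with _ , v , _ , (g₁ , g₂ , _ , _) ← bad⁻ lower (4 + k) x y (2 + z) (2 + w) (subst id (restate lower yx xw wz) t) =
      T-∧⁺ {y <ᵇ pred x} (<⇒<ᵇ {y} {pred x} (pred-mono-≤ (≤-<-trans (≡true⇒< {y} {v} (trans (<-agree g₂) refl)) (≡true⇒< {v} {x} (trans (>-agree g₁) refl)))))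
        (T-∧⁺ {x <ᵇ 2 + w} (<⇒<ᵇ (s≤s xw)) (<⇒<ᵇ wz))

    from : T (Lower.pairs (4 + k) x y z w) → Goal lower
    from t = subst id (sym (restate lower (<-trans (n<1+n y) yx) (≤-pred xw) wz))
        (bad⁺ lower (4 + k) x y (2 + z) (2 + w) (suc y)
          (A 2 0 , A 2 4 , A 2 3 , A 0 4 , A 0 3 , A 4 3)
          (<-trans yx lx)
          (A 2 1 , A 0 1 , A 4 1 , A 3 1))
      where
      unpred : ∀ {x} → y < pred x → suc y < x
      unpred {suc x} lt = s≤s lt
      yx = unpred (<ᵇ⇒< y (pred x) (T-∧ˡ t))
      xw = <ᵇ⇒< x (2 + w) (T-∧ˡ (T-∧ʳ {y <ᵇ pred x} t))
      wz = <ᵇ⇒< w z (T-∧ʳ {x <ᵇ 2 + w} (T-∧ʳ {y <ᵇ pred x} t))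
      open Chain {y} {suc y} {x} {2 + w} {2 + z} (n<1+n y) yx xw (s≤s (s≤s wz)) renaming (U-agree to A)

upper-lower-count : ∀ n → count upper n ≡ count lower n
upper-lower-count n = trans (count-cong (λ k lx _ lz lw → bad-upper k lx lz lw) n)
  (trans (pairs-count n) (sym (count-cong (λ k lx _ lz lw → bad-lower k lx lz lw) n)))

-- Avoidance in words

hit : Vec ℕ 5 → List ℕ → Bool
hit p (x ∷ y ∷ z ∷ w ∷ vs) = fits₄ p x y z w ∧ any (fits₅ p x y z w) vs
hit p _                    = false

avoid : Vec ℕ 5 → List ℕ → Bool
avoid p []       = true
avoid p (x ∷ xs) = not (hit p (x ∷ xs)) ∧ avoid p xs

-- The fifth letter is ignored, so `avoid₄` is consecutive avoidance of σ₁σ₂σ₃σ₄.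
hit₄ : Vec ℕ 5 → List ℕ → Bool
hit₄ p (x ∷ y ∷ z ∷ w ∷ _) = fits₄ p x y z w
hit₄ p _                   = false

avoid₄ : Vec ℕ 5 → List ℕ → Bool
avoid₄ p []       = true
avoid₄ p (x ∷ xs) = not (hit₄ p (x ∷ xs)) ∧ avoid₄ p xs

any⁺ : ∀ {f : ℕ → Bool} {vs v} → v ∈ vs → T (f v) → T (any f vs)
any⁺ (here refl) t = T-∨ˡ t
any⁺ {f} {u ∷ _} (there i) t = T-∨ʳ {f u} (any⁺ i t)

any⁻ : ∀ (f : ℕ → Bool) vs → T (any f vs) → ∃ λ v → v ∈ vs × T (f v)
any⁻ f (u ∷ vs) t with T-∨⁻ {f u} t
... | inj₁ t₀ = u , here refl , t₀
... | inj₂ t₁ with v , i , tv ← any⁻ f vs t₁ = v , there i , tv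

-- A map of the letters of words that acts on comparisons like the passage from the
-- pattern abcd-e to a′b′c′d′-e′.
module Transport₄ (f : ℕ → ℕ) (Ok : ℕ → Set) {a b c d e a′ b′ c′ d′ e′ : ℕ}
  (same : ∀ {x y} → Ok x → Ok y →
     agree (f x) (f y) a′ b′ ≡ agree x y a b × agree (f x) (f y) a′ c′ ≡ agree x y a c ×
     agree (f x) (f y) a′ d′ ≡ agree x y a d × agree (f x) (f y) b′ c′ ≡ agree x y b c ×
     agree (f x) (f y) b′ d′ ≡ agree x y b d × agree (f x) (f y) c′ d′ ≡ agree x y c d)
  where

  private
    p q : Vec ℕ 5
    p = a ∷ b ∷ c ∷ d ∷ e ∷ []
    q = a′ ∷ b′ ∷ c′ ∷ d′ ∷ e′ ∷ []

  fits₄-map : ∀ {x y z w} → Ok x → Ok y → Ok z → Ok w → fits₄ q (f x) (f y) (f z) (f w) ≡ fits₄ p x y z w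
  fits₄-map ox oy oz ow = cong₂ _∧_ (proj₁ (same ox oy)) (cong₂ _∧_ (proj₁ (proj₂ (same ox oz)))
    (cong₂ _∧_ (proj₁ (proj₂ (proj₂ (same ox ow)))) (cong₂ _∧_ (proj₁ (proj₂ (proj₂ (proj₂ (same oy oz)))))
    (cong₂ _∧_ (proj₁ (proj₂ (proj₂ (proj₂ (proj₂ (same oy ow)))))) (proj₂ (proj₂ (proj₂ (proj₂ (proj₂ (same oz ow))))))))))

  hit₄-map : ∀ {ws} → All Ok ws → hit₄ q (map f ws) ≡ hit₄ p ws
  hit₄-map []                      = refl
  hit₄-map (_ ∷ [])                = refl
  hit₄-map (_ ∷ _ ∷ [])            = refl
  hit₄-map (_ ∷ _ ∷ _ ∷ [])        = refl
  hit₄-map (ox ∷ oy ∷ oz ∷ ow ∷ _) = fits₄-map ox oy oz ow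

  avoid₄-map : ∀ {ws} → All Ok ws → avoid₄ q (map f ws) ≡ avoid₄ p ws
  avoid₄-map []           = refl
  avoid₄-map os@(_ ∷ os′) = cong₂ (λ h t → not h ∧ t) (hit₄-map os) (avoid₄-map os′)

  module Transport₅
    (same₅ : ∀ {x y} → Ok x → Ok y →
       agree (f x) (f y) a′ e′ ≡ agree x y a e × agree (f x) (f y) b′ e′ ≡ agree x y b e ×
       agree (f x) (f y) c′ e′ ≡ agree x y c e × agree (f x) (f y) d′ e′ ≡ agree x y d e)
    where

    fits₅-map : ∀ {x y z w v} → Ok x → Ok y → Ok z → Ok w → Ok v → fits₅ q (f x) (f y) (f z) (f w) (f v) ≡ fits₅ p x y z w v
    fits₅-map ox oy oz ow ov = cong₂ _∧_ (proj₁ (same₅ ox ov)) (cong₂ _∧_ (proj₁ (proj₂ (same₅ oy ov)))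
      (cong₂ _∧_ (proj₁ (proj₂ (proj₂ (same₅ oz ov)))) (proj₂ (proj₂ (proj₂ (same₅ ow ov))))))

    any-map : ∀ {x y z w vs} → Ok x → Ok y → Ok z → Ok w → All Ok vs →
              any (fits₅ q (f x) (f y) (f z) (f w)) (map f vs) ≡ any (fits₅ p x y z w) vs
    any-map ox oy oz ow []         = refl
    any-map ox oy oz ow (ov ∷ ovs) = cong₂ _∨_ (fits₅-map ox oy oz ow ov) (any-map ox oy oz ow ovs)

    hit-map : ∀ {ws} → All Ok ws → hit q (map f ws) ≡ hit p ws
    hit-map []                         = refl
    hit-map (_ ∷ [])                   = refl
    hit-map (_ ∷ _ ∷ [])               = refl
    hit-map (_ ∷ _ ∷ _ ∷ [])           = refl
    hit-map (ox ∷ oy ∷ oz ∷ ow ∷ ovs)  = cong₂ _∧_ (fits₄-map ox oy oz ow) (any-map ox oy oz ow ovs)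

    avoid-map : ∀ {ws} → All Ok ws → avoid q (map f ws) ≡ avoid p ws
    avoid-map []           = refl
    avoid-map os@(_ ∷ os′) = cong₂ (λ h t → not h ∧ t) (hit-map os) (avoid-map os′)

agree-pin : ∀ i x y a b → agree (pin i x) (pin i y) a b ≡ agree x y a b
agree-pin i x y a b = cong₂ (λ s t → (s ⇔ᵇ (a <ᵇ b)) ∧ (t ⇔ᵇ (b <ᵇ a))) (pin-<ᵇ i x y) (pin-<ᵇ i y x)

avoid-pin : ∀ p i ws → avoid p (map (pin i) ws) ≡ avoid p ws
avoid-pin (a ∷ b ∷ c ∷ d ∷ e ∷ []) i ws = avoid-map (everything ws)
  where
  everything : ∀ ws → All (const (0 ≤ 0)) ws
  everything []       = []
  everything (_ ∷ ws) = z≤n ∷ everything ws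
  same₄ : ∀ {x y} → 0 ≤ 0 → 0 ≤ 0 →
    agree (pin i x) (pin i y) a b ≡ agree x y a b × agree (pin i x) (pin i y) a c ≡ agree x y a c ×
    agree (pin i x) (pin i y) a d ≡ agree x y a d × agree (pin i x) (pin i y) b c ≡ agree x y b c ×
    agree (pin i x) (pin i y) b d ≡ agree x y b d × agree (pin i x) (pin i y) c d ≡ agree x y c d
  same₄ {x} {y} _ _ = let s = agree-pin i x y in s a b , s a c , s a d , s b c , s b d , s c d
  same₅ : ∀ {x y} → 0 ≤ 0 → 0 ≤ 0 →
    agree (pin i x) (pin i y) a e ≡ agree x y a e × agree (pin i x) (pin i y) b e ≡ agree x y b e ×
    agree (pin i x) (pin i y) c e ≡ agree x y c e × agree (pin i x) (pin i y) d e ≡ agree x y d e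
  same₅ {x} {y} _ _ = let s = agree-pin i x y in s a e , s b e , s c e , s d e
  open Transport₄ (pin i) (const (0 ≤ 0)) {a} {b} {c} {d} {e} {a} {b} {c} {d} {e} same₄
  open Transport₅ same₅

-- Complements of words and patterns

<ᵇ-flip : ∀ {M x y} → x < M → y < M → ((M ∸ suc x) <ᵇ (M ∸ suc y)) ≡ (y <ᵇ x)
<ᵇ-flip {M} {x} {y} lx ly = T-≡
  (λ t → <⇒<ᵇ (≰⇒> λ x≤y → <⇒≱ (<ᵇ⇒< (M ∸ suc x) (M ∸ suc y) t) (∸-monoʳ-≤ M (s≤s x≤y))))
  (λ t → <⇒<ᵇ (∸-monoʳ-< (s≤s (<ᵇ⇒< y x t)) lx))

agree-flip : ∀ {M N x y a b} → x < M → y < M → a < N → b < N →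
             agree (M ∸ suc x) (M ∸ suc y) (N ∸ suc a) (N ∸ suc b) ≡ agree x y a b
agree-flip {x = x} {y} {a} {b} lx ly la lb = trans
  (cong₂ _∧_ (cong₂ _⇔ᵇ_ (<ᵇ-flip lx ly) (<ᵇ-flip la lb)) (cong₂ _⇔ᵇ_ (<ᵇ-flip ly lx) (<ᵇ-flip lb la)))
  (∧-comm ((y <ᵇ x) ⇔ᵇ (b <ᵇ a)) _)

-- This is `complement`, written in the form M ∸ `suc` x in which the values below M are reversed.
mirror : Vec ℕ 5 → Vec ℕ 5
mirror = Vec.map (λ a → 7 ∸ suc a)

Bounded : Vec ℕ 5 → Set
Bounded (a ∷ b ∷ c ∷ d ∷ e ∷ []) = a < 7 × b < 7 × c < 7 × d < 7 × e < 7

-- If σ₅ = 5, this complements the first four letters within 1, ..., 4 and leaves the fifth in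
-- place.
mirror₄ : Vec ℕ 5 → Vec ℕ 5
mirror₄ (a ∷ b ∷ c ∷ d ∷ e ∷ []) = (6 ∸ suc a) ∷ (6 ∸ suc b) ∷ (6 ∸ suc c) ∷ (6 ∸ suc d) ∷ e ∷ []

Bounded₄ : Vec ℕ 5 → Set
Bounded₄ (a ∷ b ∷ c ∷ d ∷ _ ∷ []) = a < 6 × b < 6 × c < 6 × d < 6

module Mirror (M : ℕ) where

  private
    flip : ℕ → ℕ
    flip x = M ∸ suc x

  avoid-mirror : ∀ p → Bounded p → ∀ {ws} → All (_< M) ws → avoid (mirror p) (map flip ws) ≡ avoid p ws
  avoid-mirror (a ∷ b ∷ c ∷ d ∷ e ∷ []) (la , lb , lc , ld , le) = avoid-map
    where
    open Transport₄ flip (_< M) {a} {b} {c} {d} {e} {6 ∸ a} {6 ∸ b} {6 ∸ c} {6 ∸ d} {6 ∸ e} (λ lx ly →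
      agree-flip lx ly la lb , agree-flip lx ly la lc , agree-flip lx ly la ld ,
      agree-flip lx ly lb lc , agree-flip lx ly lb ld , agree-flip lx ly lc ld)
    open Transport₅ (λ lx ly →
      agree-flip lx ly la le , agree-flip lx ly lb le , agree-flip lx ly lc le , agree-flip lx ly ld le)

  avoid₄-mirror : ∀ p → Bounded₄ p → ∀ {ws} → All (_< M) ws → avoid₄ (mirror₄ p) (map flip ws) ≡ avoid₄ p ws
  avoid₄-mirror (a ∷ b ∷ c ∷ d ∷ e ∷ []) (la , lb , lc , ld) =
    Transport₄.avoid₄-map flip (_< M) {a} {b} {c} {d} {e} {5 ∸ a} {5 ∸ b} {5 ∸ c} {5 ∸ d} {e} (λ lx ly →
      agree-flip lx ly la lb , agree-flip lx ly la lc , agree-flip lx ly la ld ,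
      agree-flip lx ly lb lc , agree-flip lx ly lb ld , agree-flip lx ly lc ld)

  fresh-mirror : ∀ {x ws} → x < M → All (_< M) ws → fresh (M ∸ suc x) (map (λ x → M ∸ suc x) ws) ≡ fresh x ws
  fresh-mirror lx []                = refl
  fresh-mirror {x} lx (_∷_ {y} ly ls) = cong₂ (λ h t → not h ∧ t)
    (T-≡ (λ t → ≡⇒≡ᵇ x y (suc-injective (∸-cancelˡ-≡ lx ly (≡ᵇ⇒≡ (M ∸ suc x) (M ∸ suc y) t))))
         (λ t → ≡⇒≡ᵇ (M ∸ suc x) (M ∸ suc y) (cong (λ x → M ∸ suc x) (≡ᵇ⇒≡ x y t))))
    (fresh-mirror lx ls)

  uniq-mirror : ∀ {ws} → All (_< M) ws → uniq (map (λ x → M ∸ suc x) ws) ≡ uniq ws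
  uniq-mirror []        = refl
  uniq-mirror (l ∷ ls) = cong₂ _∧_ (fresh-mirror l ls) (uniq-mirror ls)

opaque
  unfolding ∑ʷ

  ∑ʷ-cong : ∀ M L {F G} → (∀ ws → All (_< M) ws → F ws ≡ G ws) → ∑ʷ M L F ≡ ∑ʷ M L G
  ∑ʷ-cong M zero    eq = eq [] []
  ∑ʷ-cong M (suc L) eq = ∑-cong M λ x lx → ∑ʷ-cong M L λ ws ls → eq (x ∷ ws) (lx ∷ ls)

  ∑ʷ-mirror : ∀ M L F → ∑ʷ M L (F ∘ map (λ x → M ∸ suc x)) ≡ ∑ʷ M L F
  ∑ʷ-mirror M zero    F = refl
  ∑ʷ-mirror M (suc L) F = trans (∑-cong M λ x _ → ∑ʷ-mirror M L (F ∘ (M ∸ suc x ∷_)))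
                                (∑-reverse M (λ x → ∑ʷ M L (F ∘ (x ∷_))))

  ∑ʷ-snoc : ∀ M L F → ∑ʷ M (suc L) F ≡ (∑[ x < M ] ∑ʷ M L (F ∘ (_∷ʳ x)))
  ∑ʷ-snoc M zero    F = refl
  ∑ʷ-snoc M (suc L) F = trans (∑-cong M λ y _ → ∑ʷ-snoc M L (F ∘ (y ∷_)))
                              (∑-swap M M (λ y x → ∑ʷ M L (λ ws → F (y ∷ ws ∷ʳ x))))

  ∑ʷ-reverse : ∀ M L F → ∑ʷ M L (F ∘ reverse) ≡ ∑ʷ M L F
  ∑ʷ-reverse M zero    F = refl
  ∑ʷ-reverse M (suc L) F = begin
    ∑[ x < M ] ∑ʷ M L (λ ws → F (reverse (x ∷ ws)))
      ≡⟨ ∑-cong M (λ x _ → ∑ʷ-cong M L λ ws _ → cong F (unfold-reverse x ws)) ⟩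
    ∑[ x < M ] ∑ʷ M L (λ ws → F (reverse ws ∷ʳ x))
      ≡⟨ ∑-cong M (λ x _ → ∑ʷ-reverse M L (F ∘ (_∷ʳ x))) ⟩
    ∑[ x < M ] ∑ʷ M L (F ∘ (_∷ʳ x))
      ≡⟨ sym (∑ʷ-snoc M L F) ⟩
    ∑ʷ M (suc L) F ∎
    where open ≡-Reasoning

-- Admissible codes as avoiding permutations

decode-uniq : ∀ es → uniq (decode es) ≡ true
decode-uniq []       = refl
decode-uniq (e ∷ es) = cong₂ _∧_ (fresh-self (decode es)) (trans (uniq-pin e (decode es)) (decode-uniq es))
  where
  fresh-self : ∀ ws → fresh e (map (pin e) ws) ≡ true
  fresh-self []       = refl
  fresh-self (w ∷ ws) = T⇒true (≢⇒fresh (pin≢ e w ∘ sym) (subst T (sym (fresh-self ws)) tt))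

∑ᶜ-words : ∀ M L (f : List ℕ → Bool) → ∑ᶜ M L (𝟙 ∘ f ∘ decode) ≡ ∑ʷ M L (λ ws → 𝟙 (uniq ws) * 𝟙 (f ws))
∑ᶜ-words M L f = trans
  (∑ᶜ-cong M L λ es _ → sym (trans (cong (λ t → 𝟙 t * 𝟙 (f (decode es))) (decode-uniq es)) (+-identityʳ _)))
  (∑ᶜ-decode M L λ ws un → cong (λ t → 𝟙 t * 𝟙 (f ws)) un)

map-bounded : ∀ {M e ws} → All (_< M) ws → All (_< suc M) (map (pin e) ws)
map-bounded         []       = []
map-bounded {e = e} (l ∷ ls) = pin< e l ∷ map-bounded ls

decode-bounded : ∀ {M L es} → Code M L es → All (_< M) (decode es)
decode-bounded []      = []
decode-bounded (l ∷ c) = l ∷ map-bounded (decode-bounded c)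

decode-full : ∀ {m es v} → Code m m es → v < m → v ∈ decode es
decode-full {es = e ∷ es} {v} (l ∷ c) lv with v ≟ e
... | yes refl = here refl
... | no ne with x , lx , refl ← pin-surjective e lv l ne = there (∈-map⁺ (pin e) (decode-full c lx))

Distinct₅ : Vec ℕ 5 → Set
Distinct₅ (a ∷ b ∷ c ∷ d ∷ e ∷ []) = a ≢ e × b ≢ e × c ≢ e × d ≢ e

-- In a full permutation every letter outside the window occurs after it or would
-- have to be compared with itself.
weight-avoid : ∀ p → Distinct₅ p → ∀ {m es} → Code m m es → Pat.weight p m es ≡ 𝟙 (avoid p (decode es))
weight-avoid p dist []                  = refl
weight-avoid p dist {m} {es = e ∷ es} code@(_ ∷ c) = begin
  𝟙 (not (Pat.marked p m (e ∷ es))) * Pat.weight p (pred m) es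
    ≡⟨ cong₂ (λ h n → 𝟙 (not h) * n) (marked-hit code) (trans (weight-avoid p dist c) (cong 𝟙 (sym (avoid-pin p e (decode es))))) ⟩
  𝟙 (not (hit p (decode (e ∷ es)))) * 𝟙 (avoid p (map (pin e) (decode es)))
    ≡⟨ sym (𝟙-∧ (not (hit p (decode (e ∷ es)))) _) ⟩
  𝟙 (avoid p (decode (e ∷ es))) ∎
  where
  open ≡-Reasoning
  marked-hit : ∀ {m es} → Code m m es → Pat.marked p m es ≡ hit p (decode es)
  marked-hit []               = refl
  marked-hit (_ ∷ [])         = refl
  marked-hit (_ ∷ _ ∷ [])     = refl
  marked-hit (_ ∷ _ ∷ _ ∷ []) = refl
  marked-hit {m} {e₁ ∷ e₂ ∷ e₃ ∷ e₄ ∷ es} code@(_ ∷ _ ∷ _ ∷ _ ∷ c) =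
    cong (fits₄ p x y z w ∧_) (T-≡ to from)
    where
    x = e₁
    y = pin e₁ e₂
    z = pin e₁ (pin e₂ e₃)
    w = pin e₁ (pin e₂ (pin e₃ e₄))
    rest = map (pin e₁) (map (pin e₂) (map (pin e₃) (map (pin e₄) (decode es))))
    word : decode (e₁ ∷ e₂ ∷ e₃ ∷ e₄ ∷ es) ≡ x ∷ y ∷ z ∷ w ∷ rest
    word = refl
    f = fits₅ p x y z w

    differ : ∀ p → Distinct₅ p → ∀ {v} → Fits₅ p x y z w v → x ≢ v × y ≢ v × z ≢ v × w ≢ v
    differ (_ ∷ _ ∷ _ ∷ _ ∷ _ ∷ []) (n₁ , n₂ , n₃ , n₄) (g₁ , g₂ , g₃ , g₄) =
      n₁ ∘ Agree-≡ g₁ , n₂ ∘ Agree-≡ g₂ , n₃ ∘ Agree-≡ g₃ , n₄ ∘ Agree-≡ g₄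

    later : ∀ {v} → T (f v) → v ∈ (x ∷ y ∷ z ∷ w ∷ rest) → v ∈ rest
    later t i with differ p dist (fits₅⁻ p x y z w _ t) | i
    ... | n , _ , _ , _ | here eq                        = ⊥-elim (n (sym eq))
    ... | _ , n , _ , _ | there (here eq)                = ⊥-elim (n (sym eq))
    ... | _ , _ , n , _ | there (there (here eq))        = ⊥-elim (n (sym eq))
    ... | _ , _ , _ , n | there (there (there (here eq))) = ⊥-elim (n (sym eq))
    ... | _ | there (there (there (there i′)))           = i′

    to : T (anyBelow m f) → T (any f rest)
    to t with v , lt , tv ← anyBelow⁻ m f t = any⁺ (later tv (decode-full code lt)) tv

    from : T (any f rest) → T (anyBelow m f)
    from t with v , i , tv ← any⁻ f rest t =
      anyBelow⁺ f (All.lookup (decode-bounded code) (there (there (there (there i))))) tv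

count-decode : ∀ p → Distinct₅ p → ∀ n → count p n ≡ ∑ᶜ n n (𝟙 ∘ avoid p ∘ decode)
count-decode p dist n = ∑ᶜ-cong n n λ es c → weight-avoid p dist c

count-words : ∀ p → Distinct₅ p → ∀ n → count p n ≡ ∑ʷ n n (λ ws → 𝟙 (uniq ws) * 𝟙 (avoid p ws))
count-words p dist n = trans (count-decode p dist n) (∑ᶜ-words n n (avoid p))

count-mirror : ∀ p → Distinct₅ p → Distinct₅ (mirror p) → Bounded p → ∀ n → count (mirror p) n ≡ count p n
count-mirror p dp dm bd n = begin
  count (mirror p) n
    ≡⟨ count-words (mirror p) dm n ⟩
  ∑ʷ n n (λ ws → 𝟙 (uniq ws) * 𝟙 (avoid (mirror p) ws))
    ≡⟨ sym (∑ʷ-mirror n n _) ⟩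
  ∑ʷ n n (λ ws → 𝟙 (uniq (map (λ x → n ∸ suc x) ws)) * 𝟙 (avoid (mirror p) (map (λ x → n ∸ suc x) ws)))
    ≡⟨ ∑ʷ-cong n n (λ ws ls → cong₂ (λ u a → 𝟙 u * 𝟙 a) (Mirror.uniq-mirror n ls) (Mirror.avoid-mirror n p bd ls)) ⟩
  ∑ʷ n n (λ ws → 𝟙 (uniq ws) * 𝟙 (avoid p ws))
    ≡⟨ sym (count-words p dp n) ⟩
  count p n ∎
  where open ≡-Reasoning

-- Splitting a permutation of {0, …, m} at its greatest letter m.
module _ (A : List ℕ → ℕ) (A-pin : ∀ i ws → A (map (pin i) ws) ≡ A ws) where

  Splits : ℕ → (List ℕ → ℕ) → (List ℕ → ℕ) → Set
  Splits m F G = ∀ u v → All (_< m) u → All (_< m) v → F (u ++ m ∷ v) ≡ G u * A v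

  -- i is the position of the maximum. Before it stands a repetition-free word of length i in m
  -- letters; what follows uses the remaining m ∸ i letters, and A sees only their relative order.
  -- The induction moves a first letter other than the maximum into F and G.
  ∑ᶜ-split : ∀ m F G → Splits m F G →
    ∑ᶜ (suc m) (suc m) (F ∘ decode) ≡ (∑[ i < suc m ] ∑ᶜ m i (G ∘ decode) * ∑ᶜ (m ∸ i) (m ∸ i) (A ∘ decode))
  ∑ᶜ-split m F G split = begin
    ∑ᶜ (suc m) (suc m) (F ∘ decode)
      ≡⟨ ∑ᶜ-suc m m _ ⟩
    (∑[ e < suc m ] ∑ᶜ m m (F ∘ (e ∷_) ∘ map (pin e) ∘ decode))
      ≡⟨ ∑-last m _ ⟩
    (∑[ e < m ] ∑ᶜ m m (F ∘ (e ∷_) ∘ map (pin e) ∘ decode)) + ∑ᶜ m m (F ∘ (m ∷_) ∘ map (pin m) ∘ decode)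
      ≡⟨ +-comm (∑[ e < m ] ∑ᶜ m m (F ∘ (e ∷_) ∘ map (pin e) ∘ decode)) _ ⟩
    ∑ᶜ m m (F ∘ (m ∷_) ∘ map (pin m) ∘ decode) + (∑[ e < m ] ∑ᶜ m m (F ∘ (e ∷_) ∘ map (pin e) ∘ decode))
      ≡⟨ cong₂ _+_ first (others m F G split) ⟩
    ∑ᶜ m 0 (G ∘ decode) * ∑ᶜ m m (A ∘ decode) + (∑[ i < m ] ∑ᶜ m (suc i) (G ∘ decode) * ∑ᶜ (m ∸ suc i) (m ∸ suc i) (A ∘ decode))
      ≡⟨ sym (∑-suc m _) ⟩
    (∑[ i < suc m ] ∑ᶜ m i (G ∘ decode) * ∑ᶜ (m ∸ i) (m ∸ i) (A ∘ decode)) ∎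
    where
    open ≡-Reasoning

    small-pin : ∀ {ws} → All (_< m) ws → All (_< m) (map (pin m) ws)
    small-pin []       = []
    small-pin (l ∷ ls) = subst (_< m) (sym (pin-< l)) l ∷ small-pin ls

    first : ∑ᶜ m m (F ∘ (m ∷_) ∘ map (pin m) ∘ decode) ≡ ∑ᶜ m 0 (G ∘ decode) * ∑ᶜ m m (A ∘ decode)
    first = begin
      ∑ᶜ m m (F ∘ (m ∷_) ∘ map (pin m) ∘ decode)
        ≡⟨ ∑ᶜ-cong m m (λ es c → trans (split [] _ [] (small-pin (decode-bounded c))) (cong (G [] *_) (A-pin m (decode es)))) ⟩
      ∑ᶜ m m (λ es → G [] * A (decode es))
        ≡⟨ ∑ᶜ-*ˡ m m (G []) _ ⟩
      G [] * ∑ᶜ m m (A ∘ decode)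
        ≡⟨ cong (_* ∑ᶜ m m (A ∘ decode)) (sym (∑ᶜ-nil m _)) ⟩
      ∑ᶜ m 0 (G ∘ decode) * ∑ᶜ m m (A ∘ decode) ∎

    others : ∀ m F G → Splits m F G →
             (∑[ e < m ] ∑ᶜ m m (F ∘ (e ∷_) ∘ map (pin e) ∘ decode)) ≡
             (∑[ i < m ] ∑ᶜ m (suc i) (G ∘ decode) * ∑ᶜ (m ∸ suc i) (m ∸ suc i) (A ∘ decode))
    others zero    F G split = trans (∑-nil _) (sym (∑-nil _))
    others (suc m) F G split = begin
      (∑[ e < suc m ] ∑ᶜ (suc m) (suc m) (F ∘ (e ∷_) ∘ map (pin e) ∘ decode))
        ≡⟨ (∑-cong (suc m) λ e le → ∑ᶜ-split m (F ∘ (e ∷_) ∘ map (pin e)) (G ∘ (e ∷_) ∘ map (pin e)) (split-after e (≤-pred le))) ⟩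
      (∑[ e < suc m ] ∑[ i < suc m ] ∑ᶜ m i (G ∘ (e ∷_) ∘ map (pin e) ∘ decode) * N i)
        ≡⟨ ∑-swap (suc m) (suc m) _ ⟩
      (∑[ i < suc m ] ∑[ e < suc m ] ∑ᶜ m i (G ∘ (e ∷_) ∘ map (pin e) ∘ decode) * N i)
        ≡⟨ (∑-cong (suc m) λ i _ → trans (∑-*ʳ (suc m) (N i) _) (cong (_* N i) (sym (∑ᶜ-suc m i _)))) ⟩
      (∑[ i < suc m ] ∑ᶜ (suc m) (suc i) (G ∘ decode) * N i) ∎
      where
      N : ℕ → ℕ
      N i = ∑ᶜ (m ∸ i) (m ∸ i) (A ∘ decode)

      -- `pin e` carries the maximum m of the shorter word to the maximum `suc m` of the longer one.
      split-after : ∀ e → e ≤ m → Splits m (F ∘ (e ∷_) ∘ map (pin e)) (G ∘ (e ∷_) ∘ map (pin e))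
      split-after e le u v lu lv = begin
        F (e ∷ map (pin e) (u ++ m ∷ v))
          ≡⟨ cong (λ t → F (e ∷ t)) (trans (map-++ (pin e) u (m ∷ v)) (cong (λ t → map (pin e) u ++ t ∷ map (pin e) v) (pin-≥ le))) ⟩
        F (e ∷ map (pin e) u ++ suc m ∷ map (pin e) v)
          ≡⟨ split (e ∷ map (pin e) u) (map (pin e) v) (s≤s le ∷ map-bounded lu) (map-bounded lv) ⟩
        G (e ∷ map (pin e) u) * A (map (pin e) v)
          ≡⟨ cong (G (e ∷ map (pin e) u) *_) (A-pin e v) ⟩
        G (e ∷ map (pin e) u) * A v ∎

-- Patterns whose fifth letter is the greatest

Top : Vec ℕ 5 → Set
Top (a ∷ b ∷ c ∷ d ∷ e ∷ []) = T (a <ᵇ e) × T (b <ᵇ e) × T (c <ᵇ e) × T (d <ᵇ e)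

none-any : ∀ (f : ℕ → Bool) {P : ℕ → Set} → (∀ {v} → P v → f v ≡ false) → ∀ {vs} → All P vs → any f vs ≡ false
none-any f h []       = refl
none-any f h (p ∷ ps) = cong₂ _∨_ (h p) (none-any f h ps)

not-above : ∀ p → Top p → ∀ {x y z w m v} → x ≡ m ⊎ y ≡ m ⊎ z ≡ m ⊎ w ≡ m → v < m → fits₅ p x y z w v ≡ false
not-above p@(a ∷ b ∷ c ∷ d ∷ e ∷ []) (ta , tb , tc , td) {x} {y} {z} {w} {m} {v} one lt = ¬T⇒false λ t →
  let f₁ , f₂ , f₃ , f₄ = fits₅⁻ p x y z w v t in
  go one f₁ f₂ f₃ f₄
  where
  clash : ∀ {a} → T (a <ᵇ e) → Agree m v a e → ⊥
  clash ta f = <-asym lt (<ᵇ⇒< m v (subst T (sym (<-agree f)) ta))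
  go : x ≡ m ⊎ y ≡ m ⊎ z ≡ m ⊎ w ≡ m → Agree x v a e → Agree y v b e → Agree z v c e → Agree w v d e → ⊥
  go (inj₁ refl)                      f _ _ _ = clash ta f
  go (inj₂ (inj₁ refl))               _ f _ _ = clash tb f
  go (inj₂ (inj₂ (inj₁ refl)))        _ _ f _ = clash tc f
  go (inj₂ (inj₂ (inj₂ refl)))        _ _ _ f = clash td f

all-above : ∀ p → Top p → ∀ {x y z w m} → x < m → y < m → z < m → w < m → T (fits₅ p x y z w m)
all-above p@(a ∷ b ∷ c ∷ d ∷ e ∷ []) (ta , tb , tc , td) {x} {y} {z} {w} {m} lx ly lz lw =
  fits₅⁺ p x y z w m (up ta lx , up tb ly , up tc lz , up td lw)
  where
  up : ∀ {a x} → T (a <ᵇ e) → x < m → Agree x m a e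
  up ta lx = <ᵇ-agree (T⇒true ta) (<⇒<ᵇ lx)

-- A window inside the part before the maximum m is completed by m itself; a window containing m can
-- never be completed.
hit-split : ∀ p → Top p → ∀ {m} x u v → All (_< m) (x ∷ u) → All (_< m) v → hit p (x ∷ u ++ m ∷ v) ≡ hit₄ p (x ∷ u)
hit-split p top {m} x (y ∷ z ∷ w ∷ u) v (lx ∷ ly ∷ lz ∷ lw ∷ _) lv =
  trans (cong (fits₄ p x y z w ∧_) (T⇒true (any⁺ (mid u) (all-above p top lx ly lz lw)))) (∧-identityʳ (fits₄ p x y z w))
  where
  mid : ∀ u → m ∈ (u ++ m ∷ v)
  mid []      = here refl
  mid (_ ∷ u) = there (mid u)
hit-split p top x []           []          _ _ = refl
hit-split p top x []           (_ ∷ [])    _ _ = refl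
hit-split p top x (_ ∷ [])     []          _ _ = refl
hit-split p top {m} x [] (z ∷ w ∷ v) _ (_ ∷ _ ∷ lv) =
  ∧-falseʳ (fits₄ p x m z w) (none-any (fits₅ p x m z w) (not-above p top (inj₂ (inj₁ refl))) lv)
hit-split p top {m} x (y ∷ []) (w ∷ v) _ (_ ∷ lv) =
  ∧-falseʳ (fits₄ p x y m w) (none-any (fits₅ p x y m w) (not-above p top (inj₂ (inj₂ (inj₁ refl)))) lv)
hit-split p top {m} x (y ∷ z ∷ []) v _ lv =
  ∧-falseʳ (fits₄ p x y z m) (none-any (fits₅ p x y z m) (not-above p top (inj₂ (inj₂ (inj₂ refl)))) lv)

hit-max : ∀ p → Top p → ∀ {m} v → All (_< m) v → hit p (m ∷ v) ≡ false
hit-max p top []               _ = refl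
hit-max p top (_ ∷ [])         _ = refl
hit-max p top (_ ∷ _ ∷ [])     _ = refl
hit-max p top {m} (y ∷ z ∷ w ∷ v) (_ ∷ _ ∷ _ ∷ lv) =
  ∧-falseʳ (fits₄ p m y z w) (none-any (fits₅ p m y z w) (not-above p top (inj₁ refl)) lv)

avoid-split : ∀ p → Top p → ∀ {m} u v → All (_< m) u → All (_< m) v → avoid p (u ++ m ∷ v) ≡ avoid₄ p u ∧ avoid p v
avoid-split p top []      v _            lv = cong (λ h → not h ∧ avoid p v) (hit-max p top v lv)
avoid-split p top (x ∷ u) v lu@(_ ∷ lu′) lv = trans
  (cong₂ (λ h t → not h ∧ t) (hit-split p top x u v lu lv) (avoid-split p top u v lu′ lv))
  (sym (∧-assoc (not (hit₄ p (x ∷ u))) (avoid₄ p u) (avoid p v)))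

-- The number of possible parts of length i in front of the maximum.
blocks : Vec ℕ 5 → ℕ → ℕ → ℕ
blocks p m i = ∑ᶜ m i (𝟙 ∘ avoid₄ p ∘ decode)

top-step : ∀ p → Distinct₅ p → Top p → ∀ m → count p (suc m) ≡ (∑[ i < suc m ] blocks p m i * count p (m ∸ i))
top-step p dist top m = begin
  count p (suc m)
    ≡⟨ count-decode p dist (suc m) ⟩
  ∑ᶜ (suc m) (suc m) (𝟙 ∘ avoid p ∘ decode)
    ≡⟨ ∑ᶜ-split (𝟙 ∘ avoid p) (λ i ws → cong 𝟙 (avoid-pin p i ws)) m (𝟙 ∘ avoid p) (𝟙 ∘ avoid₄ p)
         (λ u v lu lv → trans (cong 𝟙 (avoid-split p top u v lu lv)) (𝟙-∧ (avoid₄ p u) (avoid p v))) ⟩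
  (∑[ i < suc m ] blocks p m i * ∑ᶜ (m ∸ i) (m ∸ i) (𝟙 ∘ avoid p ∘ decode))
    ≡⟨ (∑-cong (suc m) λ i _ → cong (blocks p m i *_) (sym (count-decode p dist (m ∸ i)))) ⟩
  (∑[ i < suc m ] blocks p m i * count p (m ∸ i)) ∎
  where open ≡-Reasoning

top-count : ∀ p q → Distinct₅ p → Distinct₅ q → Top p → Top q →
            (∀ m i → blocks p m i ≡ blocks q m i) → ∀ n → count p n ≡ count q n
top-count p q dp dq tp tq eq = <-rec _ go
  where
  open ≡-Reasoning
  go : ∀ n → (∀ {m} → m < n → count p m ≡ count q m) → count p n ≡ count q n
  go zero    rec = trans (∑ᶜ-nil 0 _) (sym (∑ᶜ-nil 0 _))
  go (suc m) rec = begin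
    count p (suc m)                                   ≡⟨ top-step p dp tp m ⟩
    (∑[ i < suc m ] blocks p m i * count p (m ∸ i))   ≡⟨ (∑-cong (suc m) λ i _ → cong₂ _*_ (eq m i) (rec (s≤s (m∸n≤m m i)))) ⟩
    (∑[ i < suc m ] blocks q m i * count q (m ∸ i))   ≡⟨ sym (top-step q dq tq m) ⟩
    count q (suc m)                                   ∎

-- Reversal of words

reversed : Vec ℕ 5 → Vec ℕ 5
reversed (a ∷ b ∷ c ∷ d ∷ e ∷ []) = d ∷ c ∷ b ∷ a ∷ e ∷ []

avoid₄⁻ : ∀ p u {a b c d v} → T (avoid₄ p (u ++ a ∷ b ∷ c ∷ d ∷ v)) → ¬ T (fits₄ p a b c d)
avoid₄⁻ p []      {a} {b} {c} {d} {v} t f = not-T (T-∧ˡ {not (fits₄ p a b c d)} t) f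
avoid₄⁻ p (x ∷ u) {a} {b} {c} {d} {v} t   = avoid₄⁻ p u (T-∧ʳ {not (hit₄ p (x ∷ u ++ a ∷ b ∷ c ∷ d ∷ v))} t)

T-not : ∀ {b} → ¬ T b → T (not b)
T-not {true}  n = n tt
T-not {false} _ = tt

avoid₄⁺ : ∀ p ws → (∀ u a b c d v → ws ≡ u ++ a ∷ b ∷ c ∷ d ∷ v → ¬ T (fits₄ p a b c d)) → T (avoid₄ p ws)
avoid₄⁺ p []       h = tt
avoid₄⁺ p (x ∷ xs) h = T-∧⁺ (T-not (head-ok xs h)) (avoid₄⁺ p xs λ u a b c d v eq → h (x ∷ u) a b c d v (cong (x ∷_) eq))
  where
  head-ok : ∀ xs → (∀ u a b c d v → x ∷ xs ≡ u ++ a ∷ b ∷ c ∷ d ∷ v → ¬ T (fits₄ p a b c d)) → ¬ T (hit₄ p (x ∷ xs))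
  head-ok (y ∷ z ∷ w ∷ v) h = h [] x y z w v refl
  head-ok []              h ()
  head-ok (_ ∷ [])        h ()
  head-ok (_ ∷ _ ∷ [])    h ()

reverse-window : ∀ (u v : List ℕ) a b c d →
                 reverse (u ++ a ∷ b ∷ c ∷ d ∷ v) ≡ reverse v ++ d ∷ c ∷ b ∷ a ∷ reverse u
reverse-window u v a b c d = begin
  reverse (u ++ a ∷ b ∷ c ∷ d ∷ v)                  ≡⟨ reverse-++ u (a ∷ b ∷ c ∷ d ∷ v) ⟩
  reverse (a ∷ b ∷ c ∷ d ∷ v) ++ reverse u          ≡⟨ cong (_++ reverse u) (reverse-++ (a ∷ b ∷ c ∷ d ∷ []) v) ⟩
  (reverse v ++ d ∷ c ∷ b ∷ a ∷ []) ++ reverse u    ≡⟨ ++-assoc (reverse v) (d ∷ c ∷ b ∷ a ∷ []) (reverse u) ⟩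
  reverse v ++ d ∷ c ∷ b ∷ a ∷ reverse u            ∎
  where open ≡-Reasoning

avoid₄-unreverse : ∀ p ws → T (avoid₄ p (reverse ws)) → T (avoid₄ (reversed p) ws)
avoid₄-unreverse p ws t = avoid₄⁺ (reversed p) ws λ { u a b c d v refl f →
  avoid₄⁻ p (reverse v) (subst (T ∘ avoid₄ p) (reverse-window u v a b c d) t) (turn p a b c d f) }
  where
  turn : ∀ p x y z w → T (fits₄ (reversed p) x y z w) → T (fits₄ p w z y x)
  turn p@(_ ∷ _ ∷ _ ∷ _ ∷ _ ∷ []) x y z w t with f₁ , f₂ , f₃ , f₄ , f₅ , f₆ ← fits₄⁻ (reversed p) x y z w t =
    fits₄⁺ p w z y x (Agree-flip f₆ , Agree-flip f₅ , Agree-flip f₃ , Agree-flip f₄ , Agree-flip f₂ , Agree-flip f₁)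

reversed-involutive : ∀ p → reversed (reversed p) ≡ p
reversed-involutive (_ ∷ _ ∷ _ ∷ _ ∷ _ ∷ []) = refl

-- One implication for all patterns and words suffices, as both reversals are involutions.
avoid₄-reverse : ∀ p ws → avoid₄ p (reverse ws) ≡ avoid₄ (reversed p) ws
avoid₄-reverse p ws = T-≡ (avoid₄-unreverse p ws) λ t →
  subst (λ q → T (avoid₄ q (reverse ws))) (reversed-involutive p)
    (avoid₄-unreverse (reversed p) (reverse ws) (subst (T ∘ avoid₄ (reversed p)) (sym (reverse-involutive ws)) t))

≡ᵇ-comm : ∀ x y → (x ≡ᵇ y) ≡ (y ≡ᵇ x)
≡ᵇ-comm x y = T-≡ (λ t → ≡⇒≡ᵇ y x (sym (≡ᵇ⇒≡ x y t))) (λ t → ≡⇒≡ᵇ x y (sym (≡ᵇ⇒≡ y x t)))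

fresh-snoc : ∀ x ws y → fresh x (ws ∷ʳ y) ≡ not (x ≡ᵇ y) ∧ fresh x ws
fresh-snoc x []       y = refl
fresh-snoc x (w ∷ ws) y = trans (cong (not (x ≡ᵇ w) ∧_) (fresh-snoc x ws y)) (∧-swap (not (x ≡ᵇ w)) (not (x ≡ᵇ y)) (fresh x ws))
  where
  ∧-swap : ∀ a b c → a ∧ b ∧ c ≡ b ∧ a ∧ c
  ∧-swap true  b c = refl
  ∧-swap false true  c = refl
  ∧-swap false false c = refl

fresh-reverse : ∀ x ws → fresh x (reverse ws) ≡ fresh x ws
fresh-reverse x []       = refl
fresh-reverse x (w ∷ ws) = trans (cong (fresh x) (unfold-reverse w ws))
  (trans (fresh-snoc x (reverse ws) w) (cong (not (x ≡ᵇ w) ∧_) (fresh-reverse x ws)))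

uniq-snoc : ∀ ws x → uniq (ws ∷ʳ x) ≡ fresh x ws ∧ uniq ws
uniq-snoc []       x = refl
uniq-snoc (w ∷ ws) x = trans (cong₂ _∧_ (trans (fresh-snoc w ws x) (cong (λ t → not t ∧ fresh w ws) (≡ᵇ-comm w x))) (uniq-snoc ws x))
  (∧-shuffle₄ (not (x ≡ᵇ w)) (fresh w ws) (fresh x ws) (uniq ws))
  where
  ∧-shuffle₄ : ∀ a b c d → (a ∧ b) ∧ (c ∧ d) ≡ (a ∧ c) ∧ (b ∧ d)
  ∧-shuffle₄ true  true  c     d = refl
  ∧-shuffle₄ true  false true  d = refl
  ∧-shuffle₄ true  false false d = refl
  ∧-shuffle₄ false b     c     d = refl

uniq-reverse : ∀ ws → uniq (reverse ws) ≡ uniq ws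
uniq-reverse []       = refl
uniq-reverse (w ∷ ws) = trans (cong uniq (unfold-reverse w ws))
  (trans (uniq-snoc (reverse ws) w) (cong₂ _∧_ (fresh-reverse w ws) (uniq-reverse ws)))

blocks-words : ∀ p m i → blocks p m i ≡ ∑ʷ m i (λ ws → 𝟙 (uniq ws) * 𝟙 (avoid₄ p ws))
blocks-words p m i = ∑ᶜ-words m i (avoid₄ p)

blocks-reversed : ∀ p m i → blocks (reversed p) m i ≡ blocks p m i
blocks-reversed p m i = begin
  blocks (reversed p) m i
    ≡⟨ blocks-words (reversed p) m i ⟩
  ∑ʷ m i (λ ws → 𝟙 (uniq ws) * 𝟙 (avoid₄ (reversed p) ws))
    ≡⟨ ∑ʷ-cong m i (λ ws _ → sym (cong₂ (λ u a → 𝟙 u * 𝟙 a) (uniq-reverse ws) (avoid₄-reverse p ws))) ⟩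
  ∑ʷ m i ((λ ws → 𝟙 (uniq ws) * 𝟙 (avoid₄ p ws)) ∘ reverse)
    ≡⟨ ∑ʷ-reverse m i _ ⟩
  ∑ʷ m i (λ ws → 𝟙 (uniq ws) * 𝟙 (avoid₄ p ws))
    ≡⟨ sym (blocks-words p m i) ⟩
  blocks p m i ∎
  where open ≡-Reasoning

blocks-mirror : ∀ p → Bounded₄ p → ∀ m i → blocks (mirror₄ p) m i ≡ blocks p m i
blocks-mirror p bd m i = begin
  blocks (mirror₄ p) m i
    ≡⟨ blocks-words (mirror₄ p) m i ⟩
  ∑ʷ m i (λ ws → 𝟙 (uniq ws) * 𝟙 (avoid₄ (mirror₄ p) ws))
    ≡⟨ sym (∑ʷ-mirror m i _) ⟩
  ∑ʷ m i (λ ws → 𝟙 (uniq (map (λ x → m ∸ suc x) ws)) * 𝟙 (avoid₄ (mirror₄ p) (map (λ x → m ∸ suc x) ws)))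
    ≡⟨ ∑ʷ-cong m i (λ ws ls → cong₂ (λ u a → 𝟙 u * 𝟙 a) (Mirror.uniq-mirror m ls) (Mirror.avoid₄-mirror m p bd ls)) ⟩
  ∑ʷ m i (λ ws → 𝟙 (uniq ws) * 𝟙 (avoid₄ p ws))
    ≡⟨ sym (blocks-words p m i) ⟩
  blocks p m i ∎
  where open ≡-Reasoning

-- The permutations of Defs

does-≡ : ∀ {P : Set} (d : Dec P) {b} → (P → T b) → (T b → P) → does d ≡ b
does-≡ (yes p) f g = sym (T⇒true (f p))
does-≡ (no ¬p) f g = sym (¬T⇒false (¬p ∘ g))

length-filter : ∀ {A : Set} {P Q : A → Set} (P? : Decidable P) (Q? : Decidable Q) xs →
                length (filter Q? (filter P? xs)) ≡ sum (map (λ x → 𝟙 (does (P? x)) * 𝟙 (does (Q? x))) xs)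
length-filter P? Q? []       = refl
length-filter P? Q? (x ∷ xs) with does (P? x)
... | false = length-filter P? Q? xs
... | true with does (Q? x)
...   | false = length-filter P? Q? xs
...   | true  = cong suc (length-filter P? Q? xs)

sum-product : ∀ {A B C : Set} (G : C → ℕ) (f : A → B → C) xs ys →
              sum (map G (cartesianProductWith f xs ys)) ≡ sum (map (λ x → sum (map (G ∘ f x) ys)) xs)
sum-product G f []       ys = refl
sum-product G f (x ∷ xs) ys = begin
  sum (map G (map (f x) ys ++ cartesianProductWith f xs ys))
    ≡⟨ cong sum (map-++ G (map (f x) ys) _) ⟩
  sum (map G (map (f x) ys) ++ map G (cartesianProductWith f xs ys))
    ≡⟨ sum-++ (map G (map (f x) ys)) _ ⟩
  sum (map G (map (f x) ys)) + sum (map G (cartesianProductWith f xs ys))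
    ≡⟨ cong₂ _+_ (cong sum (sym (map-∘ ys))) (sum-product G f xs ys) ⟩
  sum (map (G ∘ f x) ys) + sum (map (λ x → sum (map (G ∘ f x) ys)) xs) ∎
  where
  open ≡-Reasoning

sum-tabulate : ∀ {A : Set} m (g : Fin m → A) (h : A → ℕ) (f : ℕ → ℕ) → (∀ i → h (g i) ≡ f (toℕ i)) →
               sum (map h (tabulate g)) ≡ ∑ m f
sum-tabulate zero    g h f eq = sym (∑-nil f)
sum-tabulate (suc m) g h f eq = trans (cong₂ _+_ (eq 0F) (sum-tabulate m (g ∘ Fin.suc) h (f ∘ suc) (eq ∘ Fin.suc))) (sym (∑-suc m f))

letters : ∀ {m k} → Vec (Fin m) k → List ℕ
letters w = toList (Vec.map toℕ w)

sum-words : ∀ m k (G : Vec (Fin m) k → ℕ) F → (∀ w → G w ≡ F (letters w)) → sum (map G (words m k)) ≡ ∑ʷ m k F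
sum-words m zero    G F eq = trans (+-identityʳ _) (trans (eq []) (sym (∑ʷ-nil m F)))
sum-words m (suc k) G F eq = begin
  sum (map G (cartesianProductWith _∷_ (allFin m) (words m k)))
    ≡⟨ sum-product G _∷_ (allFin m) (words m k) ⟩
  sum (map (λ x → sum (map (G ∘ (x ∷_)) (words m k))) (allFin m))
    ≡⟨ sum-tabulate m id _ (λ x → ∑ʷ m k (F ∘ (x ∷_))) (λ i → sum-words m k (G ∘ (i ∷_)) (F ∘ (toℕ i ∷_)) (eq ∘ (i ∷_))) ⟩
  (∑[ x < m ] ∑ʷ m k (F ∘ (x ∷_)))
    ≡⟨ sym (∑ʷ-suc m k F) ⟩
  ∑ʷ m (suc k) F ∎
  where open ≡-Reasoning

fresh⁺ : ∀ {m k} {x : Fin m} {w : Vec (Fin m) k} → VecAll.All (x ≢_) w → T (fresh (toℕ x) (letters w))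
fresh⁺ []       = tt
fresh⁺ (n ∷ ns) = ≢⇒fresh (n ∘ toℕ-injective) (fresh⁺ ns)

fresh⁻ : ∀ {m k} {x : Fin m} (w : Vec (Fin m) k) → T (fresh (toℕ x) (letters w)) → VecAll.All (x ≢_) w
fresh⁻         []      t = []
fresh⁻ {x = x} (y ∷ w) t = (fresh⇒≢ (T-∧ˡ t) ∘ cong toℕ) ∷ fresh⁻ w (T-∧ʳ {not (toℕ x ≡ᵇ toℕ y)} t)

uniq⁺ : ∀ {m k} {w : Vec (Fin m) k} → Unique w → T (uniq (letters w))
uniq⁺ []       = tt
uniq⁺ (n ∷ ns) = T-∧⁺ (fresh⁺ n) (uniq⁺ ns)

uniq⁻ : ∀ {m k} (w : Vec (Fin m) k) → T (uniq (letters w)) → Unique w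
uniq⁻ []      t = []
uniq⁻ (x ∷ w) t = fresh⁻ w (T-∧ˡ t) ∷ uniq⁻ w (T-∧ʳ {fresh (toℕ x) (letters w)} t)

module Occurrences (a₁ a₂ a₃ a₄ a₅ : Fin 5) where

  private
    s : Vec (Fin 5) 5
    s = a₁ ∷ a₂ ∷ a₃ ∷ a₄ ∷ a₅ ∷ []

  pattern-letters : Vec ℕ 5
  pattern-letters = Vec.map (suc ∘ toℕ) s

  -- Alphabet size and length are separated to allow induction on the word; for k = m this is
  -- `IsOccurrence`.
  Occurs : ∀ {m k} → Vec (Fin m) k → (i₁ i₂ i₃ i₄ i₅ : Fin k) → Set
  Occurs π i₁ i₂ i₃ i₄ i₅ =
    toℕ i₂ ≡ suc (toℕ i₁) × toℕ i₃ ≡ suc (toℕ i₂) × toℕ i₄ ≡ suc (toℕ i₃) × i₄ Fin.< i₅ ×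
    OrderIsomorphic (Vec.map (lookup π) (i₁ ∷ i₂ ∷ i₃ ∷ i₄ ∷ i₅ ∷ [])) s

  Has : ∀ {m k} → Vec (Fin m) k → Set
  Has π = ∃ λ i₁ → ∃ λ i₂ → ∃ λ i₃ → ∃ λ i₄ → ∃ λ i₅ → Occurs π i₁ i₂ i₃ i₄ i₅

  ⇔⇒Agree : ∀ {m} {x y : Fin m} {a b : Fin 5} → (x Fin.< y ⇔ a Fin.< b) → (y Fin.< x ⇔ b Fin.< a) →
            Agree (toℕ x) (toℕ y) (suc (toℕ a)) (suc (toℕ b))
  ⇔⇒Agree e e′ = agreeing (half e) (half e′)
    where
    half : ∀ {x y a b} → (x < y ⇔ a < b) → (x <ᵇ y) ≡ (a <ᵇ b)
    half {x} {y} {a} {b} e = T-≡ (<⇒<ᵇ ∘ Equivalence.to e ∘ <ᵇ⇒< x y) (<⇒<ᵇ ∘ Equivalence.from e ∘ <ᵇ⇒< a b)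

  Agree⇒⇔ : ∀ {m} {x y : Fin m} {a b : Fin 5} → Agree (toℕ x) (toℕ y) (suc (toℕ a)) (suc (toℕ b)) → (x Fin.< y ⇔ a Fin.< b)
  Agree⇒⇔ {x = x} {y} {a} {b} f = mk⇔
    (λ lt → <ᵇ⇒< (toℕ a) (toℕ b) (subst T (<-agree f) (<⇒<ᵇ lt)))
    (λ lt → <ᵇ⇒< (toℕ x) (toℕ y) (subst T (sym (<-agree f)) (<⇒<ᵇ lt)))

  module _ {m} (x y z w v : Fin m) where

    private
      p = pattern-letters

    iso⁻ : OrderIsomorphic (x ∷ y ∷ z ∷ w ∷ v ∷ []) s →
           Fits₄ p (toℕ x) (toℕ y) (toℕ z) (toℕ w) × Fits₅ p (toℕ x) (toℕ y) (toℕ z) (toℕ w) (toℕ v)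
    iso⁻ o = (ag 0F 1F , ag 0F 2F , ag 0F 3F ,
              ag 1F 2F , ag 1F 3F ,
              ag 2F 3F) ,
             (ag 0F l , ag 1F l , ag 2F l , ag 3F l)
      where
      l : Fin 5
      l = 4F
      ag : ∀ i j → Agree (toℕ (lookup (x ∷ y ∷ z ∷ w ∷ v ∷ []) i)) (toℕ (lookup (x ∷ y ∷ z ∷ w ∷ v ∷ []) j))
                         (suc (toℕ (lookup s i))) (suc (toℕ (lookup s j)))
      ag i j = ⇔⇒Agree (o i j) (o j i)

    iso⁺ : Fits₄ p (toℕ x) (toℕ y) (toℕ z) (toℕ w) → Fits₅ p (toℕ x) (toℕ y) (toℕ z) (toℕ w) (toℕ v) →
           OrderIsomorphic (x ∷ y ∷ z ∷ w ∷ v ∷ []) s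
    iso⁺ (f₁ , f₂ , f₃ , f₄ , f₅ , f₆) (g₁ , g₂ , g₃ , g₄) i j = Agree⇒⇔ (ag i j)
      where
      self : ∀ {m} (x : Fin m) (a : Fin 5) → Agree (toℕ x) (toℕ x) (suc (toℕ a)) (suc (toℕ a))
      self x a = agreeing (trans (n<ᵇn (toℕ x)) (sym (n<ᵇn (toℕ a)))) (trans (n<ᵇn (toℕ x)) (sym (n<ᵇn (toℕ a))))
      ag : ∀ i j → Agree (toℕ (lookup (x ∷ y ∷ z ∷ w ∷ v ∷ []) i)) (toℕ (lookup (x ∷ y ∷ z ∷ w ∷ v ∷ []) j))
                         (suc (toℕ (lookup s i))) (suc (toℕ (lookup s j)))
      ag 0F 0F = self x a₁
      ag 0F 1F = f₁
      ag 0F 2F = f₂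
      ag 0F 3F = f₃
      ag 0F 4F = g₁
      ag 1F 1F = self y a₂
      ag 1F 2F = f₄
      ag 1F 3F = f₅
      ag 1F 4F = g₂
      ag 2F 2F = self z a₃
      ag 2F 3F = f₆
      ag 2F 4F = g₃
      ag 3F 3F = self w a₄
      ag 3F 4F = g₄
      ag 4F 4F = self v a₅
      ag 1F 0F = Agree-flip f₁
      ag 2F 0F = Agree-flip f₂
      ag 3F 0F = Agree-flip f₃
      ag 4F 0F = Agree-flip g₁
      ag 2F 1F = Agree-flip f₄
      ag 3F 1F = Agree-flip f₅
      ag 4F 1F = Agree-flip g₂
      ag 3F 2F = Agree-flip f₆
      ag 4F 2F = Agree-flip g₃
      ag 4F 3F = Agree-flip g₄

  private
    p = pattern-letters

  ∈-letters : ∀ {m k} (π : Vec (Fin m) k) j → toℕ (lookup π j) ∈ letters π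
  ∈-letters (x ∷ π) 0F    = here refl
  ∈-letters (x ∷ π) (Fin.suc j) = there (∈-letters π j)

  letters-∈ : ∀ {m k} (π : Vec (Fin m) k) {v} → v ∈ letters π → ∃ λ j → v ≡ toℕ (lookup π j)
  letters-∈ (x ∷ π) (here refl) = 0F , refl
  letters-∈ (x ∷ π) (there i) with j , eq ← letters-∈ π i = Fin.suc j , eq

  hit⇒Has : ∀ {m k} (π : Vec (Fin m) k) → T (hit p (letters π)) → Has π
  hit⇒Has (x ∷ y ∷ z ∷ w ∷ π) t
    with v , i , tv ← any⁻ (fits₅ p (toℕ x) (toℕ y) (toℕ z) (toℕ w)) (letters π) (T-∧ʳ {fits₄ p (toℕ x) (toℕ y) (toℕ z) (toℕ w)} t)
    with j , refl ← letters-∈ π i =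
    0F , 1F , 2F , 3F , Fin.suc (Fin.suc (Fin.suc (Fin.suc j))) ,
    refl , refl , refl , s≤s (s≤s (s≤s (s≤s z≤n))) ,
    iso⁺ x y z w (lookup π j) (fits₄⁻ p (toℕ x) (toℕ y) (toℕ z) (toℕ w) (T-∧ˡ t))
                              (fits₅⁻ p (toℕ x) (toℕ y) (toℕ z) (toℕ w) (toℕ (lookup π j)) tv)

  Has-∷ : ∀ {m k x} {π : Vec (Fin m) k} → Has π → Has (x ∷ π)
  Has-∷ (i₁ , i₂ , i₃ , i₄ , i₅ , e₁ , e₂ , e₃ , lt , o) =
    Fin.suc i₁ , Fin.suc i₂ , Fin.suc i₃ , Fin.suc i₄ , Fin.suc i₅ , cong suc e₁ , cong suc e₂ , cong suc e₃ , s≤s lt , o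

  Has⇒ : ∀ {m k} x (π : Vec (Fin m) k) → Has (x ∷ π) → T (hit p (letters (x ∷ π))) ⊎ Has π
  Has⇒ x (y ∷ z ∷ w ∷ π)
    (0F , 1F , 2F , 3F , Fin.suc (Fin.suc (Fin.suc (Fin.suc j))) , refl , refl , refl , _ , o)
    with f₄ , f₅ ← iso⁻ x y z w (lookup π j) o =
    inj₁ (T-∧⁺ (fits₄⁺ p (toℕ x) (toℕ y) (toℕ z) (toℕ w) f₄)
               (any⁺ (∈-letters π j) (fits₅⁺ p (toℕ x) (toℕ y) (toℕ z) (toℕ w) (toℕ (lookup π j)) f₅)))
  Has⇒ x (_ ∷ _ ∷ _ ∷ _) (0F , 1F , 2F , 3F , 1F , refl , refl , refl , s≤s () , _)
  Has⇒ x (_ ∷ _ ∷ _ ∷ _) (0F , 1F , 2F , 3F , 2F , refl , refl , refl , s≤s (s≤s ()) , _)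
  Has⇒ x (_ ∷ _ ∷ _ ∷ _)
    (0F , 1F , 2F , 3F , 3F , refl , refl , refl , s≤s (s≤s (s≤s ())) , _)
  Has⇒ x (_ ∷ []) (0F , _ , _ , i₄ , _ , e₁ , e₂ , e₃ , _) =
    ⊥-elim (<⇒≱ (subst (_< 2) (trans e₃ (cong suc (trans e₂ (cong suc e₁)))) (toℕ<n i₄)) (s≤s (s≤s z≤n)))
  Has⇒ x (_ ∷ _ ∷ []) (0F , _ , _ , i₄ , _ , e₁ , e₂ , e₃ , _) =
    ⊥-elim (<⇒≱ (subst (_< 3) (trans e₃ (cong suc (trans e₂ (cong suc e₁)))) (toℕ<n i₄)) (s≤s (s≤s (s≤s z≤n))))
  Has⇒ x π (Fin.suc i₁ , Fin.suc i₂ , Fin.suc i₃ , Fin.suc i₄ , Fin.suc i₅ , e₁ , e₂ , e₃ , s≤s lt , o) =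
    inj₂ (i₁ , i₂ , i₃ , i₄ , i₅ , suc-injective e₁ , suc-injective e₂ , suc-injective e₃ , lt , o)

  avoid⁺ : ∀ {m k} (π : Vec (Fin m) k) → ¬ Has π → T (avoid p (letters π))
  avoid⁺ []      h = tt
  avoid⁺ (x ∷ π) h = T-∧⁺ {not (hit p (letters (x ∷ π)))} (T-not (h ∘ hit⇒Has (x ∷ π))) (avoid⁺ π (h ∘ Has-∷))

  avoid⁻ : ∀ {m k} (π : Vec (Fin m) k) → T (avoid p (letters π)) → ¬ Has π
  avoid⁻ []      t (() , _)
  avoid⁻ (x ∷ π) t h with Has⇒ x π h
  ... | inj₁ t′ = not-T (T-∧ˡ t) t′
  ... | inj₂ h′ = avoid⁻ π (T-∧ʳ {not (hit p (letters (x ∷ π)))} t) h′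

oneLine-distinct : ∀ σ → Distinct₅ (oneLine σ)
oneLine-distinct (a ∷ b ∷ c ∷ d ∷ e ∷ [] ,
    (_ ∷ _ ∷ _ ∷ n₁ ∷ []) ∷ (_ ∷ _ ∷ n₂ ∷ []) ∷ (_ ∷ n₃ ∷ []) ∷ (n₄ ∷ []) ∷ _) =
  lift n₁ , lift n₂ , lift n₃ , lift n₄
  where
  lift : ∀ {a b : Fin 5} → a ≢ b → suc (toℕ a) ≢ suc (toℕ b)
  lift n = n ∘ toℕ-injective ∘ suc-injective

length-S : ∀ σ n → length (S[ σ ] n) ≡ count (oneLine σ) n
length-S σ@(a₁ ∷ a₂ ∷ a₃ ∷ a₄ ∷ a₅ ∷ [] , _) n = begin
  length (S[ σ ] n)
    ≡⟨ length-filter unique? (avoids? σ) (words n n) ⟩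
  sum (map (λ w → 𝟙 (does (unique? w)) * 𝟙 (does (avoids? σ w))) (words n n))
    ≡⟨ sum-words n n _ (λ ws → 𝟙 (uniq ws) * 𝟙 (avoid (oneLine σ) ws)) (λ w → cong₂ (λ u a → 𝟙 u * 𝟙 a)
         (does-≡ (unique? w) uniq⁺ (uniq⁻ w))
         (does-≡ (avoids? σ w) (avoid⁺ w) (avoid⁻ w))) ⟩
  ∑ʷ n n (λ ws → 𝟙 (uniq ws) * 𝟙 (avoid (oneLine σ) ws))
    ≡⟨ sym (count-words (oneLine σ) (oneLine-distinct σ) n) ⟩
  count (oneLine σ) n ∎
  where
  open ≡-Reasoning
  open Occurrences a₁ a₂ a₃ a₄ a₅

-- The classes

infix 4 _≅_
record _≅_ (p q : Vec ℕ 5) : Set where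
  constructor equinumerous
  field
    counts : ∀ n → count p n ≡ count q n
open _≅_ public

self : ∀ {p} → p ≅ p
self = equinumerous λ _ → refl

≅-sym : ∀ {p q} → p ≅ q → q ≅ p
≅-sym e = equinumerous λ n → sym (counts e n)

infixr 6 _⊙_
_⊙_ : ∀ {p q r} → p ≅ q → q ≅ r → p ≅ r
e ⊙ f = equinumerous λ n → trans (counts e n) (counts f n)

valid : Vec ℕ 5 → Bool
valid p@(a ∷ b ∷ c ∷ d ∷ e ∷ []) =
  uniq (toList p) ∧ (a <ᵇ 6) ∧ (b <ᵇ 6) ∧ (c <ᵇ 6) ∧ (d <ᵇ 6) ∧ (e <ᵇ 6)

uniq⇒distinct : ∀ p → T (uniq (toList p)) → Distinct₄ p × Distinct₅ p
uniq⇒distinct (a ∷ b ∷ c ∷ d ∷ e ∷ []) t =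
  let row₁ = T-∧ˡ t ; t₂ = T-∧ʳ {fresh a (b ∷ c ∷ d ∷ e ∷ [])} t
      row₂ = T-∧ˡ t₂ ; t₃ = T-∧ʳ {fresh b (c ∷ d ∷ e ∷ [])} t₂
      row₃ = T-∧ˡ t₃ ; t₄ = T-∧ʳ {fresh c (d ∷ e ∷ [])} t₃
      ab , ac , ad , ae = four row₁
      bc , bd , be = three row₂
      cd , ce = two row₃
  in (ab , ac , ad , bc , bd , cd) , (ae , be , ce , one (T-∧ˡ t₄))
  where
  one : ∀ {x y} → T (fresh x (y ∷ [])) → x ≢ y
  one t = fresh⇒≢ (T-∧ˡ t)
  two : ∀ {x y z} → T (fresh x (y ∷ z ∷ [])) → x ≢ y × x ≢ z
  two {x} {y} t = fresh⇒≢ (T-∧ˡ t) , one (T-∧ʳ {not (x ≡ᵇ y)} t)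
  three : ∀ {x y z w} → T (fresh x (y ∷ z ∷ w ∷ [])) → x ≢ y × x ≢ z × x ≢ w
  three {x} {y} t = fresh⇒≢ (T-∧ˡ t) , two (T-∧ʳ {not (x ≡ᵇ y)} t)
  four : ∀ {x y z w v} → T (fresh x (y ∷ z ∷ w ∷ v ∷ [])) → x ≢ y × x ≢ z × x ≢ w × x ≢ v
  four {x} {y} t = fresh⇒≢ (T-∧ˡ t) , three (T-∧ʳ {not (x ≡ᵇ y)} t)

valid-distinct : ∀ p → T (valid p) → Distinct₄ p × Distinct₅ p
valid-distinct p@(_ ∷ _ ∷ _ ∷ _ ∷ _ ∷ []) t = uniq⇒distinct p (T-∧ˡ t)

valid-bounded : ∀ p → T (valid p) → Bounded₄ p × Bounded p
valid-bounded p@(a ∷ b ∷ c ∷ d ∷ e ∷ []) t =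
  let t₁ = T-∧ʳ {uniq (toList p)} t ; t₂ = T-∧ʳ {a <ᵇ 6} t₁ ; t₃ = T-∧ʳ {b <ᵇ 6} t₂
      t₄ = T-∧ʳ {c <ᵇ 6} t₃ ; t₅ = T-∧ʳ {d <ᵇ 6} t₄
      la = <ᵇ⇒< a 6 (T-∧ˡ t₁) ; lb = <ᵇ⇒< b 6 (T-∧ˡ t₂) ; lc = <ᵇ⇒< c 6 (T-∧ˡ t₃)
      ld = <ᵇ⇒< d 6 (T-∧ˡ t₄) ; le = <ᵇ⇒< e 6 t₅
  in (la , lb , lc , ld) , (m<n⇒m<1+n la , m<n⇒m<1+n lb , m<n⇒m<1+n lc , m<n⇒m<1+n ld , m<n⇒m<1+n le)

≅-reversed : ∀ p {v : T (valid p)} {v′ : T (valid (reversed p))} {t : Top p} {t′ : Top (reversed p)} → reversed p ≅ p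
≅-reversed p {v} {v′} {t} {t′} =
  equinumerous (top-count (reversed p) p (proj₂ (valid-distinct _ v′)) (proj₂ (valid-distinct _ v)) t′ t (blocks-reversed p))

≅-mirror₄ : ∀ p {v : T (valid p)} {v′ : T (valid (mirror₄ p))} {t : Top p} {t′ : Top (mirror₄ p)} → mirror₄ p ≅ p
≅-mirror₄ p {v} {v′} {t} {t′} =
  equinumerous (top-count (mirror₄ p) p (proj₂ (valid-distinct _ v′)) (proj₂ (valid-distinct _ v)) t′ t
    (blocks-mirror p (proj₁ (valid-bounded p v))))

≅-windows : ∀ {p q} → p ≈ᵏ q → rank₄ p ≡ rank₄ q → {T (valid p)} → {T (valid q)} →
            {NonOverlapping p} → {NonOverlapping q} → p ≅ q
≅-windows {p} {q} e r {v} {v′} {o} {o′} =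
  equinumerous (nonOverlapping-count p q (proj₁ (valid-distinct p v)) (proj₁ (valid-distinct q v′)) o o′ r e)

Bounded-oneLine : ∀ σ → Bounded (oneLine σ)
Bounded-oneLine (a ∷ b ∷ c ∷ d ∷ e ∷ [] , _) = lt a , lt b , lt c , lt d , lt e
  where
  lt : (i : Fin 5) → suc (toℕ i) < 7
  lt i = s≤s (≤-trans (toℕ<n i) (n≤1+n 5))

mirror-distinct : ∀ p → Bounded p → Distinct₅ p → Distinct₅ (mirror p)
mirror-distinct (a ∷ b ∷ c ∷ d ∷ e ∷ []) (la , lb , lc , ld , le) (n₁ , n₂ , n₃ , n₄) =
  lift la n₁ , lift lb n₂ , lift lc n₃ , lift ld n₄
  where
  lift : ∀ {a} → a < 7 → a ≢ e → 7 ∸ suc a ≢ 7 ∸ suc e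
  lift la n = n ∘ suc-injective ∘ ∸-cancelˡ-≡ la le

≅-complement : ∀ σ → complement (oneLine σ) ≅ oneLine σ
≅-complement σ = equinumerous (count-mirror (oneLine σ) (oneLine-distinct σ)
  (mirror-distinct (oneLine σ) (Bounded-oneLine σ) (oneLine-distinct σ)) (Bounded-oneLine σ))

≅-mirror : ∀ p {v : T (valid p)} {v′ : T (valid (mirror p))} → mirror p ≅ p
≅-mirror p {v} {v′} =
  equinumerous (count-mirror p (proj₂ (valid-distinct p v)) (proj₂ (valid-distinct _ v′)) (proj₂ (valid-bounded p v)))

slide₃ : ∀ a b c d e → (c <ᵇ e) ≡ true → Agree a c a e → Agree b c b e → Agree c d e d →
         rank₄ (pat a b c d e) ≡ rank₄ (pat a b e d c) →
         {T (valid (pat a b c d e))} → {T (valid (pat a b e d c))} →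
         {NonOverlapping (pat a b c d e)} → {NonOverlapping (pat a b e d c)} → pat a b c d e ≅ pat a b e d c
slide₃ a b c d e l f g h r {v} {v′} {o} {o′} = ≅-windows (≈ᵏ-slide a b c d e l f g h) r {v} {v′} {o} {o′}

-- The slide of the third letter, conjugated with the exchange of the inner letters. The chain runs
-- within `≈ᵏ`; the passage to counts is made once, between its ends.
slide₂ : ∀ a b c d e → (b <ᵇ e) ≡ true → Agree a b a e → Agree c b c e → Agree b d e d →
         rank₄ (pat a b c d e) ≡ rank₄ (pat a e c d b) →
         {T (valid (pat a b c d e))} → {T (valid (pat a e c d b))} →
         {NonOverlapping (pat a b c d e)} → {NonOverlapping (pat a e c d b)} → pat a b c d e ≅ pat a e c d b
slide₂ a b c d e l f g h r {v} {v′} {o} {o′} = ≅-windows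
  (≈ᵏ-trans {pat a b c d e} {pat a c b d e} {pat a e c d b} (≈ᵏ-swap a b c d e)
    (≈ᵏ-trans {pat a c b d e} {pat a c e d b} {pat a e c d b} (≈ᵏ-slide a c b d e l f g h) (≈ᵏ-swap a c e d b)))
  r {v} {v′} {o} {o′}

swap₂₃ : ∀ a b c d e → rank₄ (pat a b c d e) ≡ rank₄ (pat a c b d e) →
         {T (valid (pat a b c d e))} → {T (valid (pat a c b d e))} →
         {NonOverlapping (pat a b c d e)} → {NonOverlapping (pat a c b d e)} → pat a b c d e ≅ pat a c b d e
swap₂₃ a b c d e r {v} {v′} {o} {o′} = ≅-windows (≈ᵏ-swap a b c d e) r {v} {v′} {o} {o′}

pattern easy = agreeing refl refl

representative : List (Vec ℕ 5) → Vec ℕ 5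
-- A default only: no class is empty.
representative []      = pat 1 2 3 4 5
representative (p ∷ _) = p

13425≅13524 : pat 1 3 4 2 5 ≅ pat 1 3 5 2 4
13425≅13524 = slide₃ 1 3 4 2 5 refl easy easy easy refl

-- This joins the orbits of 1342 and 1432 under reversal and complement, and with them all patterns
-- of the largest class with fifth letter 1 or 5; its other patterns are attached by slides.
13425≅14325 : pat 1 3 4 2 5 ≅ pat 1 4 3 2 5
13425≅14325 = swap₂₃ 1 3 4 2 5 refl

24315≅31245 : pat 2 4 3 1 5 ≅ pat 3 1 2 4 5
24315≅31245 = ≅-sym (≅-mirror₄ (pat 2 4 3 1 5))

13425≅31245 : pat 1 3 4 2 5 ≅ pat 3 1 2 4 5
13425≅31245 = ≅-sym (≅-reversed (pat 1 3 4 2 5)) ⊙ 24315≅31245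

14325≅31245 : pat 1 4 3 2 5 ≅ pat 3 1 2 4 5
14325≅31245 = ≅-sym 13425≅14325 ⊙ 13425≅31245

23415≅31245 : pat 2 3 4 1 5 ≅ pat 3 1 2 4 5
23415≅31245 = ≅-reversed (pat 1 4 3 2 5) ⊙ 14325≅31245

-- A pattern with σ₅ = 1 is complemented first, so that σ₅ = 5 and the symmetries of the first four
-- letters become available.
class-equivalent : VecAll.All (λ ps → All (_≅ representative ps) ps) classes
class-equivalent =
  (self ∷ ≅-sym (slide₂ 1 2 5 4 3 refl easy easy easy refl) ∷ []) ∷
  (self ∷ ≅-sym (swap₂₃ 1 4 5 3 2 refl) ∷ []) ∷
  (self ∷ ≅-sym (slide₃ 2 1 3 5 4 refl easy easy easy refl) ∷ []) ∷
  (self ∷ []) ∷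
  (self ∷ []) ∷
  (self ∷
   ≅-sym (slide₃ 1 2 4 3 5 refl easy easy easy refl) ∷
   21345≅12435 ∷
   ≅-sym (≅-mirror (pat 2 3 5 4 1)) ⊙ ≅-reversed (pat 2 1 3 4 5) ⊙ 21345≅12435 ∷
   slide₂ 3 1 4 5 2 refl easy easy easy refl ⊙ 32451≅12435 ∷
   32451≅12435 ∷ []) ∷
  (self ∷ ≅-sym (swap₂₃ 3 1 2 5 4 refl) ∷ []) ∷
  (self ∷ []) ∷
  (self ∷ []) ∷
  (self ∷ []) ∷
  (self ∷ []) ∷
  (self ∷
   ≅-mirror₄ (pat 2 3 4 1 5) ⊙ 23415≅31245 ∷
   ≅-sym (≅-mirror (pat 2 5 4 3 1)) ⊙ ≅-mirror₄ (pat 1 4 3 2 5) ⊙ 14325≅31245 ∷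
   ≅-sym (≅-mirror (pat 2 4 5 3 1)) ⊙ ≅-mirror₄ (pat 1 3 4 2 5) ⊙ 13425≅31245 ∷
   23415≅31245 ∷
   24315≅31245 ∷
   13425≅31245 ∷
   14325≅31245 ∷
   ≅-sym 13425≅13524 ⊙ 13425≅31245 ∷
   ≅-sym (13425≅13524 ⊙ slide₂ 1 3 5 2 4 refl easy easy easy refl) ⊙ 13425≅31245 ∷
   ≅-sym (slide₂ 1 4 3 2 5 refl easy easy easy refl) ⊙ 14325≅31245 ∷
   ≅-sym (slide₂ 1 4 3 2 5 refl easy easy easy refl ⊙ slide₃ 1 5 3 2 4 refl easy easy easy refl) ⊙ 14325≅31245 ∷
   ≅-sym (slide₂ 2 4 3 1 5 refl easy easy easy refl) ⊙ 24315≅31245 ∷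
   ≅-sym (slide₂ 2 4 3 1 5 refl easy easy easy refl ⊙ slide₃ 2 5 3 1 4 refl easy easy easy refl) ⊙ 24315≅31245 ∷
   ≅-sym (slide₃ 2 3 4 1 5 refl easy easy easy refl) ⊙ 23415≅31245 ∷
   ≅-sym (slide₃ 2 3 4 1 5 refl easy easy easy refl ⊙ slide₂ 2 3 5 1 4 refl easy easy easy refl) ⊙ 23415≅31245 ∷ []) ∷
  (self ∷ ≅-sym (equinumerous upper-lower-count) ∷ []) ∷
  (self ∷ []) ∷
  (self ∷ []) ∷
  (self ∷ []) ∷
  (self ∷ []) ∷
  (self ∷
   ≅-mirror₄ (pat 3 2 4 1 5) ⊙ ≅-reversed (pat 1 4 2 3 5) ∷
   ≅-sym (≅-mirror (pat 2 5 3 4 1)) ⊙ ≅-mirror₄ (pat 1 4 2 3 5) ∷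
   ≅-reversed (pat 1 4 2 3 5) ∷ []) ∷
  (self ∷ ≅-sym (≅-mirror (pat 3 2 5 4 1)) ⊙ ≅-reversed (pat 2 1 4 3 5) ∷ []) ∷
  (self ∷ []) ∷
  (self ∷ []) ∷
  (self ∷ ≅-sym (≅-mirror (pat 2 4 3 5 1)) ⊙ ≅-reversed (pat 1 3 2 4 5) ∷ []) ∷
  (self ∷ []) ∷
  (self ∷ ≅-reversed (pat 2 4 1 3 5) ∷ []) ∷
  (self ∷ equinumerous (placed-count middle back) ∷ equinumerous (placed-count front back) ∷ []) ∷
  (self ∷ ≅-sym (≅-mirror (pat 2 3 4 5 1)) ⊙ ≅-reversed (pat 1 2 3 4 5) ∷ []) ∷
  []
  where
  21345≅12435 : pat 2 1 3 4 5 ≅ pat 1 2 4 3 5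
  21345≅12435 = ≅-mirror₄ (pat 3 4 2 1 5) ⊙ ≅-reversed (pat 1 2 4 3 5)
  32451≅12435 : pat 3 2 4 5 1 ≅ pat 1 2 4 3 5
  32451≅12435 = ≅-sym (≅-mirror (pat 3 2 4 5 1)) ⊙ ≅-reversed (pat 1 2 4 3 5)

-- Separation of the classes

rep : Fin 26 → Vec ℕ 5
rep c = representative (lookup classes c)

-- 10 is the least length that separates all classes: H and I agree up to length 9.
counts₁₀ : Vec ℕ 26
counts₁₀ =
  3236090 ∷ 3236740 ∷ 3236426 ∷ 3237362 ∷ 3237698 ∷ 3237620 ∷ 3238028 ∷ 3238886 ∷ 3238891 ∷
  3239356 ∷ 3239412 ∷ 3240416 ∷ 3241219 ∷ 3243505 ∷ 3241738 ∷ 3242069 ∷ 3242738 ∷ 3243252 ∷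
  3245568 ∷ 3246798 ∷ 3247036 ∷ 3247430 ∷ 3249227 ∷ 3251054 ∷ 3253240 ∷ 3289057 ∷ []

opaque
  fingerprint : Vec ℕ 5 → ℕ
  -- Seven extensions of the table of length 3 reach length 10.
  fingerprint p = total₃ (table (badᶜ p) 7)

  fingerprint-count : ∀ p → count p 10 ≡ fingerprint p
  fingerprint-count p = count-table (badᶜ p) 7

  fingerprints : Vec.map (fingerprint ∘ representative) classes ≡ counts₁₀
  fingerprints = refl

count₁₀ : ∀ c → count (rep c) 10 ≡ lookup counts₁₀ c
count₁₀ c = trans (fingerprint-count (rep c))
  (trans (sym (lookup-map c (fingerprint ∘ representative) classes)) (cong (λ v → lookup v c) fingerprints))

counts₁₀-injective : ∀ c d → lookup counts₁₀ c ≡ lookup counts₁₀ d → c ≡ d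
counts₁₀-injective = toWitness {a? = all? λ c → all? λ d → (lookup counts₁₀ c ≟ lookup counts₁₀ d) →-dec (c Fin.≟ d)} tt

InClass : Vec ℕ 5 → Fin 26 → Set
InClass p c = p ∈ lookup classes c ⊎ complement p ∈ lookup classes c

inClass? : ∀ p c → Dec (InClass p c)
inClass? p c = (p ∈? lookup classes c) ⊎-dec (complement p ∈? lookup classes c)

UniqueClass : Vec ℕ 5 → Set
UniqueClass p = ∃ λ c → InClass p c × (∀ d → InClass p d → c ≡ d)

uniqueClass? : ∀ p → Dec (UniqueClass p)
uniqueClass? p = any? λ c → inClass? p c ×-dec all? λ d → inClass? p d →-dec (c Fin.≟ d)

word : (a b c d e : Fin 5) → Vec (Fin 5) 5
word a b c d e = a ∷ b ∷ c ∷ d ∷ e ∷ []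

-- A finite check over all words of five letters; the Boolean premise discards those with
-- repetitions.
uniqueClass : ∀ a b c d e → T (uniq (letters (word a b c d e))) → UniqueClass (Vec.map (suc ∘ toℕ) (word a b c d e))
uniqueClass = toWitness {a? = all? λ a → all? λ b → all? λ c → all? λ d → all? λ e →
  T? (uniq (letters (word a b c d e))) →-dec uniqueClass? (Vec.map (suc ∘ toℕ) (word a b c d e))} tt

class : ∀ σ → UniqueClass (oneLine σ)
class (a ∷ b ∷ c ∷ d ∷ e ∷ [] , u) = uniqueClass a b c d e (uniq⁺ u)

-- Letters 1, ..., 5 return to 0, ..., 4; being below 5 after `pred`, they keep their values under
-- `mod`.
repWord : Fin 26 → Word 5
repWord c = Vec.map (λ a → pred a mod 5) (rep c)

repWord-inClass : ∀ c → Unique (repWord c) × InClass (Vec.map (suc ∘ toℕ) (repWord c)) c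
repWord-inClass = toWitness {a? = all? λ c → unique? (repWord c) ×-dec inClass? (Vec.map (suc ∘ toℕ) (repWord c)) c} tt

inhabited : ∀ c → ∃ λ σ → σ ∈class c
inhabited c = (repWord c , proj₁ (repWord-inClass c)) , proj₂ (repWord-inClass c)

≅-rep : ∀ σ c → σ ∈class c → oneLine σ ≅ rep c
≅-rep σ c (inj₁ i) = All.lookup (lookup⁺ class-equivalent c) i
≅-rep σ c (inj₂ i) = ≅-sym (≅-complement σ) ⊙ All.lookup (lookup⁺ class-equivalent c) i

theorem1p9 : (∀ (σ : Pattern) → ∃! _≡_ λ c → σ ∈class c) ×
    (∀ c → ∃ λ (σ : Pattern) → σ ∈class c) ×
    (∀ (σ τ : Pattern) → σ ≡ᵂ τ ⇔ (∃ λ c → σ ∈class c × τ ∈class c))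
theorem1p9 = uniquely , inhabited , λ σ τ → mk⇔ (separate σ τ) (identify σ τ)
  where
  uniquely : ∀ (σ : Pattern) → ∃! _≡_ λ c → σ ∈class c
  uniquely σ with c , i , only ← class σ = c , i , λ {d} → only d

  identify : ∀ σ τ → (∃ λ c → σ ∈class c × τ ∈class c) → σ ≡ᵂ τ
  identify σ τ (c , i , j) n =
    trans (length-S σ n) (trans (counts (≅-rep σ c i ⊙ ≅-sym (≅-rep τ c j)) n) (sym (length-S τ n)))

  ≡ᵂ⇒count : ∀ σ τ → σ ≡ᵂ τ → ∀ n → .{{NonZero n}} → count (oneLine σ) n ≡ count (oneLine τ) n
  ≡ᵂ⇒count σ τ eq n = trans (sym (length-S σ n)) (trans (eq n) (length-S τ n))

  separate : ∀ σ τ → σ ≡ᵂ τ → ∃ λ c → σ ∈class c × τ ∈class c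
  separate σ τ eq with c , i , _ ← class σ | d , j , _ ← class τ =
    c , i , subst (τ ∈class_) (sym (counts₁₀-injective c d (begin
      lookup counts₁₀ c      ≡⟨ sym (count₁₀ c) ⟩
      count (rep c) 10       ≡⟨ sym (counts (≅-rep σ c i) 10) ⟩
      count (oneLine σ) 10   ≡⟨ ≡ᵂ⇒count σ τ eq 10 ⟩
      count (oneLine τ) 10   ≡⟨ counts (≅-rep τ d j) 10 ⟩
      count (rep d) 10       ≡⟨ count₁₀ d ⟩
      lookup counts₁₀ d      ∎))) j
    where open ≡-Reasoning
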